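{- (i) For all integers $s \geq 0$, $b \geq 0$, $f$ with $0 \leq f \leq s$, there exists a trihex with signature $(s,b,f)$. (ii) Any two trihexes with the same signature are equivalent. (iii) Every trihex can be described with a signature $(s,b,f)$ for some integers $s\geq 0$, $b \geq 0$ and $0 \leq f \leq s$.
   Context: Trihex. A trihex is a finite, connected, 3-regular planar graph, drawn in the plane regarded as part of the oriented sphere $S^2=\mathbb{R}^2\cup\{\infty\}$, whose faces (including the unbounded one) all have three or six sides. Faces with three (six) sides are called triangles (hexagons). Two trihexes are equivalent if there is an orientation-preserving homeomorphism of the sphere taking one graph to the other. Spine. A spine of length $s\ge 0$ is a collection of distinct faces $F_0,F_1,\dots,F_{s+1}$ where $F_0,F_{s+1}$ are triangles, $F_1,\dots,F_s$ are hexagons, and each hexagon $F_i$ ($1\le i\le s$) is adjacent to $F_{i-1}$ and $F_{i+1}$ along opposite edges of $F_i$ (for $s=0$: two triangles sharing an edge). The internal edges are the $s+1$ edges shared by $F_i$ and $F_{i+1}$; all other edges are external. Gluing the faces along the internal edges only gives a closed disc whose boundary is a cycle of $4s+4$ external edges. The head (tail) vertex of the spine is the vertex of $F_0$ (of $F_{s+1}$) that is not on an internal edge. Belt. A belt is a circuit of distinct hexagons in which each hexagon is adjacent to its neighbours along opposite edges (called rungs here). A belt of $2s+2$ hexagons, glued along its rungs only, forms an annulus, each of whose two boundary cycles has $4s+4$ edges, two from each hexagon. Building trihexes. A trihex is formed from two spines of length $s$ with $b\ge 0$ belts between them if the sphere with its faces is obtained from a spine $S$ (closed disc), $b$ successive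 surrounding belts of $2s+2$ hexagons each (annuli), and a second spine $S'$ (closed disc), by gluing consecutive pieces along entire boundary cycles of $4s+4$ edges, vertices to vertices, so that the resulting graph is 3-regular. Offset, $b=0$. Start at the head or tail vertex of one spine and travel counterclockwise around its boundary until the head or tail vertex of the other spine is first met. The number of edges traversed is odd; if it is $2i+1$, the offset is $i \bmod (s+1)$. (This does not depend on the choices.) Offset, $b>0$. Delete the belts one at a time, each time sliding the remaining two parts together along the rungs and then shifting one part clockwise by one edge around the other. Precisely: label the vertices of the boundary cycle of the belt nearer to $S$ counterclockwise around $S$ as $u_0,\dots,u_{4s+3}$, and those of its other boundary cycle as $w_0,\dots,w_{4s+3}$ so that the rungs are the edges $u_{2k}w_{2k}$; remove the belt and identify $w_k$ with $u_{k-1}$ (indices mod $4s+4$). The offset of the original trihex is the offset of the trihex with no belts between the spines obtained at the end. Signature. For $s\ge 0$, $b\ge 0$, $0\le f\le s$, a trihex has signature $(s,b,f)$ if it can be formed from two spines of length $s$ with $b$ belts between them and with offset $f$. A trihex may have more than one signature. -}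

module Defs where

open import Data.Fin.Base using (Fin)
open import Data.Nat.Base
  using (ℕ; zero; suc; _+_; _*_; _<_; _≤_; _%_; ⌊_/2⌋; parity)
open import Data.Nat.Divisibility using (_∣_)
open import Data.Parity.Base using (0ℙ; 1ℙ)
open import Data.Product.Base using (Σ-syntax; ∃; _×_)
open import Data.Product using (∃!)
open import Data.Sum.Base using (_⊎_)
open import Data.Vec.Base using (Vec; []; _∷_; _∷ʳ_; lookup; map)
open import Function.Base using (_∘_)
open import Function.Bundles using (_↔_; _⇔_; module Inverse)
open import Function.Definitions using (StrictlySurjective)
open import Relation.Binary.Construct.Closure.Equivalence using (EqClosure)
open import Relation.Binary.PropositionalEquality.Core using (_≡_; _≢_)
open import Relation.Nullary.Negation.Core using (¬_)
import Function.Endo.Propositional as Endo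

module _ {A : Set} where
  open Endo A using (_^_)

  SameCycle : (A → A) → A → A → Set
  SameCycle f x y = ∃ λ k → (f ^ k) x ≡ y

  CycleLength : (A → A) → A → ℕ → Set
  CycleLength f x n =
    0 < n × (f ^ n) x ≡ x × (∀ k → 0 < k → k < n → (f ^ k) x ≢ x)

  record CycleCount (f : A → A) (n : ℕ) : Set where
    field
      cycleOf    : A → Fin n
      surjective : StrictlySurjective _≡_ cycleOf
      separates  : ∀ x y → cycleOf x ≡ cycleOf y ⇔ SameCycle f x y

-- A connected finite graph (loops and multiple edges allowed) drawn on the
-- oriented sphere, up to orientation-preserving homeomorphism, is a
-- connected combinatorial map of Euler characteristic 2.  A dart is an edge
-- with a direction; σ takes a dart to the next dart counterclockwise around
-- its origin and α reverses a dart.  Vertices, edges and faces are the cycles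
-- of σ, α and φ.

record PlanarMap : Set₁ where
  field
    Dart     : Set
    #darts   : ℕ
    finite   : Dart ↔ Fin #darts
    rotation : Dart ↔ Dart
    α        : Dart → Dart
    α-cycle  : ∀ d → CycleLength α d 2

  σ : Dart → Dart
  σ = Inverse.to rotation

  -- The dart following d on the boundary of the face to the left of d: at
  -- the far end of d, the dart next to α d in clockwise direction.  Thus φ
  -- runs counterclockwise around each face.  A dart is said to lie in the
  -- face on its left.
  φ : Dart → Dart
  φ = Inverse.from rotation ∘ α

  Neighbour : Dart → Dart → Set
  Neighbour d e = σ d ≡ e ⊎ α d ≡ e

  field
    connected : ∀ d e → EqClosure Neighbour d e
    #V #E #F  : ℕ
    vertices  : CycleCount σ #V
    edges     : CycleCount α #E
    faces     : CycleCount φ #F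
    euler     : #V + #F ≡ #E + 2

record Trihex : Set₁ where
  field
    planarMap : PlanarMap
  open PlanarMap planarMap public
  field
    cubic     : ∀ d → CycleLength σ d 3
    faceSizes : ∀ d → CycleLength φ d 3 ⊎ CycleLength φ d 6

-- Preserving σ, not merely the graph, makes this orientation preserving.
record Equivalent (T T′ : Trihex) : Set where
  private
    module T  = Trihex T
    module T′ = Trihex T′
  field
    bijection : T.Dart ↔ T′.Dart
  open Inverse bijection using (to)
  field
    σ-commutes : ∀ d → to (T.σ d) ≡ T′.σ (to d)
    α-commutes : ∀ d → to (T.α d) ≡ T′.α (to d)

module Parts (T : Trihex) where
  open Trihex T
  open Endo Dart using (_^_)

  SameVertex SameFace : Dart → Dart → Set
  SameVertex = SameCycle σ
  SameFace   = SameCycle φ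

  Triangle Hexagon : Dart → Set
  Triangle d = CycleLength φ d 3
  Hexagon  d = CycleLength φ d 6

  -- Enter the face on the other side of d and go to its edge opposite to d,
  -- if that face is a hexagon.
  ahead : Dart → Dart
  ahead d = (φ ^ 3) (α d)

  -- At the origin of φ d, skip one edge.
  skip : Dart → Dart
  skip = φ ∘ α ∘ φ

  -- For the spine whose first internal edge is the dart d of F₀, and i ≤ s + 1:
  -- a dart of Fᵢ, on the edge shared with Fᵢ₋₁ if i > 0.
  spineFace : Dart → ℕ → Dart
  spineFace d zero    = d
  spineFace d (suc i) = α ((ahead ^ i) d)

  record Spine (s : ℕ) : Set where
    field
      first : Dart

    -- For i ≤ s, the dart of Fᵢ on the edge shared by Fᵢ and Fᵢ₊₁.
    internal : ℕ → Dart
    internal i = (ahead ^ i) first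

    face : ℕ → Dart
    face = spineFace first

    field
      triangle₀ : Triangle (face 0)
      hexagons  : ∀ i → 0 < i → i ≤ s → Hexagon (face i)
      triangle₁ : Triangle (face (suc s))
      distinct  : ∀ i j → i ≤ suc s → j ≤ suc s →
                  SameFace (face i) (face j) → i ≡ j

    Contains : Dart → Set
    Contains d = ∃ λ i → i ≤ suc s × SameFace (face i) d

    -- The darts starting at the head and tail vertices; the other two
    -- vertices of each triangle are the ends of its internal edge.
    headDart tailDart : Dart
    headDart = φ (φ first)
    tailDart = φ (φ (α (internal s)))

    -- The external edges, counterclockwise around the disc: boundary j
    -- leads from the j-th boundary vertex to the (j+1)-st, the 0-th being the
    -- head.  It is periodic with period 4s + 4.  The internal edges end
    -- exactly at the odd-numbered vertices; there the boundary passes from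
    -- one face to the next.
    boundary : ℕ → Dart
    boundary zero    = headDart
    boundary (suc j) with parity j
    ... | 0ℙ = skip (boundary j)
    ... | 1ℙ = φ (boundary j)

  -- A belt of m hexagons, oriented so that it has its inner boundary on the
  -- left.  Every belt can be read in this way, starting at any rung.
  record Belt (m : ℕ) : Set where
    field
      first : Dart

    -- Hₖ denotes the face of rung k; rung k lies on the edge shared by Hₖ
    -- and Hₖ₊₁, and is directed from the outer to the inner boundary.
    rung : ℕ → Dart
    rung k = (ahead ^ k) first

    field
      closed   : rung m ≡ first
      hexagons : ∀ k → k < m → Hexagon (rung k)
      distinct : ∀ j k → j < m → k < m → SameFace (rung j) (rung k) → j ≡ k

    Contains : Dart → Set
    Contains d = ∃ λ k → k < m × SameFace (rung k) d

    -- Let rung k lead from w₂ₖ to u₂ₖ, and let u and w number the vertices of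
    -- the inner and outer boundary counterclockwise around the inside of the
    -- belt (indices mod 2m).  As the hexagons are on their left, outer j
    -- leads from wⱼ to wⱼ₊₁, and inner j from uⱼ₊₁ to uⱼ.
    outer inner : ℕ → Dart
    outer j with parity j
    ... | 0ℙ = φ (α (rung ⌊ j /2⌋))
    ... | 1ℙ = φ (φ (α (rung ⌊ j /2⌋)))
    inner j with parity j
    ... | 0ℙ = φ (φ (rung (suc ⌊ j /2⌋)))
    ... | 1ℙ = φ (rung (suc ⌊ j /2⌋))

  -- Glued x Bs cs S′: the boundary x of the part built so far, numbered
  -- counterclockwise around the first spine S, is glued to the first of the
  -- belts Bs, the outer boundary of each belt to the next belt, and that of
  -- the last one to S′.  The shifts cs say how:
  --   * before a belt, vertex j is glued to uⱼ₊c;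
  --   * before S′, vertex j is glued to boundary vertex l of S′ whenever
  --     j + c + l ≡ 0 mod 4s + 4 (counterclockwise around S′ is clockwise
  --     around S).
  Glued : ∀ {s b} → (ℕ → Dart) → Vec (Belt (2 * s + 2)) b → Vec ℕ (suc b) →
          Spine s → Set
  Glued {s} x [] (c ∷ []) S′ =
    ∀ j l → 4 * s + 4 ∣ j + c + suc l → α (x j) ≡ Spine.boundary S′ l
  Glued x (B ∷ Bs) (c ∷ cs) S′ =
    (∀ j → α (x j) ≡ Belt.inner B (j + c)) × Glued (Belt.outer B) Bs cs S′

  record Formation (s b : ℕ) : Set where
    field
      S S′   : Spine s
      belts  : Vec (Belt (2 * s + 2)) b
      shifts : Vec ℕ (suc b)

    pieces : Vec (Dart → Set) (suc (suc b))
    pieces = Spine.Contains S ∷ (map Belt.Contains belts ∷ʳ Spine.Contains S′)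

    field
      partition : ∀ d → ∃! _≡_ λ p → lookup pieces p d
      glued     : Glued (Spine.boundary S) belts shifts S′

  open Formation

  -- Travelling counterclockwise around S from its head, the head or tail of
  -- the other spine is met at the n-th boundary vertex, and not before.
  Meets : ∀ {s} → Formation s 0 → ℕ → Set
  Meets D j = SameVertex x (Spine.headDart (S′ D)) ⊎
              SameVertex x (Spine.tailDart (S′ D))
    where x = Spine.boundary (S D) j

  FirstMeeting : ∀ {s} → Formation s 0 → ℕ → Set
  FirstMeeting D n = Meets D n × (∀ j → j < n → ¬ Meets D j)

open Parts using (Formation; FirstMeeting)
open Parts.Formation using (shifts)

-- Remove the belt next to the first spine and identify wₖ with uₖ₋₁: vertex j
-- of the spine was glued to uⱼ₊c, which becomes wⱼ₊c₊₁, which was glued to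
-- vertex j + c + 1 + c′ of the next piece.
deleteBelt : ∀ {b} → Vec ℕ (suc (suc b)) → Vec ℕ (suc b)
deleteBelt (c ∷ c′ ∷ cs) = (c + 1 + c′) ∷ cs

deleteBelts : ∀ {b} → Vec ℕ (suc b) → Vec ℕ 1
deleteBelts {zero}  cs = cs
deleteBelts {suc b} cs = deleteBelts (deleteBelt cs)

data HasOffset {T : Trihex} {s : ℕ} :
               ∀ {b} → Formation T s b → ℕ → Set₁ where

  noBelts   : ∀ {D : Formation T s 0} i →
              FirstMeeting T D (2 * i + 1) → HasOffset D (i % suc s)

  -- T₀ is the trihex obtained by deleting all the belts.
  someBelts : ∀ {b f} {D : Formation T s (suc b)} →
              (T₀ : Trihex) (D₀ : Formation T₀ s 0) →
              shifts D₀ ≡ deleteBelts (shifts D) →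
              HasOffset D₀ f → HasOffset D f

HasSignature : Trihex → (s b f : ℕ) → Set₁
HasSignature T s b f = Σ[ D ∈ Formation T s b ] HasOffset D f

{-# OPTIONS --safe #-}

-- Passing straight through a face, from one edge to the opposite one (in a
-- triangle, back to the same edge), acts on the darts as a translation of the
-- regular hexagonal tiling.  Starting at a dart of a triangle, these
-- translations develop the tiling, modulo the half turn about that triangle,
-- onto the trihex; as neither φ nor α fixes a dart, only half turns about
-- faces occur, so the edges of the trihex inherit the three directions of the
-- tiling.  Such a chart is determined up to equivalence by its lattice of
-- periods.  A trihex has signature (s, b, f) exactly if, in a suitable chart,
-- this lattice is generated by (2s + 2, 0) and (2x, 2b + 2), where x = f + b + 1:
-- the row 0 of the tiling folds up to the first spine, the rows 1, …, b to the
-- belts, and the row b + 1 to the second spine, which starts at column x.  So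
-- existence amounts to dividing the tiling by this lattice, uniqueness to
-- reading the lattice off a formation, and completeness to the Hermite normal
-- form.  Euler's formula is needed only to find a triangle to start from.

module Submission where

open import Defs
open import Data.Nat.Base using (ℕ; _≤_)
open import Data.Product.Base using (Σ-syntax; ∃-syntax; _×_)

open import Data.Fin.Base using (Fin; zero; suc; toℕ; fromℕ<)
open import Data.Fin.Patterns using (0F; 1F; 2F)
open import Data.Fin.Permutation using (↔⇒≡)
import Data.Fin.Properties as Fin
open import Data.Integer.Base as ℤ using (ℤ; +_; -[1+_]; 0ℤ; 1ℤ; -1ℤ; _+_; _*_; -_; _-_)
import Data.Integer.DivMod as ℤ
import Data.Integer.Properties as ℤ
open import Data.Integer.Tactic.RingSolver using (solve-∀)
open import Data.Nat.Base as ℕ using (zero; suc; _<_; NonZero; z≤n; s≤s; z<s; parity; ⌊_/2⌋)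
open import Data.Nat.Divisibility using (_∣_; divides)
open import Data.Nat.DivMod using (m%n<n; m<n⇒m%n≡m; m≡m%n+[m/n]*n; [m+kn]%n≡m%n)
import Data.Nat.Properties as ℕ
import Data.Nat.Tactic.RingSolver as ℕ-Solver
open import Data.Parity.Base using (0ℙ; 1ℙ)
open import Data.Product.Base using (∃; ∃₂; _,_; proj₁; proj₂)
open import Data.Product.Function.NonDependent.Propositional using (_×-↔_)
open import Data.Sum.Base using (_⊎_; inj₁; inj₂)
open import Data.Sum.Function.Propositional using (_⊎-↔_)
open import Data.Vec.Base using (Vec; []; _∷_; _∷ʳ_; lookup; map)
open import Function.Base using (_∘_)
open import Function.Bundles using (_↔_; Equivalence; Injection; Inverse; mk↔ₛ′; mk⇔)
open import Function.Construct.Composition using (_↔-∘_)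
open import Function.Construct.Identity using (↔-id)
open import Function.Construct.Symmetry using (↔-sym)
import Function.Endo.Propositional as Endo
open import Function.Properties.Inverse using (↔⇒↣)
open import Relation.Binary.Construct.Closure.Equivalence as EqClosure using (EqClosure)
open import Relation.Binary.Construct.Closure.ReflexiveTransitive using (ε; _◅_)
open import Relation.Binary.Construct.Closure.Symmetric using (fwd; bwd)
open import Relation.Binary.Definitions using (DecidableEquality; tri<; tri≈; tri>)
open import Relation.Binary.PropositionalEquality
open import Relation.Nullary using (¬_; Dec; yes; no; contradiction; map′)
open import Relation.Unary using (Decidable)

-- Cycles of maps of finite order

-- The four triangles are the half periods modulo the lattice: `(0, 0)`, `(s + 1, 0)`, `(x, b + 1)`
-- and `(x + s + 1, b + 1)`, the ends of the two spines. Only `x` modulo `s + 1` matters, because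
-- `2x` may be changed by multiples of the width `2s + 2`; this is the modulus of the offset. In
-- `x = f + b + 1`, the 1 arises because boundary vertex `2i + 1` of the first spine lies in column
-- `i + 1`, and the `b` because each deletion of a belt moves the second spine by one column. The
-- tiling is never built as a space. Its translations are words in `φ` and `α`, and that they
-- commute follows from `φ⁶ = α² = (φα)³ = 1`. Conversely, a formation yields the full lattice only
-- because its faces do not repeat: the partition into pieces bounds the periods vertically, the
-- distinctness of the faces of one spine horizontally.

module _ {A : Set} where
  open Endo A using (_^_)

  ^-+ : ∀ (f : A → A) m n x → (f ^ (m ℕ.+ n)) x ≡ (f ^ m) ((f ^ n) x)
  ^-+ f zero    n x = refl
  ^-+ f (suc m) n x = cong f (^-+ f m n x)

  SameCycle-refl : ∀ {f : A → A} {x} → SameCycle f x x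
  SameCycle-refl = 0 , refl

  SameCycle-trans : ∀ {f : A → A} {x y z} → SameCycle f x y → SameCycle f y z → SameCycle f x z
  SameCycle-trans {f} {x} (j , p) (k , q) = k ℕ.+ j , trans (^-+ f k j x) (trans (cong (f ^ k) p) q)

  finite⇒≟ : ∀ {N} → A ↔ Fin N → DecidableEquality A
  finite⇒≟ fin = Fin.inj⇒≟ (↔⇒↣ fin)

  module Periodic (f : A → A) (k : ℕ) (period : ∀ x → (f ^ suc k) x ≡ x) where

    ^-multiple : ∀ q x → (f ^ (q ℕ.* suc k)) x ≡ x
    ^-multiple zero    x = refl
    ^-multiple (suc q) x =
      trans (^-+ f (suc k) (q ℕ.* suc k) x) (trans (period _) (^-multiple q x))

    ^-% : ∀ n x → (f ^ n) x ≡ (f ^ (n ℕ.% suc k)) x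
    ^-% n x = trans (cong (λ j → (f ^ j) x) (m≡m%n+[m/n]*n n (suc k)))
      (trans (^-+ f (n ℕ.% suc k) (n ℕ./ suc k ℕ.* suc k) x)
      (cong (f ^ (n ℕ.% suc k)) (^-multiple (n ℕ./ suc k) x)))

    -- Here `f` has order dividing `suc k`, and `j + j * k = j * suc k`.
    ^-inverse : ∀ j x → (f ^ (j ℕ.* k)) ((f ^ j) x) ≡ x
    ^-inverse j x = trans (sym (^-+ f (j ℕ.* k) j x))
      (trans (cong (λ i → (f ^ i) x) (trans (ℕ.+-comm (j ℕ.* k) j) (sym (ℕ.*-suc j k)))) (^-multiple j x))

    ^-injective : ∀ {x y} j → (f ^ j) x ≡ (f ^ j) y → x ≡ y
    ^-injective {x} {y} j eq =
      trans (sym (^-inverse j x)) (trans (cong (f ^ (j ℕ.* k)) eq) (^-inverse j y))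

    SameCycle-sym : ∀ {x y} → SameCycle f x y → SameCycle f y x
    SameCycle-sym {x} (j , refl) = j ℕ.* k , ^-inverse j x

    SameCycle-dec : DecidableEquality A → ∀ x y → Dec (SameCycle f x y)
    SameCycle-dec _≟A_ x y =
      map′ (λ (i , q) → toℕ i , q)
           (λ (n , q) → fromℕ< (m%n<n n (suc k)) ,
              trans (cong (λ i → (f ^ i) x) (Fin.toℕ-fromℕ< (m%n<n n (suc k))))
                    (trans (sym (^-% n x)) q))
           (Fin.any? (λ i → (f ^ toℕ i) x ≟A y))

    transversal⇒count : ∀ {n} (rep : Fin n → A) →
                        (∀ x → ∃ λ i → SameCycle f (rep i) x) →
                        (∀ i j → SameCycle f (rep i) (rep j) → i ≡ j) → CycleCount f n
    transversal⇒count rep find sep = record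
      { cycleOf    = proj₁ ∘ find
      ; surjective = λ i → rep i , sep _ _ (proj₂ (find (rep i)))
      ; separates  = λ x y → mk⇔
          (λ eq → SameCycle-trans (SameCycle-sym (proj₂ (find x)))
                    (subst (λ i → SameCycle f (rep i) y) (sym eq) (proj₂ (find y))))
          (λ c → sep _ _ (SameCycle-trans (proj₂ (find x))
                    (SameCycle-trans c (SameCycle-sym (proj₂ (find y))))))
      }

    private
      transversal : DecidableEquality A →
                    ∀ {m} (elem : Fin m → A) → ∃ λ n → Σ[ rep ∈ (Fin n → A) ]
                      (∀ i → ∃ λ r → SameCycle f (rep r) (elem i)) ×
                      (∀ r r′ → SameCycle f (rep r) (rep r′) → r ≡ r′)
      transversal _≟A_ {zero} elem = 0 , (λ ()) , (λ ()) , λ ()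
      transversal _≟A_ {suc m} elem
        with n , rep , find , sep ← transversal _≟A_ (elem ∘ suc)
        with Fin.any? (λ r → SameCycle-dec _≟A_ (rep r) (elem zero))
      ... | yes found = n , rep , (λ { zero → found ; (suc i) → find i }) , sep
      ... | no ¬found = suc n , rep′ , find′ , sep′
        where
        rep′ : Fin (suc n) → A
        rep′ zero    = elem zero
        rep′ (suc r) = rep r
        find′ : ∀ i → ∃ λ r → SameCycle f (rep′ r) (elem i)
        find′ zero    = zero , SameCycle-refl
        find′ (suc i) = let r , c = find i in suc r , c
        sep′ : ∀ r r′ → SameCycle f (rep′ r) (rep′ r′) → r ≡ r′
        sep′ zero    zero     c = refl
        sep′ zero    (suc r′) c = contradiction (r′ , SameCycle-sym c) ¬found
        sep′ (suc r) zero     c = contradiction (r , c) ¬found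
        sep′ (suc r) (suc r′) c = cong suc (sep r r′ c)

    cycleCount : ∀ {N} → A ↔ Fin N → ∃ (CycleCount f)
    cycleCount fin
      with n , rep , find , sep ← transversal (finite⇒≟ fin) (Inverse.from fin)
      = n , transversal⇒count rep
              (λ x → let r , c = find (Inverse.to fin x) in
                     r , subst (SameCycle f (rep r)) (Inverse.strictlyInverseʳ fin x) c)
              sep

  -- Double counting: an element is a representative of its cycle together with an exponent below
  -- the common length. This gives the relations between the numbers of darts, vertices, edges and
  -- faces.
  cycles*length : ∀ {N} → A ↔ Fin N → ∀ {f : A → A} {n} k → CycleCount f n →
                  (∀ x → CycleLength f x (suc k)) → n ℕ.* suc k ≡ N
  cycles*length fin {f} {n} k count len = ↔⇒≡ (fin ↔-∘ (bij ↔-∘ Fin.*↔×))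
    where
    open CycleCount count
    module Sep {x} {y} = Equivalence (separates x y)
    open Periodic f k (λ x → proj₁ (proj₂ (len x)))
    rep : Fin n → A
    rep i = proj₁ (surjective i)
    cycleOf-rep : ∀ i → cycleOf (rep i) ≡ i
    cycleOf-rep i = proj₂ (surjective i)
    from : A → Fin n × Fin (suc k)
    from x = cycleOf x , fromℕ< (m%n<n (proj₁ (Sep.to (cycleOf-rep (cycleOf x)))) (suc k))
    toA : Fin n × Fin (suc k) → A
    toA (i , j) = (f ^ toℕ j) (rep i)
    toA-from : ∀ x → toA (from x) ≡ x
    toA-from x =
      let m , eq = Sep.to {rep (cycleOf x)} {x} (cycleOf-rep (cycleOf x)) in
      trans (cong (λ j → (f ^ j) (rep (cycleOf x))) (Fin.toℕ-fromℕ< (m%n<n m (suc k))))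
            (trans (sym (^-% m _)) eq)
    distinct : ∀ x j j′ → j < j′ → j′ < suc k → (f ^ j) x ≢ (f ^ j′) x
    distinct x j j′ j<j′ j′<k eq = proj₂ (proj₂ (len x)) (j′ ℕ.∸ j) (ℕ.m<n⇒0<n∸m j<j′)
      (ℕ.≤-<-trans (ℕ.m∸n≤m j′ j) j′<k)
      (sym (^-injective j (trans eq (trans (cong (λ i → (f ^ i) x) (sym (ℕ.m+[n∸m]≡n (ℕ.<⇒≤ j<j′))))
                                             (^-+ f j (j′ ℕ.∸ j) x)))))
    same-exponent : ∀ x (j j′ : Fin (suc k)) → (f ^ toℕ j) x ≡ (f ^ toℕ j′) x → j ≡ j′
    same-exponent x j j′ eq with ℕ.<-cmp (toℕ j) (toℕ j′)
    ... | tri< lt _ _ = contradiction eq (distinct x _ _ lt (Fin.toℕ<n j′))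
    ... | tri≈ _ e  _ = Fin.toℕ-injective e
    ... | tri> _ _ gt = contradiction (sym eq) (distinct x _ _ gt (Fin.toℕ<n j))
    toA-injective : ∀ p q → toA p ≡ toA q → p ≡ q
    toA-injective (i , j) (i′ , j′) eq
      with refl ← trans (sym (cycleOf-rep i)) (trans
             (trans (Sep.from (toℕ j , refl)) (trans (cong cycleOf eq) (sym (Sep.from (toℕ j′ , refl)))))
             (cycleOf-rep i′))
      = cong (i ,_) (same-exponent (rep i) j j′ eq)
    bij : (Fin n × Fin (suc k)) ↔ A
    bij = mk↔ₛ′ toA from toA-from (λ p → toA-injective _ _ (toA-from (toA p)))

-- Integer induction, parity and remainders

ℤ-ind : (P : ℤ → Set) → P 0ℤ → (∀ i → P i → P (1ℤ + i)) → (∀ i → P i → P (-1ℤ + i)) → ∀ i → P i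
ℤ-ind P z s p (+ zero)        = z
ℤ-ind P z s p (+ suc n)       = s (+ n) (ℤ-ind P z s p (+ n))
ℤ-ind P z s p -[1+ zero ]     = p 0ℤ z
ℤ-ind P z s p -[1+ suc n ]    = p -[1+ n ] (ℤ-ind P z s p -[1+ n ])

evenOrOdd : ∀ i → ∃ λ h → i ≡ h + h ⊎ i ≡ 1ℤ + (h + h)
evenOrOdd = ℤ-ind _ (0ℤ , inj₁ refl)
  (λ { _ (h , inj₁ refl) → h , inj₂ refl
     ; _ (h , inj₂ refl) → 1ℤ + h , inj₁ (up h) })
  (λ { _ (h , inj₁ refl) → -1ℤ + h , inj₂ (down h)
     ; _ (h , inj₂ refl) → h , inj₁ (down′ h) })
  where
  up : ∀ h → 1ℤ + (1ℤ + (h + h)) ≡ (1ℤ + h) + (1ℤ + h)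
  up = solve-∀
  down : ∀ h → -1ℤ + (h + h) ≡ 1ℤ + ((-1ℤ + h) + (-1ℤ + h))
  down = solve-∀
  down′ : ∀ h → -1ℤ + (1ℤ + (h + h)) ≡ h + h
  down′ = solve-∀

-- Besides separating columns and rows, this serves with `m = 2` as the parity argument.
remainder-unique : ∀ {i j m} p → i < m → j < m → + i ≡ + j + p * + m → i ≡ j
remainder-unique {i} {j} {m@(suc _)} p i<m j<m eq = go p eq
  where
  step : ∀ {i j} k → i < m → j < m → + i ≡ + j + + k * + m → i ≡ j
  step {i} {j} k i<m j<m eq = trans (sym (m<n⇒m%n≡m i<m)) (trans
    (cong (ℕ._% m) (ℤ.+-injective (trans eq (cong (λ z → + j + z) (sym (ℤ.pos-* k m))))))
    (trans ([m+kn]%n≡m%n j k m) (m<n⇒m%n≡m j<m)))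
  swap : ∀ a b c d → a ≡ b + - c * d → b ≡ a + c * d
  swap a b c d refl = lemma b c d
    where
    lemma : ∀ b c d → b ≡ b + - c * d + c * d
    lemma = solve-∀
  go : ∀ p → + i ≡ + j + p * + m → i ≡ j
  go (+ k)    eq = step k i<m j<m eq
  go -[1+ k ] eq = sym (step (suc k) j<m i<m (swap (+ i) (+ j) (+ suc k) (+ m) eq))

-- Charts and their periods

-- Translations of the tiling by unit steps are numbered e₀, …, e₅ counterclockwise,
-- and (m , n) stands for m e₀ + n e₄.  The dart at k m n lies in the face centred
-- at (m , n), on the edge in direction eₖ.  In direction eₖ₊₃ it would be
-- at k (- m) (- n), by the half turn about (0 , 0).
record Chart {A : Set} (φ α : A → A) : Set where
  field
    at     : Fin 3 → ℤ → ℤ → A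
    φ-at0  : ∀ m n → φ (at 0F m n) ≡ at 1F m n
    φ-at1  : ∀ m n → φ (at 1F m n) ≡ at 2F m n
    φ-at2  : ∀ m n → φ (at 2F m n) ≡ at 0F (- m) (- n)
    α-at0  : ∀ m n → α (at 0F m n) ≡ at 0F (-1ℤ - m) (- n)
    α-at1  : ∀ m n → α (at 1F m n) ≡ at 1F (- m) (1ℤ - n)
    α-at2  : ∀ m n → α (at 2F m n) ≡ at 2F (1ℤ - m) (1ℤ - n)
    onto   : ∀ e → ∃ λ k → ∃₂ λ m n → at k m n ≡ e
    colour : ∀ {k l m n p q} → at k m n ≡ at l p q → k ≡ l

module ChartProperties {A : Set} {φ α : A → A} (C : Chart φ α) where
  open Endo A using (_^_)
  open Chart C public

  φ³-at : ∀ k m n → (φ ^ 3) (at k m n) ≡ at k (- m) (- n)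
  φ³-at 0F m n rewrite φ-at0 m n | φ-at1 m n = φ-at2 m n
  φ³-at 1F m n rewrite φ-at1 m n | φ-at2 m n = φ-at0 (- m) (- n)
  φ³-at 2F m n rewrite φ-at2 m n | φ-at0 (- m) (- n) = φ-at1 (- m) (- n)

  φ⁶ : ∀ e → (φ ^ 6) e ≡ e
  φ⁶ e with k , m , n , refl ← onto e =
    trans (cong (φ ^ 3) (φ³-at k m n)) (trans (φ³-at k (- m) (- n))
      (cong₂ (at k) (ℤ.neg-involutive m) (ℤ.neg-involutive n)))

  open Periodic φ 5 φ⁶ using () renaming (SameCycle-sym to SameFace-sym) public

  -- This and the next three lemmas exhibit words in `φ` and `α` that act on the darts of colour 0
  -- as the translations by e₀, e₃, e₁ and e₄.
  ahead-at : ∀ m n → (φ ^ 3) (α (at 0F m n)) ≡ at 0F (1ℤ + m) n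
  ahead-at m n rewrite α-at0 m n = trans (φ³-at 0F _ _) (cong₂ (at 0F) (lemma m) (ℤ.neg-involutive n))
    where
    lemma : ∀ m → - (-1ℤ - m) ≡ 1ℤ + m
    lemma = solve-∀

  behind-at : ∀ m n → α ((φ ^ 3) (at 0F m n)) ≡ at 0F (-1ℤ + m) n
  behind-at m n = trans (cong α (φ³-at 0F m n)) (trans (α-at0 _ _)
    (cong₂ (at 0F) (cong (λ z → -1ℤ + z) (ℤ.neg-involutive m)) (ℤ.neg-involutive n)))

  above-at : ∀ m n → φ (φ (α (φ (at 0F m n)))) ≡ at 0F m (-1ℤ + n)
  above-at m n rewrite φ-at0 m n | α-at1 m n | φ-at1 (- m) (1ℤ - n) =
    trans (φ-at2 _ _) (cong₂ (at 0F) (ℤ.neg-involutive m) (lemma n))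
    where
    lemma : ∀ n → - (1ℤ - n) ≡ -1ℤ + n
    lemma = solve-∀

  below-at : ∀ m n → (φ ^ 3) (φ (φ (α (φ ((φ ^ 3) (at 0F m n)))))) ≡ at 0F m (1ℤ + n)
  below-at m n =
    trans (cong (λ e → (φ ^ 3) (φ (φ (α (φ e))))) (φ³-at 0F m n))
      (trans (cong (φ ^ 3) (above-at (- m) (- n)))
        (trans (φ³-at 0F (- m) (-1ℤ - n)) (cong₂ (at 0F) (ℤ.neg-involutive m) (lemma n))))
    where
    lemma : ∀ n → - (-1ℤ - n) ≡ 1ℤ + n
    lemma = solve-∀

  -- Translations are words in `φ` and `α`, so applying them to both sides preserves a coincidence.
  -- This makes the periods a group that governs all coincidences.
  translate : ∀ i j {m n p q} → at 0F m n ≡ at 0F p q → at 0F (i + m) (j + n) ≡ at 0F (i + p) (j + q)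
  translate i j {m} {n} {p} {q} eq = horizontally i (vertically j eq)
    where
    recast : ∀ {a b a′ b′ c c′ d d′} → at 0F a b ≡ at 0F a′ b′ → a ≡ c → b ≡ d → a′ ≡ c′ → b′ ≡ d′ →
         at 0F c d ≡ at 0F c′ d′
    recast eq refl refl refl refl = eq
    horizontally : ∀ i {m n p q} → at 0F m n ≡ at 0F p q → at 0F (i + m) n ≡ at 0F (i + p) q
    horizontally i {m} {n} {p} {q} eq = ℤ-ind (λ i → at 0F (i + m) n ≡ at 0F (i + p) q)
      (recast eq (sym (ℤ.+-identityˡ m)) refl (sym (ℤ.+-identityˡ p)) refl)
      (λ i eq → recast (trans (sym (ahead-at _ _)) (trans (cong ((φ ^ 3) ∘ α) eq) (ahead-at _ _)))
                   (sym (ℤ.+-assoc 1ℤ i m)) refl (sym (ℤ.+-assoc 1ℤ i p)) refl)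
      (λ i eq → recast (trans (sym (behind-at _ _)) (trans (cong (α ∘ (φ ^ 3)) eq) (behind-at _ _)))
                   (sym (ℤ.+-assoc -1ℤ i m)) refl (sym (ℤ.+-assoc -1ℤ i p)) refl) i
    vertically : ∀ j {m n p q} → at 0F m n ≡ at 0F p q → at 0F m (j + n) ≡ at 0F p (j + q)
    vertically j {m} {n} {p} {q} eq = ℤ-ind (λ j → at 0F m (j + n) ≡ at 0F p (j + q))
      (recast eq refl (sym (ℤ.+-identityˡ n)) refl (sym (ℤ.+-identityˡ q)))
      (λ j eq → recast (trans (sym (below-at _ _)) (trans
                      (cong (λ e → (φ ^ 3) (φ (φ (α (φ ((φ ^ 3) e)))))) eq) (below-at _ _)))
                   refl (sym (ℤ.+-assoc 1ℤ j n)) refl (sym (ℤ.+-assoc 1ℤ j q)))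
      (λ j eq → recast (trans (sym (above-at _ _)) (trans (cong (λ e → φ (φ (α (φ e)))) eq) (above-at _ _)))
                   refl (sym (ℤ.+-assoc -1ℤ j n)) refl (sym (ℤ.+-assoc -1ℤ j q))) j

  colour0 : ∀ k {m n p q} → at k m n ≡ at k p q → at 0F m n ≡ at 0F p q
  colour0 0F eq = eq
  colour0 1F {m} {n} {p} {q} eq = Periodic.^-injective φ 5 φ⁶ 1
    (trans (φ-at0 m n) (trans eq (sym (φ-at0 p q))))
  colour0 2F {m} {n} {p} {q} eq = colour0 1F (Periodic.^-injective φ 5 φ⁶ 1
    (trans (φ-at1 m n) (trans eq (sym (φ-at1 p q)))))

  anyColour : ∀ k {m n p q} → at 0F m n ≡ at 0F p q → at k m n ≡ at k p q
  anyColour 0F eq = eq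
  anyColour 1F {m} {n} {p} {q} eq = trans (sym (φ-at0 m n)) (trans (cong φ eq) (φ-at0 p q))
  anyColour 2F {m} {n} {p} {q} eq = trans (sym (φ-at1 m n)) (trans (cong φ (anyColour 1F eq)) (φ-at1 p q))

  -- Coincidences with the dart at the origin are enough: `translate` moves them anywhere, `φ`
  -- carries them to the other colours, and `colour` excludes those between different colours.
  Period : ℤ → ℤ → Set
  Period m n = at 0F m n ≡ at 0F 0ℤ 0ℤ

  private
    cancel : ∀ a b → b + (a - b) ≡ a
    cancel = solve-∀
    cancel′ : ∀ a b → - b + a ≡ a - b
    cancel′ = solve-∀
    cancel″ : ∀ b → - b + b ≡ 0ℤ
    cancel″ = solve-∀

  period⇒≡ : ∀ k {m n p q} → Period (m - p) (n - q) → at k m n ≡ at k p q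
  period⇒≡ k {m} {n} {p} {q} per = anyColour k
    (subst₂ _≡_ (cong₂ (at 0F) (cancel m p) (cancel n q))
                (cong₂ (at 0F) (ℤ.+-identityʳ p) (ℤ.+-identityʳ q)) (translate p q per))

  ≡⇒period : ∀ k {m n p q} → at k m n ≡ at k p q → Period (m - p) (n - q)
  ≡⇒period k {m} {n} {p} {q} eq =
    subst₂ _≡_ (cong₂ (at 0F) (cancel′ m p) (cancel′ n q))
               (cong₂ (at 0F) (cancel″ p) (cancel″ q)) (translate (- p) (- q) (colour0 k eq))

  Period-+ : ∀ {m n p q} → Period m n → Period p q → Period (m + p) (n + q)
  Period-+ {m} {n} {p} {q} per per′ = trans (translate m n per′)
    (trans (cong₂ (at 0F) (ℤ.+-identityʳ m) (ℤ.+-identityʳ n)) per)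

  Period-neg : ∀ {m n} → Period m n → Period (- m) (- n)
  Period-neg {m} {n} per = trans (sym (φ³-at 0F m n)) (trans (cong (φ ^ 3) per) (φ³-at 0F 0ℤ 0ℤ))

  Period-* : ∀ i {m n} → Period m n → Period (i * m) (i * n)
  Period-* i {m} {n} per = ℤ-ind (λ i → Period (i * m) (i * n))
    (cong₂ (at 0F) (ℤ.*-zeroˡ m) (ℤ.*-zeroˡ n))
    (λ i per′ → subst₂ Period (lemma i m) (lemma i n) (Period-+ per per′))
    (λ i per′ → subst₂ Period (lemma′ i m) (lemma′ i n) (Period-+ (Period-neg per) per′)) i
    where
    lemma : ∀ i m → m + i * m ≡ (1ℤ + i) * m
    lemma = solve-∀
    lemma′ : ∀ i m → - m + i * m ≡ (-1ℤ + i) * m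
    lemma′ = solve-∀

  SameFace-at : ∀ k m n → SameCycle φ (at 0F m n) (at k m n)
  SameFace-at 0F m n = 0 , refl
  SameFace-at 1F m n = 1 , φ-at0 m n
  SameFace-at 2F m n = 2 , trans (cong φ (φ-at0 m n)) (φ-at1 m n)

  SameFace-neg : ∀ m n → SameCycle φ (at 0F m n) (at 0F (- m) (- n))
  SameFace-neg m n = 3 , φ³-at 0F m n

  -- Going around a face, colour 0 recurs every three steps, alternately at `(m , n)` and, turned,
  -- at `(- m , - n)`. The two cases are a translation and a half turn.
  SameFace⇒ : ∀ {m n p q} → SameCycle φ (at 0F m n) (at 0F p q) →
              Period (m - p) (n - q) ⊎ Period (m + p) (n + q)
  SameFace⇒ {m} {n} {p} {q} (j , eq) with orbit j
    where
    neg² : ∀ k m n → at k (- - m) (- - n) ≡ at k m n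
    neg² k m n = cong₂ (at k) (ℤ.neg-involutive m) (ℤ.neg-involutive n)
    orbit : ∀ j → ∃ λ k → (φ ^ j) (at 0F m n) ≡ at k m n ⊎ (φ ^ j) (at 0F m n) ≡ at k (- m) (- n)
    orbit zero = 0F , inj₁ refl
    orbit (suc j) with orbit j
    ... | 0F , inj₁ eq = 1F , inj₁ (trans (cong φ eq) (φ-at0 _ _))
    ... | 1F , inj₁ eq = 2F , inj₁ (trans (cong φ eq) (φ-at1 _ _))
    ... | 2F , inj₁ eq = 0F , inj₂ (trans (cong φ eq) (φ-at2 _ _))
    ... | 0F , inj₂ eq = 1F , inj₂ (trans (cong φ eq) (φ-at0 _ _))
    ... | 1F , inj₂ eq = 2F , inj₂ (trans (cong φ eq) (φ-at1 _ _))
    ... | 2F , inj₂ eq = 0F , inj₁ (trans (cong φ eq) (trans (φ-at2 _ _) (neg² 0F m n)))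
  ... | k , inj₁ eq′ with refl ← colour (trans (sym eq) eq′) =
    inj₁ (≡⇒period 0F (trans (sym eq′) eq))
  ... | k , inj₂ eq′ with refl ← colour (trans (sym eq) eq′) =
    inj₂ (subst₂ Period (lemma m p) (lemma n q) (Period-neg (≡⇒period 0F (trans (sym eq′) eq))))
    where
    lemma : ∀ m p → - (- m - p) ≡ m + p
    lemma = solve-∀

  -- The half turn about the origin followed by a period is the half turn about half that period. If
  -- a coordinate is odd, that point is the midpoint of an edge, and `α` fixes a dart there; the
  -- three odd parity patterns belong to the three colours.
  even-period : (∀ e → α e ≢ e) → ∀ {m n} → Period m n → ∃₂ λ i j → m ≡ i + i × n ≡ j + j
  even-period α-free {m} {n} per with evenOrOdd m | evenOrOdd n
  ... | i , inj₁ refl | j , inj₁ refl = i , j , refl , refl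
  ... | i , inj₂ refl | j , inj₁ refl = contradiction
    (trans (α-at0 (-1ℤ - i) (- j)) (period⇒≡ 0F (subst₂ Period (l₁ i) (l₂ j) per))) (α-free _)
    where
    l₁ : ∀ i → 1ℤ + (i + i) ≡ -1ℤ - (-1ℤ - i) - (-1ℤ - i)
    l₁ = solve-∀
    l₂ : ∀ j → j + j ≡ - - j - - j
    l₂ = solve-∀
  ... | i , inj₁ refl | j , inj₂ refl = contradiction
    (trans (α-at1 (- i) (- j)) (period⇒≡ 1F (subst₂ Period (l₁ i) (l₂ j) per))) (α-free _)
    where
    l₁ : ∀ j → j + j ≡ - - j - - j
    l₁ = solve-∀
    l₂ : ∀ i → 1ℤ + (i + i) ≡ 1ℤ - - i - - i
    l₂ = solve-∀
  ... | i , inj₂ refl | j , inj₂ refl = contradiction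
    (trans (α-at2 (- i) (- j)) (period⇒≡ 2F (subst₂ Period (l₁ i) (l₁ j) per))) (α-free _)
    where
    l₁ : ∀ i → 1ℤ + (i + i) ≡ 1ℤ - - i - - i
    l₁ = solve-∀

-- The developing map

module _ {A : Set} (f g : A → A) (f∘g : ∀ x → f (g x) ≡ x) (g∘f : ∀ x → g (f x) ≡ x) where
  open Endo A using (_^_)

  power : ℤ → A → A
  power (+ n)    = f ^ n
  power -[1+ n ] = g ^ suc n

  power-suc : ∀ i x → power (1ℤ + i) x ≡ f (power i x)
  power-suc (+ n)        x = refl
  power-suc -[1+ zero ]  x = sym (f∘g x)
  power-suc -[1+ suc n ] x = sym (f∘g _)

  power-pred : ∀ i x → power (-1ℤ + i) x ≡ g (power i x)
  power-pred (+ zero)     x = refl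
  power-pred (+ suc n)    x = sym (g∘f _)
  power-pred -[1+ n ]     x = refl

module _ {A : Set} (φ α : A → A) where
  open Endo A using (_^_)

  -- These are the defining relations of the rotation group of the hexagonal tiling.
  module HexagonalRelations (φ⁶ : ∀ x → (φ ^ 6) x ≡ x) (α² : ∀ x → α (α x) ≡ x)
                   (φα³ : ∀ x → φ (α (φ (α (φ (α x))))) ≡ x) where

    private
      -- This and `αφα` are `(φα)³ = 1` solved for half of the word, with `φ ^ 5` in the role of the
      -- inverse of `φ`.
      φαφ : ∀ x → φ (α (φ x)) ≡ α ((φ ^ 5) (α x))
      φαφ x = trans (cong (λ y → φ (α (φ y))) (sym (α² x)))
        (trans (sym (α² _)) (cong α (trans (sym (φ⁶ _)) (cong (φ ^ 5) (φα³ (α x))))))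

      αφα : ∀ x → α (φ (α x)) ≡ (φ ^ 5) (α ((φ ^ 5) x))
      αφα x = trans (cong (λ y → α (φ (α y))) (sym (trans (cong φ (α² _)) (φ⁶ x))))
        (trans (sym (φ⁶ _)) (cong (φ ^ 5) (φα³ (α ((φ ^ 5) x)))))

    -- Steps relative to the direction of the dart: for a dart in direction e₀ they are e₀, e₃, e₄
    -- and e₁. In `down`, the powers `φ ^ 5` and `φ ^ 4` stand for the inverses of `φ` and `φ ^ 2`,
    -- so that it undoes `up`.
    right left down up : A → A
    right = (φ ^ 3) ∘ α
    left  = α ∘ (φ ^ 3)
    down  = (φ ^ 5) ∘ α ∘ (φ ^ 4)
    up    = φ ∘ φ ∘ α ∘ φ

    right-left : ∀ x → right (left x) ≡ x
    right-left x = trans (cong (φ ^ 3) (α² _)) (φ⁶ x)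

    left-right : ∀ x → left (right x) ≡ x
    left-right x = trans (cong α (φ⁶ _)) (α² x)

    down-up : ∀ x → down (up x) ≡ x
    down-up x = trans (cong (φ ^ 5) (trans (cong α (φ⁶ _)) (α² _))) (φ⁶ x)

    up-down : ∀ x → up (down x) ≡ x
    up-down x = trans (cong (λ y → φ (φ (α y))) (φ⁶ _)) (trans (cong (φ ^ 2) (α² _)) (φ⁶ x))

    -- That the two generating translations commute is what allows a dart to be addressed by a pair
    -- of integers.
    down-right : ∀ x → down (right x) ≡ right (down x)
    down-right x = trans (cong (λ y → (φ ^ 5) (α y)) (φ⁶ _))
      (trans (cong (φ ^ 5) (αφα x))
        (trans (cong (φ ^ 4) (φ⁶ _))
          (cong (φ ^ 3) (φαφ _))))

    up-right : ∀ x → up (right x) ≡ right (up x)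
    up-right x = trans (cong (λ y → up (right y)) (sym (down-up x)))
      (trans (cong up (sym (down-right (up x)))) (up-down _))

    φ³-right : ∀ x → (φ ^ 3) (right x) ≡ left ((φ ^ 3) x)
    φ³-right x = trans (φ⁶ _) (sym (cong α (φ⁶ x)))

    φ³-left : ∀ x → (φ ^ 3) (left x) ≡ right ((φ ^ 3) x)
    φ³-left x = refl

    φ³-down : ∀ x → (φ ^ 3) (down x) ≡ up ((φ ^ 3) x)
    φ³-down x = cong (φ ^ 2) (φ⁶ _)

    φ³-up : ∀ x → (φ ^ 3) (up x) ≡ down ((φ ^ 3) x)
    φ³-up x = cong (λ y → (φ ^ 5) (α (φ y))) (sym (φ⁶ x))

    -- Seen from `x`, the step `up` taken after the rotation `φ` goes in direction e₂, and e₂ = e₁ +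
    -- e₃.
    up-φ : ∀ x → up (φ x) ≡ φ (up (left x))
    up-φ x = sym (trans (cong (φ ^ 3) (lemma x)) (φ⁶ _))
      where
      lemma : ∀ x → α (φ (α ((φ ^ 3) x))) ≡ (φ ^ 5) (α (φ (φ x)))
      lemma x = trans (αφα ((φ ^ 3) x)) (cong (λ y → (φ ^ 5) (α (φ (φ y)))) (φ⁶ x))

    module Development (d : A) (triangle : (φ ^ 3) d ≡ d) (φ-free : ∀ e → φ e ≢ e)
                       (generated : ∀ (P : A → Set) → P d → (∀ e → P e → P (φ e)) →
                                    (∀ e → P e → P (α e)) → ∀ e → P e) where

      abstract
        -- The vertical steps are taken first, so that horizontal steps act on the coordinates by
        -- construction; for the vertical ones this needs commutation.
        at₀ : ℤ → ℤ → A
        at₀ m n = power right left right-left left-right m (power down up down-up up-down n d)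

        at₀-origin : at₀ 0ℤ 0ℤ ≡ d
        at₀-origin = refl

        right-at : ∀ m n → right (at₀ m n) ≡ at₀ (1ℤ + m) n
        right-at m n = sym (power-suc right left right-left left-right m _)

        left-at : ∀ m n → left (at₀ m n) ≡ at₀ (-1ℤ + m) n
        left-at m n = sym (power-pred right left right-left left-right m _)

        up-at-0 : ∀ n → up (at₀ 0ℤ n) ≡ at₀ 0ℤ (-1ℤ + n)
        up-at-0 n = sym (power-pred down up down-up up-down n d)

      up-at : ∀ m n → up (at₀ m n) ≡ at₀ m (-1ℤ + n)
      up-at m n = ℤ-ind (λ m → up (at₀ m n) ≡ at₀ m (-1ℤ + n))
        (up-at-0 n)
        (λ i eq → trans (cong up (sym (right-at i n)))
                   (trans (up-right _) (trans (cong right eq) (right-at i _))))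
        (λ i eq → trans (cong up (sym (left-at i n)))
                   (trans (up-left _) (trans (cong left eq) (left-at i _)))) m
        where
        up-left : ∀ x → up (left x) ≡ left (up x)
        up-left x = trans (sym (left-right _))
          (cong left (trans (sym (up-right (left x))) (cong up (right-left x))))

      down-at : ∀ m n → down (at₀ m n) ≡ at₀ m (1ℤ + n)
      down-at m n = trans (cong (λ i → down (at₀ m i)) (lemma n))
        (trans (cong down (sym (up-at m (1ℤ + n)))) (down-up _))
        where
        lemma : ∀ n → n ≡ -1ℤ + (1ℤ + n)
        lemma = solve-∀

      -- Conjugation by `φ ^ 3` inverts every translation, and `φ ^ 3` fixes the origin because `d`
      -- lies in a triangle. So `φ ^ 3` acts as the half turn about the origin.
      φ³-at₀ : ∀ m n → (φ ^ 3) (at₀ m n) ≡ at₀ (- m) (- n)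
      φ³-at₀ m n = ℤ-ind (λ m → (φ ^ 3) (at₀ m n) ≡ at₀ (- m) (- n))
        (ℤ-ind (λ n → (φ ^ 3) (at₀ 0ℤ n) ≡ at₀ 0ℤ (- n))
          (trans (cong (φ ^ 3) at₀-origin) (trans triangle (sym at₀-origin)))
          (λ j eq → trans (cong (φ ^ 3) (sym (down-at 0ℤ j))) (trans (φ³-down _) (trans (cong up eq)
            (trans (up-at 0ℤ _) (cong (at₀ 0ℤ) (neg-suc j))))))
          (λ j eq → trans (cong (φ ^ 3) (sym (up-at 0ℤ j))) (trans (φ³-up _) (trans (cong down eq)
            (trans (down-at 0ℤ _) (cong (at₀ 0ℤ) (neg-pred j)))))) n)
        (λ i eq → trans (cong (φ ^ 3) (sym (right-at i n))) (trans (φ³-right _) (trans (cong left eq)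
            (trans (left-at _ _) (cong (λ i → at₀ i (- n)) (neg-suc i))))))
        (λ i eq → trans (cong (φ ^ 3) (sym (left-at i n))) (trans (φ³-left _) (trans (cong right eq)
            (trans (right-at _ _) (cong (λ i → at₀ i (- n)) (neg-pred i)))))) m
        where
        neg-suc : ∀ i → -1ℤ + - i ≡ - (1ℤ + i)
        neg-suc = solve-∀
        neg-pred : ∀ i → 1ℤ + - i ≡ - (-1ℤ + i)
        neg-pred = solve-∀

      -- Reversing an edge is a unit step combined with a half turn: `α ∘ φ` is `φ ^ 4` after `up`,
      -- `α ∘ φ ∘ φ` is `φ ^ 5` after `up ∘ left`, and `α` is `left` after `φ ^ 3`.
      at₁-α : ∀ m n → α (φ (at₀ m n)) ≡ φ (at₀ (- m) (1ℤ - n))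
      at₁-α m n = trans (sym (φ⁶ _)) (trans (cong (φ ^ 4) (up-at m n))
        (cong φ (trans (φ³-at₀ m (-1ℤ + n)) (cong (at₀ (- m)) (lemma n)))))
        where
        lemma : ∀ n → - (-1ℤ + n) ≡ 1ℤ - n
        lemma = solve-∀

      at₂-α : ∀ m n → α (φ (φ (at₀ m n))) ≡ φ (φ (at₀ (1ℤ - m) (1ℤ - n)))
      at₂-α m n = trans (sym (φ⁶ _)) (trans (cong (φ ^ 4) (trans (up-φ (at₀ m n))
        (cong φ (trans (cong up (left-at m n)) (up-at _ n)))))
        (cong (φ ^ 2) (trans (φ³-at₀ (-1ℤ + m) (-1ℤ + n)) (cong₂ at₀ (lemma m) (lemma n)))))
        where
        lemma : ∀ n → - (-1ℤ + n) ≡ 1ℤ - n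
        lemma = solve-∀

      at₀-α : ∀ m n → α (at₀ m n) ≡ at₀ (-1ℤ - m) (- n)
      at₀-α m n = trans (cong α (sym (φ⁶ _))) (trans (cong left (φ³-at₀ m n)) (left-at _ _))

      at : Fin 3 → ℤ → ℤ → A
      at 0F m n = at₀ m n
      at 1F m n = φ (at₀ m n)
      at 2F m n = φ (φ (at₀ m n))

      Reached : A → Set
      Reached e = ∃ λ k → ∃₂ λ m n → at k m n ≡ e

      reached : ∀ e → Reached e
      reached = generated Reached (0F , 0ℤ , 0ℤ , at₀-origin) φ-reached α-reached
        where
        φ-reached : ∀ e → Reached e → Reached (φ e)
        φ-reached _ (0F , m , n , refl) = 1F , m , n , refl
        φ-reached _ (1F , m , n , refl) = 2F , m , n , refl
        φ-reached _ (2F , m , n , refl) = 0F , _ , _ , sym (φ³-at₀ m n)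
        α-reached : ∀ e → Reached e → Reached (α e)
        α-reached _ (0F , m , n , refl) = 0F , _ , _ , sym (at₀-α m n)
        α-reached _ (1F , m , n , refl) = 1F , _ , _ , sym (at₁-α m n)
        α-reached _ (2F , m , n , refl) = 2F , _ , _ , sym (at₂-α m n)

      -- Moving both darts by the same word turns such a coincidence into a fixed
      -- point of φ.
      at₀≢at₁ : ∀ m n p q → at₀ m n ≢ φ (at₀ p q)
      at₀≢at₁ m n p q eq = φ-free (at₀ (j + p) (j + (- i + q))) (sym
        (trans (cong₂ at₀ (column m n p q) (row m n p q))
        (vertically j _ n p (- i + q) (horizontally i m n p q eq))))
        where
        -- A horizontal step of the left dart moves the right one, whose frame is rotated by `φ`,
        -- along e₁; a step along e₄ moves it along e₅ = e₀ + e₄. The values solve `i + m = j + p`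
        -- and `j + n = j - i + q`, making both positions equal.
        i j : ℤ
        i = q - n
        j = i + m - p
        column : ∀ m n p q → (q - n + m - p) + p ≡ (q - n) + m
        column = solve-∀
        row : ∀ m n p q → (q - n + m - p) + (- (q - n) + q) ≡ (q - n + m - p) + n
        row = solve-∀
        right-φ : ∀ m n → right (φ (at₀ m n)) ≡ φ (at₀ m (-1ℤ + n))
        right-φ m n = cong φ (up-at m n)
        left-φ : ∀ m n → left (φ (at₀ m n)) ≡ φ (at₀ m (1ℤ + n))
        left-φ m n = trans (cong (left ∘ φ) (sym (trans (up-at m (1ℤ + n)) (cong (at₀ m) (lemma n)))))
                           (left-right _)
          where
          lemma : ∀ n → -1ℤ + (1ℤ + n) ≡ n
          lemma = solve-∀
        up-φ-at : ∀ m n → up (φ (at₀ m n)) ≡ φ (at₀ (-1ℤ + m) (-1ℤ + n))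
        up-φ-at m n = trans (up-φ _) (cong φ (trans (cong up (left-at m n)) (up-at _ n)))
        down-φ : ∀ m n → down (φ (at₀ m n)) ≡ φ (at₀ (1ℤ + m) (1ℤ + n))
        down-φ m n = trans
          (cong down (sym (trans (up-φ-at (1ℤ + m) (1ℤ + n)) (cong φ (cong₂ at₀ (lemma m) (lemma n))))))
          (down-up _)
          where
          lemma : ∀ n → -1ℤ + (1ℤ + n) ≡ n
          lemma = solve-∀
        horizontally : ∀ i m n p q → at₀ m n ≡ φ (at₀ p q) → at₀ (i + m) n ≡ φ (at₀ p (- i + q))
        horizontally i m n p q eq = ℤ-ind (λ i → at₀ (i + m) n ≡ φ (at₀ p (- i + q)))
          (trans (cong (λ i → at₀ i n) (ℤ.+-identityˡ m))
            (trans eq (cong (φ ∘ at₀ p) (sym (ℤ.+-identityˡ q)))))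
          (λ i eq → trans (cong (λ i → at₀ i n) (ℤ.+-assoc 1ℤ i m))
            (trans (sym (right-at (i + m) n)) (trans (cong right eq)
              (trans (right-φ p (- i + q)) (cong (φ ∘ at₀ p) (lemma i q))))))
          (λ i eq → trans (cong (λ i → at₀ i n) (ℤ.+-assoc -1ℤ i m))
            (trans (sym (left-at (i + m) n)) (trans (cong left eq)
              (trans (left-φ p (- i + q)) (cong (φ ∘ at₀ p) (lemma′ i q)))))) i
          where
          lemma : ∀ i q → -1ℤ + (- i + q) ≡ - (1ℤ + i) + q
          lemma = solve-∀
          lemma′ : ∀ i q → 1ℤ + (- i + q) ≡ - (-1ℤ + i) + q
          lemma′ = solve-∀
        vertically : ∀ j m n p q → at₀ m n ≡ φ (at₀ p q) → at₀ m (j + n) ≡ φ (at₀ (j + p) (j + q))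
        vertically j m n p q eq = ℤ-ind (λ j → at₀ m (j + n) ≡ φ (at₀ (j + p) (j + q)))
          (trans (cong (at₀ m) (ℤ.+-identityˡ n))
            (trans eq (cong φ (cong₂ at₀ (sym (ℤ.+-identityˡ p)) (sym (ℤ.+-identityˡ q))))))
          (λ j eq → trans (cong (at₀ m) (ℤ.+-assoc 1ℤ j n))
            (trans (sym (down-at m (j + n))) (trans (cong down eq)
              (trans (down-φ (j + p) (j + q))
              (cong φ (cong₂ at₀ (sym (ℤ.+-assoc 1ℤ j p)) (sym (ℤ.+-assoc 1ℤ j q))))))))
          (λ j eq → trans (cong (at₀ m) (ℤ.+-assoc -1ℤ j n))
            (trans (sym (up-at m (j + n))) (trans (cong up eq)
              (trans (up-φ-at (j + p) (j + q))
              (cong φ (cong₂ at₀ (sym (ℤ.+-assoc -1ℤ j p)) (sym (ℤ.+-assoc -1ℤ j q)))))))) j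

      at-colour : ∀ k l m n p q → at k m n ≡ at l p q → k ≡ l
      at-colour 0F 0F m n p q eq = refl
      at-colour 1F 1F m n p q eq = refl
      at-colour 2F 2F m n p q eq = refl
      at-colour 0F 1F m n p q eq = contradiction eq (at₀≢at₁ m n p q)
      at-colour 1F 2F m n p q eq =
        contradiction (Periodic.^-injective φ 5 φ⁶ 1 eq) (at₀≢at₁ m n p q)
      at-colour 2F 0F m n p q eq =
        contradiction (trans (sym (φ³-at₀ m n)) (cong φ eq)) (at₀≢at₁ (- m) (- n) p q)
      at-colour 1F 0F m n p q eq = sym (at-colour 0F 1F p q m n (sym eq))
      at-colour 2F 1F m n p q eq = sym (at-colour 1F 2F p q m n (sym eq))
      at-colour 0F 2F m n p q eq = sym (at-colour 2F 0F p q m n (sym eq))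

      developed : Chart φ α
      developed = record
        { at     = at
        ; φ-at0  = λ _ _ → refl
        ; φ-at1  = λ _ _ → refl
        ; φ-at2  = φ³-at₀
        ; α-at0  = at₀-α
        ; α-at1  = at₁-α
        ; α-at2  = at₂-α
        ; onto   = reached
        ; colour = at-colour _ _ _ _ _ _
        }

-- The hexagonal relations in a trihex, and the existence of a triangle

module TrihexProperties (T : Trihex) where
  open Trihex T public
  open Parts T public
  open Endo Dart using (_^_) public

  σ⁻¹ : Dart → Dart
  σ⁻¹ = Inverse.from rotation

  α² : ∀ d → α (α d) ≡ d
  α² d = proj₁ (proj₂ (α-cycle d))

  α-free : ∀ d → α d ≢ d
  α-free d = proj₂ (proj₂ (α-cycle d)) 1 z<s (s≤s z<s)

  φα : ∀ d → φ (α d) ≡ σ⁻¹ d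
  φα d = cong σ⁻¹ (α² d)

  σ⁻¹-cubed : ∀ d → σ⁻¹ (σ⁻¹ (σ⁻¹ d)) ≡ d
  σ⁻¹-cubed d = trans (cong (σ⁻¹ ∘ σ⁻¹ ∘ σ⁻¹) (sym (proj₁ (proj₂ (cubic d)))))
    (trans (cong (σ⁻¹ ∘ σ⁻¹) (Inverse.strictlyInverseʳ rotation _))
      (trans (cong σ⁻¹ (Inverse.strictlyInverseʳ rotation _)) (Inverse.strictlyInverseʳ rotation _)))

  σ≡σ⁻¹² : ∀ d → σ d ≡ σ⁻¹ (σ⁻¹ d)
  σ≡σ⁻¹² d = trans (sym (σ⁻¹-cubed (σ d))) (cong (σ⁻¹ ∘ σ⁻¹) (Inverse.strictlyInverseʳ rotation d))

  -- Since `φα` is the inverse of `σ`, which has order 3, `σ` is its square. Hence maps that respect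
  -- `φ` and `α` respect `σ`.
  σ≡φαφα : ∀ d → σ d ≡ φ (α (φ (α d)))
  σ≡φαφα d = trans (σ≡σ⁻¹² d) (sym (trans (φα _) (cong σ⁻¹ (φα d))))

  φα³ : ∀ d → φ (α (φ (α (φ (α d))))) ≡ d
  φα³ d = trans (φα _) (trans (cong σ⁻¹ (φα _)) (trans (cong (σ⁻¹ ∘ σ⁻¹) (φα d)) (σ⁻¹-cubed d)))

  face⁶ : ∀ d → (φ ^ 6) d ≡ d
  face⁶ d with faceSizes d
  ... | inj₁ (_ , φ³ , _) = trans (cong (φ ^ 3) φ³) φ³
  ... | inj₂ (_ , φ⁶ , _) = φ⁶

  φ-free : ∀ d → φ d ≢ d
  φ-free d with faceSizes d
  ... | inj₁ (_ , _ , least) = least 1 z<s (s≤s z<s)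
  ... | inj₂ (_ , _ , least) = least 1 z<s (s≤s z<s)

  triangle : ∀ {d} → (φ ^ 3) d ≡ d → Triangle d
  triangle {d} φ³ with faceSizes d
  ... | inj₁ t = t
  ... | inj₂ (_ , _ , least) = contradiction φ³ (least 3 z<s (s≤s (s≤s (s≤s z<s))))

  hexagon : ∀ {d} → (φ ^ 3) d ≢ d → Hexagon d
  hexagon {d} ¬φ³ with faceSizes d
  ... | inj₁ (_ , φ³ , _) = contradiction φ³ ¬φ³
  ... | inj₂ h = h

  -- Connectedness as an induction principle. Steps along `σ` in either direction are words in `φ`
  -- and `α`.
  generated : ∀ d (P : Dart → Set) → P d → (∀ e → P e → P (φ e)) → (∀ e → P e → P (α e)) → ∀ e → P e
  generated d P Pd Pφ Pα e = go d Pd (connected d e)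
    where
    Pσ⁻¹ : ∀ e → P e → P (σ⁻¹ e)
    Pσ⁻¹ e Pe = subst P (φα e) (Pφ _ (Pα _ Pe))
    go : ∀ d → P d → EqClosure Neighbour d e → P e
    go d Pd ε = Pd
    go d Pd (fwd (inj₁ refl) ◅ path) = go _ (subst P (sym (σ≡σ⁻¹² d)) (Pσ⁻¹ _ (Pσ⁻¹ _ Pd))) path
    go d Pd (fwd (inj₂ refl) ◅ path) = go _ (Pα _ Pd) path
    go d Pd (_◅_ {j = e} (bwd (inj₁ refl)) path) =
      go _ (subst P (Inverse.strictlyInverseʳ rotation e) (Pσ⁻¹ _ Pd)) path
    go d Pd (_◅_ {j = e} (bwd (inj₂ refl)) path) = go _ (subst P (α² e) (Pα _ Pd)) path

  module _ (d : Dart) (φ³ : (φ ^ 3) d ≡ d) where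
    private
      module Developed = HexagonalRelations.Development φ α face⁶ α² φα³ d φ³ φ-free (generated d)

    chartAt : Chart φ α
    chartAt = Developed.developed

    chartAt-origin : Chart.at chartAt 0F 0ℤ 0ℤ ≡ d
    chartAt-origin = Developed.at₀-origin

  _≟_ : ∀ (d e : Dart) → Dec (d ≡ e)
  _≟_ = finite⇒≟ finite

  -- If all faces were hexagons, counting darts would give `3V = 2E = 6F`, so `V + F = 3F = E`,
  -- against Euler's formula.
  some-triangle : ∃[ d ] (φ ^ 3) d ≡ d
  some-triangle
    with Fin.any? (λ i → (φ ^ 3) (Inverse.from finite i) ≟ Inverse.from finite i)
  ... | yes (i , φ³) = Inverse.from finite i , φ³
  ... | no ¬φ³ = contradiction euler (count #V #E #F
          (trans (cycles*length finite 2 vertices cubic) (sym faces≡))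
          (trans (cycles*length finite 1 edges α-cycle) (sym faces≡)))
    where
    faces≡ : #F ℕ.* 6 ≡ #darts
    faces≡ = cycles*length finite 5 faces (λ d → hexagon (λ φ³ → ¬φ³ (Inverse.to finite d ,
      subst (λ e → (φ ^ 3) e ≡ e) (sym (Inverse.strictlyInverseʳ finite d)) φ³)))
    count : ∀ v e f → v ℕ.* 3 ≡ f ℕ.* 6 → e ℕ.* 2 ≡ f ℕ.* 6 → v ℕ.+ f ≢ e ℕ.+ 2
    count v e f 3v≡6f 2e≡6f eq
      with refl ← ℕ.*-cancelʳ-≡ v (f ℕ.* 2) 3 (trans 3v≡6f (sym (ℕ.*-assoc f 2 3)))
         | refl ← ℕ.*-cancelʳ-≡ e (f ℕ.* 3) 2 (trans 2e≡6f (sym (ℕ.*-assoc f 3 2)))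
      = contradiction (ℕ.+-cancelˡ-≡ (f ℕ.* 3) 0 2
          (trans (lemma f) eq)) λ ()
      where
      lemma : ∀ f → f ℕ.* 3 ℕ.+ 0 ≡ f ℕ.* 2 ℕ.+ f
      lemma = ℕ-Solver.solve-∀

-- Lattices of periods

InLattice : (s b : ℕ) (x : ℤ) → ℤ → ℤ → Set
InLattice s b x m n = ∃₂ λ p q →
  m ≡ p * + (2 ℕ.* s ℕ.+ 2) + q * (x + x) × n ≡ q * + (2 ℕ.* b ℕ.+ 2)

record Framing {A : Set} (φ α : A → A) (s b : ℕ) (x : ℤ) : Set where
  field
    chart : Chart φ α
  open ChartProperties chart public
  field
    period⇒lattice : ∀ {m n} → Period m n → InLattice s b x m n
    width-period   : Period (+ (2 ℕ.* s ℕ.+ 2)) 0ℤ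
    height-period  : Period (x + x) (+ (2 ℕ.* b ℕ.+ 2))

  lattice⇒period : ∀ {m n} → InLattice s b x m n → Period m n
  lattice⇒period (p , q , refl , refl) = subst (Period _) (lemma p _)
    (Period-+ (Period-* p width-period) (Period-* q height-period))
    where
    lemma : ∀ p n → p * 0ℤ + n ≡ n
    lemma = solve-∀

double : ∀ s → + (2 ℕ.* s ℕ.+ 2) ≡ + suc s + + suc s
double s = cong +_ (lemma s)
  where
  lemma : ∀ s → 2 ℕ.* s ℕ.+ 2 ≡ suc s ℕ.+ suc s
  lemma = ℕ-Solver.solve-∀

-- Adding a multiple of the generator `(2s + 2, 0)` to the other one does not change the lattice.
reframe : ∀ {A : Set} {φ α : A → A} {s b x} k →
          Framing φ α s b x → Framing φ α s b (x + k * + suc s)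
reframe {s = s} {b} {x} k F = record
  { chart = chart
  ; period⇒lattice = λ per → let p , q , eq , eq′ = period⇒lattice per in
      p - q * k , q ,
      trans eq (trans (cong (λ w → p * w + q * (x + x)) (double s))
        (trans (shift p q x k (+ suc s))
          (cong (λ w → (p - q * k) * w + q * (y + y)) (sym (double s))))) , eq′
  ; width-period = width-period
  ; height-period = subst₂ Period
      (trans (cong (λ w → x + x + k * w) (double s)) (shift′ x k (+ suc s)))
      (trans (cong (λ n → + (2 ℕ.* b ℕ.+ 2) + n) (ℤ.*-zeroʳ k)) (ℤ.+-identityʳ _))
      (Period-+ height-period (Period-* k width-period))
  }
  where
  open Framing F
  y : ℤ
  y = x + k * + suc s
  shift : ∀ p q x k w → p * (w + w) + q * (x + x) ≡
          (p - q * k) * (w + w) + q * ((x + k * w) + (x + k * w))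
  shift = solve-∀
  shift′ : ∀ x k w → x + x + k * (w + w) ≡ (x + k * w) + (x + k * w)
  shift′ = solve-∀

-- Both charts identify the same coordinates, so sending each dart to the dart with the same
-- coordinates is well defined in both directions.
framing-equivalent : ∀ {s b x} (T T′ : Trihex) → Framing (Trihex.φ T) (Trihex.α T) s b x →
                     Framing (Trihex.φ T′) (Trihex.α T′) s b x → Equivalent T T′
framing-equivalent T T′ F F′ = record
  { bijection  = mk↔ₛ′ to from to-from from-to
  ; σ-commutes = λ d → trans (cong to (T.σ≡φαφα d)) (trans (to-φ _) (trans (cong T′.φ (trans (to-α _)
      (cong T′.α (trans (to-φ _) (cong T′.φ (to-α d)))))) (sym (T′.σ≡φαφα (to d)))))
  ; α-commutes = to-α
  }
  where
  module T  = TrihexProperties T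
  module T′ = TrihexProperties T′
  module F  = Framing F
  module F′ = Framing F′
  transport : ∀ {k l m n p q} → F.at k m n ≡ F.at l p q → F′.at k m n ≡ F′.at l p q
  transport {k} eq with refl ← F.colour eq =
    F′.period⇒≡ k (F′.lattice⇒period (F.period⇒lattice (F.≡⇒period k eq)))
  transport⁻ : ∀ {k l m n p q} → F′.at k m n ≡ F′.at l p q → F.at k m n ≡ F.at l p q
  transport⁻ {k} eq with refl ← F′.colour eq =
    F.period⇒≡ k (F.lattice⇒period (F′.period⇒lattice (F′.≡⇒period k eq)))
  to : T.Dart → T′.Dart
  to d = let k , m , n , _ = F.onto d in F′.at k m n
  from : T′.Dart → T.Dart
  from d = let k , m , n , _ = F′.onto d in F.at k m n
  to-at : ∀ k m n → to (F.at k m n) ≡ F′.at k m n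
  to-at k m n = transport (proj₂ (proj₂ (proj₂ (F.onto (F.at k m n)))))
  from-at : ∀ k m n → from (F′.at k m n) ≡ F.at k m n
  from-at k m n = transport⁻ (proj₂ (proj₂ (proj₂ (F′.onto (F′.at k m n)))))
  to-from : ∀ d → to (from d) ≡ d
  to-from d with k , m , n , refl ← F′.onto d = to-at k m n
  from-to : ∀ d → from (to d) ≡ d
  from-to d with k , m , n , refl ← F.onto d = from-at k m n
  to-φ : ∀ d → to (T.φ d) ≡ T′.φ (to d)
  to-φ d with F.onto d
  ... | 0F , m , n , refl = trans (trans (cong to (F.φ-at0 m n)) (to-at _ _ _)) (sym (F′.φ-at0 m n))
  ... | 1F , m , n , refl = trans (trans (cong to (F.φ-at1 m n)) (to-at _ _ _)) (sym (F′.φ-at1 m n))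
  ... | 2F , m , n , refl = trans (trans (cong to (F.φ-at2 m n)) (to-at _ _ _)) (sym (F′.φ-at2 m n))
  to-α : ∀ d → to (T.α d) ≡ T′.α (to d)
  to-α d with F.onto d
  ... | 0F , m , n , refl = trans (trans (cong to (F.α-at0 m n)) (to-at _ _ _)) (sym (F′.α-at0 m n))
  ... | 1F , m , n , refl = trans (trans (cong to (F.α-at1 m n)) (to-at _ _ _)) (sym (F′.α-at1 m n))
  ... | 2F , m , n , refl = trans (trans (cong to (F.α-at2 m n)) (to-at _ _ _)) (sym (F′.α-at2 m n))

least : ∀ {P : ℕ → Set} → Decidable P → ∀ n → P n → ∃[ m ] P m × (∀ k → k < m → ¬ P k)
least P? zero    p = 0 , p , λ _ ()
least P? (suc n) p with P? 0
... | yes p₀ = 0 , p₀ , λ _ ()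
... | no ¬p₀ =
  let m , pm , below = least (P? ∘ suc) n p in
  suc m , pm , λ { zero _ → ¬p₀ ; (suc k) (s≤s k<m) → below k k<m }

-- A reduced basis of the lattice of periods, in Hermite normal form.
module ReducedBasis {A : Set} {φ α : A → A} (C : Chart φ α) (α-free : ∀ e → α e ≢ e) where
  open ChartProperties C

  module _ (s b : ℕ) (x : ℤ)
           (width : Period (+ (2 ℕ.* s ℕ.+ 2)) 0ℤ)
           (width-least : ∀ t → t < s → ¬ Period (+ (2 ℕ.* t ℕ.+ 2)) 0ℤ)
           (height : Period (x + x) (+ (2 ℕ.* b ℕ.+ 2)))
           (height-least : ∀ r t → r < b → t < suc s → ¬ Period (+ t + + t) (+ (2 ℕ.* r ℕ.+ 2)))
           where

    -- Applied to the remainder of a period on division by both generators. It is again a period,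
    -- below the minimal width or the minimal height, so it vanishes.
    remainder-trivial : ∀ {t r} → t < suc s → r < suc b → Period (+ t + + t) (+ r + + r) → t ≡ 0 × r ≡ 0
    remainder-trivial {zero} {zero} t<s r<b per = refl , refl
    remainder-trivial {suc t} {zero} (s≤s t<s) r<b per = contradiction
      (subst (λ m → Period m 0ℤ) (sym (double t)) per) (width-least t t<s)
    remainder-trivial {t} {suc r} t<s (s≤s r<b) per =
      contradiction (subst (Period _) (sym (double r)) per) (height-least r t r<b t<s)

    in-lattice : ∀ {m n} → Period m n → InLattice s b x m n
    in-lattice per with i , j , refl , refl ← even-period α-free per = p , q ,
      trans (cong (λ i → i + i) i≡)
        (trans (column p q x (+ suc s)) (cong (λ w → p * w + q * (x + x)) (sym (double s)))) ,
      trans (cong (λ j → j + j) j≡) (trans (row q (+ suc b)) (cong (q *_) (sym (double b))))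
      where
      q p : ℤ
      q = j ℤ./ℕ suc b
      p = (i - q * x) ℤ./ℕ suc s
      r t : ℕ
      r = j ℤ.%ℕ suc b
      t = (i - q * x) ℤ.%ℕ suc s
      reduced : Period (+ t + + t) (+ r + + r)
      reduced = subst₂ Period
        (trans (cong (λ w → i + i + (- q * (x + x) + - p * w)) (double s))
          (trans (l₁ i q x p (+ suc s)) (trans
            (cong (λ y → (y - p * + suc s) + (y - p * + suc s)) (ℤ.a≡a%ℕn+[a/ℕn]*n (i - q * x) (suc s)))
            (l₂ (+ t) (p * + suc s)))))
        (trans (cong (λ w → j + j + (- q * w + - p * 0ℤ)) (double b))
          (trans (l₃ j q p (+ suc b)) (trans
            (cong (λ y → (y - q * + suc b) + (y - q * + suc b)) (ℤ.a≡a%ℕn+[a/ℕn]*n j (suc b)))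
            (l₂ (+ r) (q * + suc b)))))
        (Period-+ per (Period-+ (Period-* (- q) height) (Period-* (- p) width)))
        where
        l₁ : ∀ i q x p w → i + i + (- q * (x + x) + - p * (w + w)) ≡
             ((i - q * x) - p * w) + ((i - q * x) - p * w)
        l₁ = solve-∀
        l₂ : ∀ t y → ((t + y) - y) + ((t + y) - y) ≡ t + t
        l₂ = solve-∀
        l₃ : ∀ j q p w → j + j + (- q * (w + w) + - p * 0ℤ) ≡ (j - q * w) + (j - q * w)
        l₃ = solve-∀
      trivial : t ≡ 0 × r ≡ 0
      trivial = remainder-trivial (ℤ.n%ℕd<d (i - q * x) (suc s)) (ℤ.n%ℕd<d j (suc b)) reduced
      i≡ : i ≡ p * + suc s + q * x
      i≡ = trans (l i (q * x)) (cong (λ y → y + q * x) (trans (ℤ.a≡a%ℕn+[a/ℕn]*n (i - q * x) (suc s))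
             (trans (cong (λ t → + t + p * + suc s) (proj₁ trivial)) (ℤ.+-identityˡ (p * + suc s)))))
        where
        l : ∀ i y → i ≡ (i - y) + y
        l = solve-∀
      j≡ : j ≡ q * + suc b
      j≡ = trans (ℤ.a≡a%ℕn+[a/ℕn]*n j (suc b))
             (trans (cong (λ r → + r + q * + suc b) (proj₂ trivial)) (ℤ.+-identityˡ (q * + suc b)))
      column : ∀ p q x w → (p * w + q * x) + (p * w + q * x) ≡ p * (w + w) + q * (x + x)
      column = solve-∀
      row : ∀ q w → q * w + q * w ≡ q * (w + w)
      row = solve-∀

    framing : Framing φ α s b x
    framing = record
      { chart          = C
      ; period⇒lattice = in-lattice
      ; width-period   = width
      ; height-period  = height
      }

module _ (T : Trihex) where
  open TrihexProperties T

  private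
    returns : (walk : ℕ → Dart) → ∃₂ λ i j → i < j × walk i ≡ walk j
    returns walk =
      let i , j , i<j , eq = Fin.pigeonhole (ℕ.n<1+n #darts) (λ i → Inverse.to finite (walk (toℕ i))) in
      toℕ i , toℕ j , i<j , Injection.injective (↔⇒↣ finite) eq

    -- Doubling the difference of two times of return gives a positive even period without any
    -- appeal to parity.
    doubled-difference : ∀ {i j} → i < j → ∃ λ s → (+ j - + i) + (+ j - + i) ≡ + (2 ℕ.* s ℕ.+ 2)
    doubled-difference {i} {j} i<j with s , refl ← ℕ.m≤n⇒∃[o]m+o≡n i<j = s ,
      trans (cong₂ _+_ difference difference) (sym (double s))
      where
      difference : + suc (i ℕ.+ s) - + i ≡ + suc s
      difference = trans (cong (λ z → + suc z - + i) (ℕ.+-comm i s))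
        (trans (cong (_- + i) (ℤ.pos-+ (suc s) i)) (lemma (+ suc s) (+ i)))
        where
        lemma : ∀ a b → (a + b) - b ≡ a
        lemma = solve-∀

  private module _ (C : Chart φ α) where
    open ChartProperties C

    reducedBasis : ∀ s₀ → Period (+ (2 ℕ.* s₀ ℕ.+ 2)) 0ℤ → ∀ b₀ → Period 0ℤ (+ (2 ℕ.* b₀ ℕ.+ 2)) →
                   ∃₂ λ s b → ∃ λ x → Framing φ α s b x
    reducedBasis s₀ width₀ b₀ height₀
      with s , width , width-least ← least (λ s → at 0F (+ (2 ℕ.* s ℕ.+ 2)) 0ℤ ≟ at 0F 0ℤ 0ℤ) s₀ width₀
      with b , (x , height) , height-least ← least
             {λ b → ∃ λ (t : Fin (suc s)) → Period (+ toℕ t + + toℕ t) (+ (2 ℕ.* b ℕ.+ 2))}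
             (λ b → Fin.any? (λ t → at 0F (+ toℕ t + + toℕ t) _ ≟ at 0F 0ℤ 0ℤ)) b₀ (0F , height₀)
      = s , b , + toℕ x , ReducedBasis.framing C α-free s b (+ toℕ x) width width-least height
          (λ r t r<b t<s per → height-least r r<b (fromℕ< t<s ,
            subst (λ t → Period (+ t + + t) _) (sym (Fin.toℕ-fromℕ< t<s)) per))

    some-width : ∃ λ s → Period (+ (2 ℕ.* s ℕ.+ 2)) 0ℤ
    some-width with i , j , i<j , eq ← returns (λ i → at 0F (+ i) 0ℤ)
      with s , doubled ← doubled-difference i<j =
      s , subst (λ m → Period m 0ℤ) doubled (Period-+ (≡⇒period 0F (sym eq)) (≡⇒period 0F (sym eq)))

    some-height : ∃ λ b → Period 0ℤ (+ (2 ℕ.* b ℕ.+ 2))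
    some-height with i , j , i<j , eq ← returns (λ i → at 0F 0ℤ (+ i))
      with b , doubled ← doubled-difference i<j =
      b , subst (Period 0ℤ) doubled (Period-+ (≡⇒period 0F (sym eq)) (≡⇒period 0F (sym eq)))

    chart-framed : ∃₂ λ s b → ∃ λ x → Framing φ α s b x
    chart-framed with s₀ , width₀ ← some-width with b₀ , height₀ ← some-height =
      reducedBasis s₀ width₀ b₀ height₀

  framed : ∃₂ λ s b → ∃ λ x → Framing φ α s b x
  framed with d , φ³ ← some-triangle = chart-framed (chartAt d φ³)

-- Spines and belts as rows of a chart

-- Unlike `2 * k`, this unfolds by two successors at a time, as do `parity`, `⌊_/2⌋` and `side`.
twice : ℕ → ℕ
twice zero    = zero
twice (suc k) = suc (suc (twice k))

twice≡ : ∀ k → twice k ≡ 2 ℕ.* k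
twice≡ zero    = refl
twice≡ (suc k) = cong suc (trans (cong suc (twice≡ k)) (sym (ℕ.+-suc k (k ℕ.+ 0))))

data Halved : ℕ → Set where
  even : ∀ k → Halved (twice k)
  odd  : ∀ k → Halved (suc (twice k))

halve : ∀ j → Halved j
halve zero = even zero
halve (suc j) with halve j
... | even k = odd k
... | odd k  = even (suc k)

parity-even : ∀ k → parity (twice k) ≡ 0ℙ
parity-even zero    = refl
parity-even (suc k) = parity-even k

parity-odd : ∀ k → parity (suc (twice k)) ≡ 1ℙ
parity-odd zero    = refl
parity-odd (suc k) = parity-odd k

half-even : ∀ k → ⌊ twice k /2⌋ ≡ k
half-even zero    = refl
half-even (suc k) = cong suc (half-even k)

half-odd : ∀ k → ⌊ suc (twice k) /2⌋ ≡ k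
half-odd zero    = refl
half-odd (suc k) = cong suc (half-odd k)

-- The orbits of ℤ under m ↦ - m and m ↦ m + (2s + 2).
Folds : ℕ → ℤ → ℕ → Set
Folds s m i = ∃ λ p → m ≡ + i + p * + (2 ℕ.* s ℕ.+ 2) ⊎ m ≡ - + i + p * + (2 ℕ.* s ℕ.+ 2)

-- Half turns fold in both directions: this is used with `s` for the columns of a row and with `b`
-- for the rows.
module Folding (s : ℕ) where

  width : ℕ
  width = 2 ℕ.* s ℕ.+ 2

  width≡ : width ≡ suc s ℕ.+ suc s
  width≡ = ℤ.+-injective (double s)

  instance
    width≢0 : NonZero width
    width≢0 = subst NonZero (sym width≡) _

  1+s<width : suc s < width
  1+s<width = subst (suc s <_) (sym width≡) (ℕ.m<m+n (suc s) z<s)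

  fold : ∀ m → ∃ λ i → i ≤ suc s × Folds s m i
  fold m = go (m ℤ.%ℕ width) (m ℤ./ℕ width) (ℤ.n%ℕd<d m width) (ℤ.a≡a%ℕn+[a/ℕn]*n m width)
    where
    go : ∀ k q → k < width → m ≡ + k + q * + width → ∃ λ i → i ≤ suc s × Folds s m i
    go k q k<w eq with k ℕ.≤? suc s
    ... | yes k≤1+s = k , k≤1+s , q , inj₁ eq
    ... | no k≰1+s = i , i≤1+s , q + 1ℤ , inj₂ (trans eq (l (+ i) (+ k) q (+ width) total))
      where
      i : ℕ
      i = width ℕ.∸ k
      i≤1+s : i ≤ suc s
      i≤1+s = ℕ.m≤n+o⇒m∸n≤o width k
        (subst (_≤ (k ℕ.+ suc s)) (sym width≡) (ℕ.+-monoˡ-≤ (suc s) (ℕ.<⇒≤ (ℕ.≰⇒> k≰1+s))))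
      total : + i + + k ≡ + width
      total = cong +_ (ℕ.m∸n+n≡m (ℕ.<⇒≤ k<w))
      l′ : ∀ i k q → k + q * (i + k) ≡ - i + (q + 1ℤ) * (i + k)
      l′ = solve-∀
      l : ∀ i k q w → i + k ≡ w → k + q * w ≡ - i + (q + 1ℤ) * w
      l i k q _ refl = l′ i k q

  -- With opposite signs, `i + j` is a multiple of `2(s + 1)`; as neither exceeds `s + 1`, both are
  -- 0 or both are `s + 1`. These are the two fixed points of the folding, the triangles at the ends
  -- of a spine.
  fold-unique : ∀ {i j} → i ≤ suc s → j ≤ suc s → Folds s (+ i) j → i ≡ j
  fold-unique i≤1+s j≤1+s (p , inj₁ eq) =
    remainder-unique p (ℕ.≤-<-trans i≤1+s 1+s<width) (ℕ.≤-<-trans j≤1+s 1+s<width) eq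
  fold-unique {i} {zero} i≤1+s j≤1+s (p , inj₂ eq) =
    remainder-unique p (ℕ.≤-<-trans i≤1+s 1+s<width) (ℕ.≤-<-trans z≤n 1+s<width) eq
  fold-unique {i} {suc j} i≤1+s j≤1+s (p , inj₂ eq) = ℕ.≤-antisym
    (ℕ.+-cancelʳ-≤ (suc s) i (suc j) (ℕ.≤-trans (ℕ.+-monoˡ-≤ (suc s) i≤1+s)
      (ℕ.≤-trans (ℕ.≤-reflexive (sym total)) (ℕ.≤-trans (ℕ.+-monoˡ-≤ (suc j) i≤1+s)
        (ℕ.≤-reflexive (ℕ.+-comm (suc s) (suc j)))))))
    (ℕ.+-cancelʳ-≤ (suc s) (suc j) i (ℕ.≤-trans (ℕ.+-monoˡ-≤ (suc s) j≤1+s)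
      (ℕ.≤-trans (ℕ.≤-reflexive (sym total)) (ℕ.+-monoʳ-≤ i j≤1+s))))
    where
    j≤w : suc j ≤ width
    j≤w = ℕ.≤-trans j≤1+s (ℕ.<⇒≤ 1+s<width)
    k : ℕ
    k = width ℕ.∸ suc j
    j+k : + suc j + + k ≡ + width
    j+k = cong +_ (ℕ.m+[n∸m]≡n j≤w)
    i≡k : i ≡ k
    i≡k = remainder-unique (p - 1ℤ) (ℕ.≤-<-trans i≤1+s 1+s<width) (ℕ.∸-monoʳ-< z<s j≤w)
      (trans eq (l p (+ suc j) (+ k) (+ width) j+k))
      where
      l′ : ∀ p j k → - j + p * (j + k) ≡ k + (p - 1ℤ) * (j + k)
      l′ = solve-∀
      l : ∀ p j k w → j + k ≡ w → - j + p * w ≡ k + (p - 1ℤ) * w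
      l p j k _ refl = l′ p j k
    total : i ℕ.+ suc j ≡ suc s ℕ.+ suc s
    total = trans (cong (ℕ._+ suc j) i≡k) (trans (ℕ.m∸n+n≡m j≤w) width≡)

module Rows {A : Set} {φ α : A → A} (C : Chart φ α) (s : ℕ) where
  open ChartProperties C

  open Folding s public

  Row : ℤ → A → Set
  Row n e = ∃ λ m → SameCycle φ (at 0F m n) e

  OnlyWidth : Set
  OnlyWidth = ∀ {t} → Period t 0ℤ → ∃ λ p → t ≡ p * + width

  module _ (width-period : Period (+ width) 0ℤ) where

    widths-period : ∀ p → Period (p * + width) 0ℤ
    widths-period p = subst (Period _) (ℤ.*-zeroʳ p) (Period-* p width-period)

    belt-cover : ∀ r {n e} → Row n e → ∃ λ k → k < width × SameCycle φ (at 0F (r + + k) n) e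
    belt-cover r {n} {e} (m , c) = k , ℤ.n%ℕd<d (m - r) width , subst (λ d → SameCycle φ d e)
      (period⇒≡ 0F (subst₂ Period (sym eq) (sym (ℤ.+-inverseʳ n)) (widths-period q))) c
      where
      k : ℕ
      k = (m - r) ℤ.%ℕ width
      q : ℤ
      q = (m - r) ℤ./ℕ width
      eq : m - (r + + k) ≡ q * + width
      eq = trans (l m r (+ k)) (trans (cong (_- + k) (ℤ.a≡a%ℕn+[a/ℕn]*n (m - r) width)) (l′ (+ k) _))
        where
        l : ∀ m r k → m - (r + k) ≡ (m - r) - k
        l = solve-∀
        l′ : ∀ k y → (k + y) - k ≡ y
        l′ = solve-∀

    -- The hypothesis `centre` makes `(x , n)` the centre of a half turn, which reflects the row
    -- about column `x`. Modulo the width, half of the row remains, both ends included.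
    spine-cover : ∀ x {n e} → Period (x + x) (n + n) → Row n e →
                  ∃ λ i → i ≤ suc s × SameCycle φ (at 0F (x + + i) n) e
    spine-cover x {n} {e} centre (m , c) with fold (m - x)
    ... | i , i≤1+s , p , inj₁ eq = i , i≤1+s , subst (λ d → SameCycle φ d e)
      (period⇒≡ 0F (subst₂ Period (trans (l p (+ i) (+ width))
      (trans (cong (_- + i) (sym eq)) (l′ m x (+ i))))
        (sym (ℤ.+-inverseʳ n)) (widths-period p))) c
      where
      l : ∀ p i w → p * w ≡ i + p * w - i
      l = solve-∀
      l′ : ∀ m x i → (m - x) - i ≡ m - (x + i)
      l′ = solve-∀
    ... | i , i≤1+s , p , inj₂ eq = i , i≤1+s ,
      SameCycle-trans (SameFace-neg _ _) (subst (λ d → SameCycle φ d e)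
        (period⇒≡ 0F (subst₂ Period (trans (l p x (+ i) (+ width))
        (trans (cong (λ y → x + x + (y + + i)) (sym eq)) (l′ m x (+ i))))
          (l″ n) (Period-+ centre (widths-period p)))) c)
      where
      l : ∀ p x i w → x + x + p * w ≡ x + x + (- i + p * w + i)
      l = solve-∀
      l′ : ∀ m x i → x + x + ((m - x) + i) ≡ m - - (x + i)
      l′ = solve-∀
      l″ : ∀ n → n + n + 0ℤ ≡ n - - n
      l″ = solve-∀

  -- Without a centre in row `n`, no half turn maps the row to itself, so only horizontal periods
  -- identify its faces.
  belt-separate : OnlyWidth → ∀ r {n} → (∀ t → ¬ Period t (n + n)) → ∀ {j k} → j < width → k < width →
                  SameCycle φ (at 0F (r + + j) n) (at 0F (r + + k) n) → j ≡ k
  belt-separate only r {n} ¬centre {j} {k} j<w k<w c with SameFace⇒ c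
  ... | inj₂ per = contradiction per (¬centre _)
  ... | inj₁ per with p , eq ← only (subst (Period _) (ℤ.+-inverseʳ n) per) =
    remainder-unique p j<w k<w (trans (l r (+ j) (+ k)) (cong (λ z → + k + z) eq))
    where
    l : ∀ r j k → j ≡ k + ((r + j) - (r + k))
    l = solve-∀

  spine-separate : OnlyWidth → ∀ x {n} → Period (x + x) (n + n) → ∀ {i j} → i ≤ suc s → j ≤ suc s →
                   SameCycle φ (at 0F (x + + i) n) (at 0F (x + + j) n) → i ≡ j
  spine-separate only x {n} centre {i} {j} i≤1+s j≤1+s c with SameFace⇒ c
  ... | inj₁ per with p , eq ← only (subst (Period _) (ℤ.+-inverseʳ n) per) =
    fold-unique i≤1+s j≤1+s (p , inj₁ (trans (l x (+ i) (+ j)) (cong (λ z → + j + z) eq)))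
    where
    l : ∀ x i j → i ≡ j + ((x + i) - (x + j))
    l = solve-∀
  ... | inj₂ per
    with p , eq ← only (subst (Period _) (ℤ.+-inverseʳ (n + n)) (Period-+ per (Period-neg centre))) =
    fold-unique i≤1+s j≤1+s (p , inj₂ (trans (l x (+ i) (+ j)) (cong (λ z → - + j + z) eq)))
    where
    l : ∀ x i j → i ≡ - j + (x + i + (x + j) - (x + x))
    l = solve-∀

  -- The upper sides of the faces in row n, two for each face, from left to right
  -- starting at column r.
  side : ℤ → ℤ → ℕ → A
  side r n 0             = at 2F r n
  side r n 1             = at 1F r n
  side r n (suc (suc j)) = side (1ℤ + r) n j

  private
    1+[r+k] : ∀ r k → (1ℤ + r) + k ≡ r + (1ℤ + k)
    1+[r+k] = solve-∀

  side-even : ∀ r n k → side r n (twice k) ≡ at 2F (r + + k) n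
  side-even r n zero    = cong (λ r → at 2F r n) (sym (ℤ.+-identityʳ r))
  side-even r n (suc k) = trans (side-even (1ℤ + r) n k) (cong (λ r → at 2F r n) (1+[r+k] r (+ k)))

  side-odd : ∀ r n k → side r n (suc (twice k)) ≡ at 1F (r + + k) n
  side-odd r n zero    = cong (λ r → at 1F r n) (sym (ℤ.+-identityʳ r))
  side-odd r n (suc k) = trans (side-odd (1ℤ + r) n k) (cong (λ r → at 1F r n) (1+[r+k] r (+ k)))

module Pieces (T : Trihex) (C : Chart (Trihex.φ T) (Trihex.α T)) (s : ℕ) where
  open TrihexProperties T
  open ChartProperties C
  open Rows C s

  ahead^-at : ∀ i x n → (ahead ^ i) (at 0F x n) ≡ at 0F (x + + i) n
  ahead^-at zero    x n = cong (λ x → at 0F x n) (sym (ℤ.+-identityʳ x))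
  ahead^-at (suc i) x n = trans (cong ahead (ahead^-at i x n))
    (trans (ahead-at _ n) (cong (λ x → at 0F x n) (l x (+ i))))
    where
    l : ∀ x i → 1ℤ + (x + i) ≡ x + (1ℤ + i)
    l = solve-∀

  spineFace-at : ∀ x n i → SameFace (at 0F (x + + i) n) (spineFace (at 0F x n) i)
  spineFace-at x n zero = subst (λ y → SameFace (at 0F y n) (at 0F x n)) (sym (ℤ.+-identityʳ x)) (0 , refl)
  spineFace-at x n (suc i) = subst (SameFace _)
    (sym (trans (cong α (ahead^-at i x n)) (trans (α-at0 _ n) (cong (λ x → at 0F x (- n)) (l x (+ i))))))
    (SameFace-neg _ _)
    where
    l : ∀ x i → -1ℤ - (x + i) ≡ - (x + (1ℤ + i))
    l = solve-∀

  -- The half turn about a face is the one about the origin followed by the translation by twice its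
  -- centre. So the triangles lie exactly at the half periods.
  φ³-fixed⇒ : ∀ k {m n} → (φ ^ 3) (at k m n) ≡ at k m n → Period (m + m) (n + n)
  φ³-fixed⇒ k {m} {n} eq = subst₂ Period (l m) (l n) (≡⇒period k (trans (sym eq) (φ³-at k m n)))
    where
    l : ∀ m → m - - m ≡ m + m
    l = solve-∀

  φ³-fixed⇐ : ∀ k {m n} → Period (m + m) (n + n) → (φ ^ 3) (at k m n) ≡ at k m n
  φ³-fixed⇐ k {m} {n} per = trans (φ³-at k m n) (sym (period⇒≡ k (subst₂ Period (l m) (l n) per)))
    where
    l : ∀ m → m + m ≡ m - - m
    l = solve-∀

  spine-row⇒ : ∀ {x n e} (S : Spine s) → Spine.first S ≡ at 0F x n → Spine.Contains S e → Row n e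
  spine-row⇒ {x} {n} S refl′ (i , _ , c) rewrite refl′ =
    x + + i , SameCycle-trans (spineFace-at x n i) c

  belt-row⇒ : ∀ {r n e} (B : Belt width) → Belt.first B ≡ at 0F r n → Belt.Contains B e → Row n e
  belt-row⇒ {r} {n} {e} B refl′ (k , _ , c) rewrite refl′ =
    r + + k , subst (λ d → SameFace d e) (ahead^-at k r n) c

  module _ (width-period : Period (+ width) 0ℤ) where

    spine-row⇐ : ∀ {x n e} (S : Spine s) → Spine.first S ≡ at 0F x n → Period (x + x) (n + n) →
                 Row n e → Spine.Contains S e
    spine-row⇐ {x} {n} S refl′ centre row rewrite refl′ =
      let i , i≤ , c = spine-cover width-period x centre row in
      i , i≤ , SameCycle-trans (SameFace-sym (spineFace-at x n i)) c

    belt-row⇐ : ∀ {r n e} (B : Belt width) → Belt.first B ≡ at 0F r n → Row n e → Belt.Contains B e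
    belt-row⇐ {r} {n} {e} B refl′ row rewrite refl′ =
      let k , k< , c = belt-cover width-period r row in
      k , k< , subst (λ d → SameFace d e) (sym (ahead^-at k r n)) c

    -- The column of a belt is left open, since a belt fills its row from any start. A spine has to
    -- start at a triangle, and that is the centre recorded here.
    Aligned : ∀ {b} → ℤ → Vec (Belt width) b → Spine s → Set
    Aligned n []       S′ = ∃ λ x → Spine.first S′ ≡ at 0F x n × Period (x + x) (n + n)
    Aligned n (B ∷ Bs) S′ = (∃ λ r → Belt.first B ≡ at 0F r n) × Aligned (1ℤ + n) Bs S′

    private
      next-row : ∀ n p → (1ℤ + n) + p ≡ n + (1ℤ + p)
      next-row = solve-∀

    piece-row⇒ : ∀ {b n} (Bs : Vec (Belt width) b) S′ → Aligned n Bs S′ → ∀ p {e} →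
                 lookup (map Belt.Contains Bs ∷ʳ Spine.Contains S′) p e → Row (n + + toℕ p) e
    piece-row⇒ {n = n} [] S′ (x , eq , _) Fin.zero {e} c =
      subst (λ n → Row n e) (sym (ℤ.+-identityʳ n)) (spine-row⇒ S′ eq c)
    piece-row⇒ {n = n} (B ∷ Bs) S′ ((r , eq) , _) Fin.zero {e} c =
      subst (λ n → Row n e) (sym (ℤ.+-identityʳ n)) (belt-row⇒ B eq c)
    piece-row⇒ {n = n} (B ∷ Bs) S′ (_ , aligned) (Fin.suc p) {e} c =
      subst (λ n → Row n e) (next-row n (+ toℕ p)) (piece-row⇒ Bs S′ aligned p c)

    piece-row⇐ : ∀ {b n} (Bs : Vec (Belt width) b) S′ → Aligned n Bs S′ → ∀ p {e} →
                 Row (n + + toℕ p) e → lookup (map Belt.Contains Bs ∷ʳ Spine.Contains S′) p e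
    piece-row⇐ {n = n} [] S′ (x , eq , centre) Fin.zero {e} row =
      spine-row⇐ S′ eq centre (subst (λ n → Row n e) (ℤ.+-identityʳ n) row)
    piece-row⇐ {n = n} (B ∷ Bs) S′ ((r , eq) , _) Fin.zero {e} row =
      belt-row⇐ B eq (subst (λ n → Row n e) (ℤ.+-identityʳ n) row)
    piece-row⇐ {n = n} (B ∷ Bs) S′ (_ , aligned) (Fin.suc p) {e} row =
      piece-row⇐ Bs S′ aligned p (subst (λ n → Row n e) (sym (next-row n (+ toℕ p))) row)

    spineAt : OnlyWidth → ∀ x n → Period (x + x) (n + n) → Spine s
    spineAt only x n centre = record
      { first     = at 0F x n
      ; triangle₀ = triangle (φ³-fixed⇐ 0F centre)
      ; hexagons  = hexagons
      ; triangle₁ = triangle (subst (λ d → (φ ^ 3) d ≡ d) (sym (last-face s)) (φ³-fixed⇐ 0F end))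
      ; distinct  = λ i j i≤ j≤ c → spine-separate only x centre i≤ j≤
          (SameCycle-trans (spineFace-at x n i) (SameCycle-trans c (SameFace-sym (spineFace-at x n j))))
      }
      where
      last-face : ∀ i → spineFace (at 0F x n) (suc i) ≡ at 0F (- (x + + suc i)) (- n)
      last-face i = trans (cong α (ahead^-at i x n))
        (trans (α-at0 _ n) (cong (λ x → at 0F x (- n)) (l x (+ i))))
        where
        l : ∀ x i → -1ℤ - (x + i) ≡ - (x + (1ℤ + i))
        l = solve-∀
      end : Period (- (x + + suc s) + - (x + + suc s)) (- n + - n)
      end = subst₂ Period (trans (cong (λ w → - (x + x + w)) (double s)) (l x (+ suc s))) (l′ n)
              (Period-neg (Period-+ centre width-period))
        where
        l : ∀ x w → - ((x + x) + (w + w)) ≡ - (x + w) + - (x + w)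
        l = solve-∀
        l′ : ∀ n → - ((n + n) + 0ℤ) ≡ - n + - n
        l′ = solve-∀
      hexagons : ∀ i → 0 < i → i ≤ s → Hexagon (spineFace (at 0F x n) i)
      -- A triangle here would, together with the one at column `x`, give a horizontal period of
      -- twice their distance, which is positive and below the width.
      hexagons (suc i) _ i<s = hexagon λ φ³ →
        let per = φ³-fixed⇒ 0F (subst (λ d → (φ ^ 3) d ≡ d) (last-face i) φ³)
            p , eq = only (subst₂ Period (l x (+ suc i)) (l′ n) (Period-neg (Period-+ per centre)))
        in contradiction (remainder-unique p (doubled i<s) (ℕ.≤-<-trans z≤n 1+s<width)
             (trans eq (sym (ℤ.+-identityˡ (p * + width))))) λ ()
        where
        l : ∀ x i → - (- (x + i) + - (x + i) + (x + x)) ≡ i + i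
        l = solve-∀
        l′ : ∀ n → - (- n + - n + (n + n)) ≡ 0ℤ
        l′ = solve-∀
        doubled : suc i ≤ s → suc i ℕ.+ suc i < width
        doubled i<s = subst (suc i ℕ.+ suc i <_) (sym width≡)
          (ℕ.+-mono-≤ {suc (suc i)} (s≤s i<s) (ℕ.≤-trans i<s (ℕ.n≤1+n s)))

    beltAt : OnlyWidth → ∀ r n → (∀ t → ¬ Period t (n + n)) → Belt width
    beltAt only r n ¬centre = record
      { first    = at 0F r n
      ; closed   = trans (ahead^-at width r n) (period⇒≡ 0F
          (subst₂ Period (l r (+ width)) (sym (ℤ.+-inverseʳ n)) width-period))
      ; hexagons = λ k _ → hexagon λ φ³ →
          ¬centre _ (φ³-fixed⇒ 0F (subst (λ d → (φ ^ 3) d ≡ d) (ahead^-at k r n) φ³))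
      ; distinct = λ j k j< k< c → belt-separate only r ¬centre j< k<
          (subst₂ SameFace (ahead^-at j r n) (ahead^-at k r n) c)
      }
      where
      l : ∀ r w → w ≡ (r + w) - r
      l = solve-∀

  -- The row unrolls the disc: its boundary, run counterclockwise, becomes the upper side of the
  -- row, run endlessly from right to left. `skip` crosses an internal edge from one face to the
  -- next, and `φ` passes over the peak of a face.
  boundary-even : ∀ {x n} (S : Spine s) → Spine.first S ≡ at 0F x n → Period (x + x) (n + n) →
                  ∀ k → Spine.boundary S (twice k) ≡ at 2F (x - + k) n
  boundary-odd  : ∀ {x n} (S : Spine s) → Spine.first S ≡ at 0F x n → Period (x + x) (n + n) →
                  ∀ k → Spine.boundary S (suc (twice k)) ≡ at 1F (x - + suc k) n
  boundary-even {x} {n} S first centre zero = trans (cong (φ ∘ φ) first) (trans (cong φ (φ-at0 x n))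
    (trans (φ-at1 x n) (cong (λ x → at 2F x n) (sym (ℤ.+-identityʳ x)))))
  boundary-even {x} {n} S first centre (suc k) rewrite parity-odd k =
    trans (cong φ (boundary-odd S first centre k)) (φ-at1 _ _)
  boundary-odd {x} {n} S first centre k rewrite parity-even k =
    trans (cong skip (boundary-even S first centre k))
      (trans (cong (φ ∘ α) (φ-at2 _ _)) (trans (cong φ (α-at0 _ _)) (trans (φ-at0 _ _)
        (cong₂ (at 1F) (l x (+ k)) (ℤ.neg-involutive n)))))
    where
    l : ∀ x k → -1ℤ - - (x - k) ≡ x - (1ℤ + k)
    l = solve-∀

  -- Across the upper side of row 0 lies row -1, which the half turn about the origin carries to row
  -- 1 with left and right exchanged. From there on the pieces follow downwards.
  α-boundary : ∀ (S : Spine s) → Spine.first S ≡ at 0F 0ℤ 0ℤ → ∀ j →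
               α (Spine.boundary S j) ≡ side 1ℤ 1ℤ j
  α-boundary S first j with halve j
  ... | even k = trans (cong α (boundary-even S first refl k)) (trans (α-at2 _ _)
    (trans (cong (λ m → at 2F m 1ℤ) (l (+ k))) (sym (side-even 1ℤ 1ℤ k))))
    where
    l : ∀ k → 1ℤ - (0ℤ - k) ≡ 1ℤ + k
    l = solve-∀
  ... | odd k = trans (cong α (boundary-odd S first refl k)) (trans (α-at1 _ _)
    (trans (cong (λ m → at 1F m 1ℤ) (l (+ k))) (sym (side-odd 1ℤ 1ℤ k))))
    where
    l : ∀ k → - (0ℤ - (1ℤ + k)) ≡ 1ℤ + k
    l = solve-∀

  module _ {r n} (B : Belt width) (first : Belt.first B ≡ at 0F r n) where
    open Belt B using (inner; outer; rung)

    rung-at : ∀ k → rung k ≡ at 0F (r + + k) n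
    rung-at k = trans (cong (ahead ^ k) first) (ahead^-at k r n)

    inner-side : ∀ j → inner j ≡ side (1ℤ + r) n j
    inner-side j with halve j
    ... | even k rewrite parity-even k | half-even k = trans (cong (φ ∘ φ) (rung-at (suc k)))
      (trans (cong φ (φ-at0 _ n)) (trans (φ-at1 _ n)
        (trans (cong (λ m → at 2F m n) (l r (+ k))) (sym (side-even (1ℤ + r) n k)))))
      where
      l : ∀ r k → r + (1ℤ + k) ≡ (1ℤ + r) + k
      l = solve-∀
    ... | odd k rewrite parity-odd k | half-odd k = trans (cong φ (rung-at (suc k)))
      (trans (φ-at0 _ n) (trans (cong (λ m → at 1F m n) (l r (+ k))) (sym (side-odd (1ℤ + r) n k))))
      where
      l : ∀ r k → r + (1ℤ + k) ≡ (1ℤ + r) + k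
      l = solve-∀

    -- The index is `suc j` because consecutive rows are staggered by half a face: `outer 0` is the
    -- lower left side of a face, hence the upper right side of the face below. This is the unit
    -- shift contributed by each belt.
    α-outer : ∀ j → α (outer j) ≡ side (1ℤ + r) (1ℤ + n) (suc j)
    α-outer j with halve j
    ... | even k rewrite parity-even k | half-even k =
      trans (cong (α ∘ φ) (trans (cong α (rung-at k)) (α-at0 _ n)))
        (trans (cong α (φ-at0 _ _)) (trans (α-at1 _ _)
          (trans (cong₂ (at 1F) (l r (+ k)) (l′ n)) (sym (side-odd (1ℤ + r) (1ℤ + n) k)))))
      where
      l : ∀ r k → - (-1ℤ - (r + k)) ≡ (1ℤ + r) + k
      l = solve-∀
      l′ : ∀ n → 1ℤ - - n ≡ 1ℤ + n
      l′ = solve-∀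
    ... | odd k rewrite parity-odd k | half-odd k =
      trans (cong (α ∘ φ ∘ φ) (trans (cong α (rung-at k)) (α-at0 _ n)))
        (trans (cong (α ∘ φ) (φ-at0 _ _)) (trans (cong α (φ-at1 _ _)) (trans (α-at2 _ _)
          (trans (cong₂ (at 2F) (l r (+ k)) (l′ n)) (sym (side-even (1ℤ + r) (1ℤ + n) (suc k)))))))
      where
      l : ∀ r k → 1ℤ - (-1ℤ - (r + k)) ≡ (1ℤ + r) + (1ℤ + k)
      l = solve-∀
      l′ : ∀ n → 1ℤ - - n ≡ 1ℤ + n
      l′ = solve-∀

*-zero : ∀ q n .{{_ : NonZero n}} → 0ℤ ≡ q * + n → q ≡ 0ℤ
*-zero q (suc n) eq with ℤ.i*j≡0⇒i≡0∨j≡0 q (sym eq)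
... | inj₁ q≡0 = q≡0

-- The rows of a framing, and a transversal of its faces

module FramingRows {A : Set} {φ α : A → A} {s b x} (F : Framing φ α s b x) where
  open Framing F public
  open Rows chart s public
  open Endo A using (_^_)
  module Height = Folding b

  private
    height : ℕ
    height = 2 ℕ.* b ℕ.+ 2

  only-width : OnlyWidth
  only-width per with p , q , eq , eq′ ← period⇒lattice per
    with refl ← *-zero q height {{Height.width≢0}} eq′ = p , trans eq (l _ x)
    where
    l : ∀ y x → y + 0ℤ * (x + x) ≡ y
    l = solve-∀

  heights-period : ∀ q → Period (q * (x + x)) (q * + height)
  heights-period q = Period-* q height-period

  -- The rows of periods are multiples of `2b + 2`, and `2n` lies strictly between two of them.
  -- Hence the middle rows have no triangles and form belts.
  no-centre : ∀ {n} → 0 < n → n ≤ b → ∀ t → ¬ Period t (+ n + + n)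
  no-centre {n} 0<n n≤b t per with p , q , _ , eq ← period⇒lattice per =
    ℕ.<⇒≢ (ℕ.<-≤-trans 0<n (ℕ.m≤m+n n n)) (sym
      (remainder-unique {n ℕ.+ n} {0} {height} q
        (subst (n ℕ.+ n <_) (sym Height.width≡) (ℕ.+-mono-≤ {suc n} (s≤s n≤b) (ℕ.m≤n⇒m≤1+n n≤b)))
        (ℕ.<-trans z<s Height.1+s<width)
        (trans eq (sym (ℤ.+-identityˡ _)))))

  row-fold : ∀ {n e} → Row n e → ∃ λ j → j ≤ suc b × Row (+ j) e
  row-fold {n} {e} (m , c) with Height.fold n
  ... | j , j≤ , p , inj₁ eq = j , j≤ , m - p * (x + x) , subst (λ d → SameCycle φ d e)
    (period⇒≡ 0F (subst₂ Period (l m _) (trans (l′ (+ j) _) (cong (_- + j) (sym eq))) (heights-period p))) c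
    where
    l : ∀ m y → y ≡ m - (m - y)
    l = solve-∀
    l′ : ∀ j y → y ≡ (j + y) - j
    l′ = solve-∀
  ... | j , j≤ , p , inj₂ eq = j , j≤ , - (m - p * (x + x)) ,
    SameCycle-trans (SameFace-neg _ _) (subst (λ d → SameCycle φ d e)
    (period⇒≡ 0F (subst₂ Period (l m _) (trans (l′ (+ j) _) (cong (_- - + j) (sym eq)))
    (heights-period p))) c)
    where
    l : ∀ m y → y ≡ m - - - (m - y)
    l = solve-∀
    l′ : ∀ j y → y ≡ (- j + y) - - j
    l′ = solve-∀

  row-unique : ∀ {i j e} → i ≤ suc b → j ≤ suc b → Row (+ i) e → Row (+ j) e → i ≡ j
  row-unique {i} {j} i≤ j≤ (m , c) (m′ , c′) with SameFace⇒ (SameCycle-trans c (SameFace-sym c′))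
  ... | inj₁ per with p , q , _ , eq ← period⇒lattice per =
    Height.fold-unique i≤ j≤ (q , inj₁ (trans (l (+ i) (+ j)) (cong (λ z → + j + z) eq)))
    where
    l : ∀ i j → i ≡ j + (i - j)
    l = solve-∀
  ... | inj₂ per with p , q , _ , eq ← period⇒lattice per =
    Height.fold-unique i≤ j≤ (q , inj₂ (trans (l (+ i) (+ j)) (cong (λ z → - + j + z) eq)))
    where
    l : ∀ i j → i ≡ - j + (i + j)
    l = solve-∀

  centre-S : Period (0ℤ + 0ℤ) (0ℤ + 0ℤ)
  centre-S = refl

  centre-S′ : Period (x + x) (+ suc b + + suc b)
  centre-S′ = subst (Period _) (double b) height-period

  -- One place for each face: `s + 2` in each of the end rows, which are folded, and `2s + 2` in
  -- each of the `b` rows between them.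
  Place : Set
  Place = Fin (suc (suc s)) ⊎ ((Fin b × Fin width) ⊎ Fin (suc (suc s)))

  #places : ℕ
  #places = suc (suc s) ℕ.+ (b ℕ.* width ℕ.+ suc (suc s))

  places : Fin #places ↔ Place
  places = (↔-id _ ⊎-↔ ((Fin.*↔× ⊎-↔ ↔-id _) ↔-∘ Fin.+↔⊎)) ↔-∘ Fin.+↔⊎

  placeRow : Place → ℕ
  placeRow (inj₁ i)              = 0
  placeRow (inj₂ (inj₁ (j , k))) = suc (toℕ j)
  placeRow (inj₂ (inj₂ i))       = suc b

  placeColumn : Place → ℤ
  placeColumn (inj₁ i)              = 0ℤ + + toℕ i
  placeColumn (inj₂ (inj₁ (j , k))) = 0ℤ + + toℕ k
  placeColumn (inj₂ (inj₂ i))       = x + + toℕ i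

  placeDart : Place → A
  placeDart p = at 0F (placeColumn p) (+ placeRow p)

  place-find : ∀ e → ∃ λ p → SameCycle φ (placeDart p) e
  place-find e with k , m , n , refl ← onto e with row-fold (m , SameFace-at k m n)
  ... | zero , _ , row =
    let i , i≤ , c = spine-cover width-period 0ℤ centre-S row in
    inj₁ (fromℕ< (s≤s i≤)) ,
    subst (λ i → SameCycle φ (at 0F (0ℤ + + i) 0ℤ) _) (sym (Fin.toℕ-fromℕ< (s≤s i≤))) c
  ... | suc j , s≤s j≤b , row with ℕ.m≤n⇒m<n∨m≡n j≤b
  ... | inj₁ j<b =
    let k , k<w , c = belt-cover width-period 0ℤ row in
    inj₂ (inj₁ (fromℕ< j<b , fromℕ< k<w)) ,
    subst₂ (λ j k → SameCycle φ (at 0F (0ℤ + + k) (+ suc j)) _)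
      (sym (Fin.toℕ-fromℕ< j<b)) (sym (Fin.toℕ-fromℕ< k<w)) c
  ... | inj₂ refl =
    let i , i≤ , c = spine-cover width-period x centre-S′ row in
    inj₂ (inj₂ (fromℕ< (s≤s i≤))) ,
    subst (λ i → SameCycle φ (at 0F (x + + i) (+ suc b)) _) (sym (Fin.toℕ-fromℕ< (s≤s i≤))) c

  placeRow≤ : ∀ p → placeRow p ≤ suc b
  placeRow≤ (inj₁ i)              = z≤n
  placeRow≤ (inj₂ (inj₁ (j , k))) = s≤s (ℕ.<⇒≤ (Fin.toℕ<n j))
  placeRow≤ (inj₂ (inj₂ i))       = ℕ.≤-refl

  place-separate : ∀ p p′ → SameCycle φ (placeDart p) (placeDart p′) → p ≡ p′
  place-separate p p′ c = go p p′ (row-unique (placeRow≤ p) (placeRow≤ p′)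
      (placeColumn p , c) (placeColumn p′ , SameCycle-refl)) c
    where
    go : ∀ p p′ → placeRow p ≡ placeRow p′ → SameCycle φ (placeDart p) (placeDart p′) → p ≡ p′
    go (inj₁ i) (inj₁ i′) _ c = cong inj₁ (Fin.toℕ-injective
      (spine-separate only-width 0ℤ centre-S (Fin.toℕ≤pred[n] i) (Fin.toℕ≤pred[n] i′) c))
    go (inj₂ (inj₁ (j , k))) (inj₂ (inj₁ (j′ , k′))) eq c
      with refl ← Fin.toℕ-injective (ℕ.suc-injective eq) =
      cong (λ k → inj₂ (inj₁ (j , k))) (Fin.toℕ-injective (belt-separate only-width 0ℤ
        (no-centre z<s (Fin.toℕ<n j)) (Fin.toℕ<n k) (Fin.toℕ<n k′) c))
    go (inj₂ (inj₂ i)) (inj₂ (inj₂ i′)) _ c = cong (inj₂ ∘ inj₂) (Fin.toℕ-injective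
      (spine-separate only-width x centre-S′ (Fin.toℕ≤pred[n] i) (Fin.toℕ≤pred[n] i′) c))
    go (inj₁ _) (inj₂ (inj₁ _)) ()
    go (inj₁ _) (inj₂ (inj₂ _)) ()
    go (inj₂ (inj₁ (j , _))) (inj₂ (inj₂ _)) eq = contradiction (ℕ.suc-injective eq) (ℕ.<⇒≢ (Fin.toℕ<n j))
    go (inj₂ (inj₂ _)) (inj₂ (inj₁ (j , _))) eq = contradiction (ℕ.suc-injective (sym eq))
      (ℕ.<⇒≢ (Fin.toℕ<n j))

  face-count : CycleCount φ #places
  face-count = Periodic.transversal⇒count φ 5 φ⁶ (placeDart ∘ Inverse.to places)
    (λ e → let p , c = place-find e in Inverse.from places p ,
           subst (λ p → SameCycle φ (placeDart p) e) (sym (Inverse.strictlyInverseˡ places p)) c)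
    (λ i j c → Injection.injective (↔⇒↣ places) (place-separate _ _ c))

-- The trihex carried by a framing

module TrihexOf {A : Set} {φ α : A → A} {s b x} (F : Framing φ α s b x)
                (finite : A ↔ Fin (3 ℕ.* ((2 ℕ.* s ℕ.+ 2) ℕ.* (2 ℕ.* b ℕ.+ 2)))) where
  open FramingRows F
  open Endo A using (_^_)

  private
    height : ℕ
    height = 2 ℕ.* b ℕ.+ 2

  even≢odd : ∀ h k → h + h ≢ 1ℤ + (k + k)
  even≢odd h k eq = contradiction
    (remainder-unique {0} {1} {2} (k - h) (s≤s z≤n) (s≤s (s≤s z≤n))
    (trans (l h) (trans (cong (λ y → y - (h + h)) eq) (l′ h k)))) λ ()
    where
    l : ∀ h → 0ℤ ≡ (h + h) - (h + h)
    l = solve-∀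
    l′ : ∀ h k → (1ℤ + (k + k)) - (h + h) ≡ 1ℤ + (k - h) * + 2
    l′ = solve-∀

  period-even : ∀ {m n} → Period m n → (∃ λ i → m ≡ i + i) × (∃ λ j → n ≡ j + j)
  period-even per with p , q , refl , refl ← period⇒lattice per =
    (p * + suc s + q * x , trans (cong (λ w → p * w + q * (x + x)) (double s)) (l p (+ suc s) q x)) ,
    (q * + suc b , trans (cong (q *_) (double b)) (l′ q (+ suc b)))
    where
    l : ∀ p w q x → p * (w + w) + q * (x + x) ≡ (p * w + q * x) + (p * w + q * x)
    l = solve-∀
    l′ : ∀ q w → q * (w + w) ≡ q * w + q * w
    l′ = solve-∀

  -- A fixed dart would make the midpoint of its edge a centre, hence give a period with an odd
  -- coordinate, whereas both generators are even.
  α-free : ∀ e → α e ≢ e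
  α-free e eq with onto e
  ... | 0F , m , n , refl with (i , eq′) , _ ← period-even (≡⇒period 0F (trans (sym (α-at0 m n)) eq)) =
    even≢odd i (-1ℤ - m) (trans (sym eq′) (l m))
    where
    l : ∀ m → -1ℤ - m - m ≡ 1ℤ + ((-1ℤ - m) + (-1ℤ - m))
    l = solve-∀
  ... | 1F , m , n , refl with _ , (j , eq′) ← period-even (≡⇒period 1F (trans (sym (α-at1 m n)) eq)) =
    even≢odd j (- n) (trans (sym eq′) (l n))
    where
    l : ∀ m → 1ℤ - m - m ≡ 1ℤ + (- m + - m)
    l = solve-∀
  ... | 2F , m , n , refl with (i , eq′) , _ ← period-even (≡⇒period 2F (trans (sym (α-at2 m n)) eq)) =
    even≢odd i (- m) (trans (sym eq′) (l m))
    where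
    l : ∀ m → 1ℤ - m - m ≡ 1ℤ + (- m + - m)
    l = solve-∀

  α² : ∀ e → α (α e) ≡ e
  α² e with onto e
  ... | 0F , m , n , refl = trans (cong α (α-at0 m n)) (trans (α-at0 _ _)
    (cong₂ (at 0F) (l m) (ℤ.neg-involutive n)))
    where
    l : ∀ m → -1ℤ - (-1ℤ - m) ≡ m
    l = solve-∀
  ... | 1F , m , n , refl = trans (cong α (α-at1 m n)) (trans (α-at1 _ _)
    (cong₂ (at 1F) (ℤ.neg-involutive m) (l n)))
    where
    l : ∀ m → 1ℤ - (1ℤ - m) ≡ m
    l = solve-∀
  ... | 2F , m , n , refl = trans (cong α (α-at2 m n)) (trans (α-at2 _ _)
    (cong₂ (at 2F) (l m) (l n)))
    where
    l : ∀ m → 1ℤ - (1ℤ - m) ≡ m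
    l = solve-∀

  φα-at0 : ∀ m n → φ (α (at 0F m n)) ≡ at 1F (-1ℤ - m) (- n)
  φα-at0 m n = trans (cong φ (α-at0 m n)) (φ-at0 _ _)

  φα-at1 : ∀ m n → φ (α (at 1F m n)) ≡ at 2F (- m) (1ℤ - n)
  φα-at1 m n = trans (cong φ (α-at1 m n)) (φ-at1 _ _)

  φα-at2 : ∀ m n → φ (α (at 2F m n)) ≡ at 0F (- (1ℤ - m)) (- (1ℤ - n))
  φα-at2 m n = trans (cong φ (α-at2 m n)) (φ-at2 _ _)

  φα³ : ∀ e → φ (α (φ (α (φ (α e))))) ≡ e
  φα³ e with onto e
  ... | 0F , m , n , refl = trans (cong (φ ∘ α ∘ φ ∘ α) (φα-at0 m n))
    (trans (cong (φ ∘ α) (φα-at1 _ _)) (trans (φα-at2 _ _) (cong₂ (at 0F) (l m) (l′ n))))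
    where
    l : ∀ m → - (1ℤ - - (-1ℤ - m)) ≡ m
    l = solve-∀
    l′ : ∀ n → - (1ℤ - (1ℤ - - n)) ≡ n
    l′ = solve-∀
  ... | 1F , m , n , refl = trans (cong (φ ∘ α ∘ φ ∘ α) (φα-at1 m n))
    (trans (cong (φ ∘ α) (φα-at2 _ _)) (trans (φα-at0 _ _) (cong₂ (at 1F) (l m) (l′ n))))
    where
    l : ∀ m → -1ℤ - - (1ℤ - - m) ≡ m
    l = solve-∀
    l′ : ∀ n → - - (1ℤ - (1ℤ - n)) ≡ n
    l′ = solve-∀
  ... | 2F , m , n , refl = trans (cong (φ ∘ α ∘ φ ∘ α) (φα-at2 m n))
    (trans (cong (φ ∘ α) (φα-at0 _ _)) (trans (φα-at1 _ _) (cong₂ (at 2F) (l m) (l′ n))))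
    where
    l : ∀ m → - (-1ℤ - - (1ℤ - m)) ≡ m
    l = solve-∀
    l′ : ∀ n → 1ℤ - - - (1ℤ - n) ≡ n
    l′ = solve-∀

  -- `φα` permutes the colours cyclically: the three edges at a vertex have three different
  -- directions.
  φα-free : ∀ e → φ (α e) ≢ e
  φα-free e eq with onto e
  ... | 0F , m , n , refl = contradiction (colour (trans (sym (φα-at0 m n)) eq)) λ ()
  ... | 1F , m , n , refl = contradiction (colour (trans (sym (φα-at1 m n)) eq)) λ ()
  ... | 2F , m , n , refl = contradiction (colour (trans (sym (φα-at2 m n)) eq)) λ ()

  φ-colours : ∀ e → φ e ≢ e × φ (φ e) ≢ e
  φ-colours e with onto e
  ... | 0F , m , n , refl =
    (λ eq → contradiction (colour (trans (sym (φ-at0 m n)) eq)) λ ()) ,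
    (λ eq → contradiction (colour (trans (sym (trans (cong φ (φ-at0 m n)) (φ-at1 m n))) eq)) λ ())
  ... | 1F , m , n , refl =
    (λ eq → contradiction (colour (trans (sym (φ-at1 m n)) eq)) λ ()) ,
    (λ eq → contradiction (colour (trans (sym (trans (cong φ (φ-at1 m n)) (φ-at2 m n))) eq)) λ ())
  ... | 2F , m , n , refl =
    (λ eq → contradiction (colour (trans (sym (φ-at2 m n)) eq)) λ ()) ,
    (λ eq → contradiction (colour (trans (sym (trans (cong φ (φ-at2 m n)) (φ-at0 _ _))) eq)) λ ())

  rotation : A ↔ A
  rotation = mk↔ₛ′ (λ e → φ (α (φ (α e)))) (φ ∘ α)  φα³ φα³

  -- The face permutation that `PlanarMap` derives from `rotation` and `α`. It agrees with `φ` only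
  -- pointwise, so the framing has to be restated for it.
  φ′ : A → A
  φ′ = φ ∘ α ∘ α

  φ≡φ′ : ∀ e → φ e ≡ φ′ e
  φ≡φ′ e = cong φ (sym (α² e))

  framing : Framing φ′ α s b x
  framing = record
    { chart = record
      { at     = at
      ; φ-at0  = λ m n → trans (sym (φ≡φ′ _)) (φ-at0 m n)
      ; φ-at1  = λ m n → trans (sym (φ≡φ′ _)) (φ-at1 m n)
      ; φ-at2  = λ m n → trans (sym (φ≡φ′ _)) (φ-at2 m n)
      ; α-at0  = α-at0
      ; α-at1  = α-at1
      ; α-at2  = α-at2
      ; onto   = onto
      ; colour = colour
      }
    ; period⇒lattice = period⇒lattice
    ; width-period   = width-period
    ; height-period  = height-period
    }

  private
    σ : A → A
    σ = Inverse.to rotation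

    module F′ = FramingRows framing

  σ-length : ∀ e → CycleLength σ e 3
  σ-length e = z<s ,
    trans (cong (φ ∘ α ∘ φ ∘ α) (φα³ (φ (α e)))) (φα³ e) , minimal
    where
    minimal : ∀ k → 0 < k → k < 3 → (σ ^ k) e ≢ e
    minimal 1 _ _ eq = φα-free e (trans (cong (φ ∘ α) (sym eq)) (φα³ e))
    minimal 2 _ _ eq = φα-free e (trans (sym (φα³ (φ (α e)))) eq)
    minimal (suc (suc (suc k))) _ (s≤s (s≤s (s≤s ())))

  α-length : ∀ e → CycleLength α e 2
  α-length e = z<s , α² e , minimal
    where
    minimal : ∀ k → 0 < k → k < 2 → (α ^ k) e ≢ e
    minimal 1 _ _ eq = α-free e eq
    minimal (suc (suc k)) _ (s≤s (s≤s ()))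

  φ′-colours : ∀ e → φ′ e ≢ e × φ′ (φ′ e) ≢ e
  φ′-colours e =
    (λ eq → proj₁ (φ-colours e) (trans (φ≡φ′ e) eq)) ,
    (λ eq → proj₂ (φ-colours e) (trans (cong φ (φ≡φ′ e)) (trans (φ≡φ′ _) eq)))

  φ′-length : ∀ e → CycleLength φ′ e 3 ⊎ CycleLength φ′ e 6
  φ′-length e with finite⇒≟ finite ((φ′ ^ 3) e) e
  ... | yes φ³ = inj₁ (z<s , φ³ , minimal)
    where
    minimal : ∀ k → 0 < k → k < 3 → (φ′ ^ k) e ≢ e
    minimal 1 _ _ = proj₁ (φ′-colours e)
    minimal 2 _ _ = proj₂ (φ′-colours e)
    minimal (suc (suc (suc k))) _ (s≤s (s≤s (s≤s ())))
  ... | no ¬φ³ = inj₂ (z<s , F′.φ⁶ e , minimal)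
    where
    minimal : ∀ k → 0 < k → k < 6 → (φ′ ^ k) e ≢ e
    minimal 1 _ _ = proj₁ (φ′-colours e)
    minimal 2 _ _ = proj₂ (φ′-colours e)
    minimal 3 _ _ = ¬φ³
    minimal 4 _ _ eq = proj₂ (φ′-colours e) (trans (cong (φ′ ^ 2) (sym eq)) (F′.φ⁶ e))
    minimal 5 _ _ eq = proj₁ (φ′-colours e) (trans (cong φ′ (sym eq)) (F′.φ⁶ e))
    minimal (suc (suc (suc (suc (suc (suc k)))))) _ (s≤s (s≤s (s≤s (s≤s (s≤s (s≤s ()))))))

  Joined : A → A → Set
  Joined = EqClosure (λ d e → σ d ≡ e ⊎ α d ≡ e)

  joined-refl : ∀ {d} → Joined d d
  joined-refl = EqClosure.reflexive _

  joined-trans : ∀ {d e f} → Joined d e → Joined e f → Joined d f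
  joined-trans = EqClosure.transitive _

  joined-sym : ∀ {d e} → Joined d e → Joined e d
  joined-sym = EqClosure.symmetric _

  joined-α : ∀ e → Joined e (α e)
  joined-α e = EqClosure.return (inj₂ refl)

  joined-φ : ∀ e → Joined e (φ e)
  joined-φ e = joined-trans (joined-α e) (joined-sym (EqClosure.return
    (inj₁ (trans (cong (φ ∘ α ∘ φ ∘ α) (φ≡φ′ e)) (φα³ (α e))))))

  joined : ∀ d e → Joined d e
  joined d e = joined-trans (joined-sym (from-origin d)) (from-origin e)
    where
    φ³-joined : ∀ e → Joined e ((φ ^ 3) e)
    φ³-joined e = joined-trans (joined-φ e) (joined-trans (joined-φ _) (joined-φ _))
    right left up down : ∀ m n → _
    right m n = subst (Joined (at 0F m n)) (ahead-at m n) (joined-trans (joined-α _) (φ³-joined _))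
    left m n = subst (Joined (at 0F m n)) (behind-at m n) (joined-trans (φ³-joined _) (joined-α _))
    up m n = subst (Joined (at 0F m n)) (above-at m n)
      (joined-trans (joined-φ _) (joined-trans (joined-α _) (joined-trans (joined-φ _) (joined-φ _))))
    down m n = subst (Joined (at 0F m n)) (below-at m n)
      (joined-trans (φ³-joined _) (joined-trans (joined-φ _) (joined-trans (joined-α _)
        (joined-trans (joined-φ _) (joined-trans (joined-φ _) (φ³-joined _))))))
    from-origin : ∀ e → Joined (at 0F 0ℤ 0ℤ) e
    from-origin e with k , m , n , refl ← onto e = joined-trans
      (ℤ-ind (λ m → Joined (at 0F 0ℤ 0ℤ) (at 0F m 0ℤ)) joined-refl
        (λ i j → joined-trans j (right i 0ℤ)) (λ i j → joined-trans j (left i 0ℤ)) m)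
      (joined-trans
      (ℤ-ind (λ n → Joined (at 0F m 0ℤ) (at 0F m n)) joined-refl
        (λ i j → joined-trans j (down m i)) (λ i j → joined-trans j (up m i)) n)
      (colours k m n))
      where
      colours : ∀ k m n → Joined (at 0F m n) (at k m n)
      colours 0F m n = joined-refl
      colours 1F m n = subst (Joined _) (φ-at0 m n) (joined-φ _)
      colours 2F m n = joined-trans (colours 1F m n) (subst (Joined _) (φ-at1 m n) (joined-φ _))

  private
    vertex-count : ∃ (CycleCount σ)
    vertex-count = Periodic.cycleCount σ 2 (λ e → proj₁ (proj₂ (σ-length e))) finite

    edge-count : ∃ (CycleCount α)
    edge-count = Periodic.cycleCount α 1 α² finite

    halved : ∀ s h → 3 ℕ.* ((2 ℕ.* s ℕ.+ 2) ℕ.* h) ≡ (3 ℕ.* (suc s ℕ.* h)) ℕ.* 2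
    halved = ℕ-Solver.solve-∀

    -- Let `N = width * height`, the number of hexagons of the torus before the half turn is divided
    -- out. The half turn fixes four of them and pairs the others, so `F = N / 2 + 2`, while `V = N`
    -- and `E = 3N / 2`.
    euler-arithmetic : ∀ v e → v ℕ.* 3 ≡ 3 ℕ.* (width ℕ.* height) → e ℕ.* 2 ≡ 3 ℕ.* (width ℕ.* height) →
                       v ℕ.+ #places ≡ e ℕ.+ 2
    euler-arithmetic v e 3v≡ 2e≡
      with refl ← ℕ.*-cancelʳ-≡ v (width ℕ.* height) 3 (trans 3v≡ (ℕ.*-comm 3 (width ℕ.* height)))
         | refl ← ℕ.*-cancelʳ-≡ e (3 ℕ.* (suc s ℕ.* height)) 2 (trans 2e≡ (halved s height))
      = l s b
      where
      l : ∀ s b → (2 ℕ.* s ℕ.+ 2) ℕ.* (2 ℕ.* b ℕ.+ 2) ℕ.+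
             (suc (suc s) ℕ.+ (b ℕ.* (2 ℕ.* s ℕ.+ 2) ℕ.+ suc (suc s))) ≡
           3 ℕ.* (suc s ℕ.* (2 ℕ.* b ℕ.+ 2)) ℕ.+ 2
      l = ℕ-Solver.solve-∀

  trihex : Trihex
  trihex = record
    { planarMap = record
      { Dart      = A
      ; #darts    = _
      ; finite    = finite
      ; rotation  = rotation
      ; α         = α
      ; α-cycle   = α-length
      ; connected = joined
      ; #V        = proj₁ vertex-count
      ; #E        = proj₁ edge-count
      ; #F        = #places
      ; vertices  = proj₂ vertex-count
      ; edges     = proj₂ edge-count
      ; faces     = F′.face-count
      ; euler     = euler-arithmetic _ _ (cycles*length finite 2 (proj₂ vertex-count) σ-length)
                                         (cycles*length finite 1 (proj₂ edge-count) α-length)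
      }
    ; cubic     = σ-length
    ; faceSizes = φ′-length
    }

-- The quotient of the tiling by a lattice

module Model (s b : ℕ) (x : ℤ) where
  private
    width height : ℕ
    width  = 2 ℕ.* s ℕ.+ 2
    height = 2 ℕ.* b ℕ.+ 2

  Residue : Set
  Residue = Fin width × Fin height

  column row : Residue → ℤ
  column (i , j) = + toℕ i
  row    (i , j) = + toℕ j

  private
    In : ℤ → ℤ → Set
    In = InLattice s b x

  In-neg : ∀ {m n} → In m n → In (- m) (- n)
  In-neg (p , q , refl , refl) = - p , - q , l p _ q _ , l′ q _
    where
    l : ∀ p w q y → - (p * w + q * y) ≡ - p * w + - q * y
    l = solve-∀
    l′ : ∀ q h → - (q * h) ≡ - q * h
    l′ = solve-∀

  In-+ : ∀ {m n m′ n′} → In m n → In m′ n′ → In (m + m′) (n + n′)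
  In-+ (p , q , refl , refl) (p′ , q′ , refl , refl) = p + p′ , q + q′ , l p p′ _ q q′ _ , l′ q q′ _
    where
    l : ∀ p p′ w q q′ y → p * w + q * y + (p′ * w + q′ * y) ≡ (p + p′) * w + (q + q′) * y
    l = solve-∀
    l′ : ∀ q q′ h → q * h + q′ * h ≡ (q + q′) * h
    l′ = solve-∀

  abstract
    -- The generators are triangular: reducing the row shears the column by multiples of `2x`, so
    -- the row is divided first.
    residue : ℤ → ℤ → Residue
    residue m n = fromℕ< (ℤ.n%ℕd<d
      (m - (n ℤ./ℕ height) {{Folding.width≢0 b}} * (x + x)) width {{Folding.width≢0 s}}) ,
                  fromℕ< (ℤ.n%ℕd<d n height {{Folding.width≢0 b}})

    residue-In : ∀ m n → In (m - column (residue m n)) (n - row (residue m n))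
    residue-In m n = p , q ,
      trans (cong (λ i → m - + i) (Fin.toℕ-fromℕ< _))
        (trans (l m (q * (x + x)) (+ i)) (trans
          (cong (λ y → y - + i + q * (x + x))
          (ℤ.a≡a%ℕn+[a/ℕn]*n (m - q * (x + x)) width {{Folding.width≢0 s}}))
          (l′ (+ i) (p * + width) (q * (x + x))))) ,
      trans (cong (λ j → n - + j) (Fin.toℕ-fromℕ< _))
        (trans (cong (_- + j) (ℤ.a≡a%ℕn+[a/ℕn]*n n height {{Folding.width≢0 b}})) (l″ (+ j) (q * + height)))
      where
      q p : ℤ
      q = (n ℤ./ℕ height) {{Folding.width≢0 b}}
      p = ((m - q * (x + x)) ℤ./ℕ width) {{Folding.width≢0 s}}
      i j : ℕ
      i = ((m - q * (x + x)) ℤ.%ℕ width) {{Folding.width≢0 s}}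
      j = (n ℤ.%ℕ height) {{Folding.width≢0 b}}
      l : ∀ m y i → m - i ≡ (m - y) - i + y
      l = solve-∀
      l′ : ∀ i z y → (i + z) - i + y ≡ z + y
      l′ = solve-∀
      l″ : ∀ j y → (j + y) - j ≡ y
      l″ = solve-∀

  In-residues : ∀ r r′ → In (column r - column r′) (row r - row r′) → r ≡ r′
  In-residues (i , j) (i′ , j′) (p , q , eq , eq′) = cong₂ _,_ (Fin.toℕ-injective i≡i′)
    (Fin.toℕ-injective j≡j′)
    where
    l : ∀ i j → i ≡ j + (i - j)
    l = solve-∀
    l′ : ∀ y z → y + 0ℤ * z ≡ y
    l′ = solve-∀
    l″ : ∀ j → j - j ≡ 0ℤ
    l″ = solve-∀
    j≡j′ : toℕ j ≡ toℕ j′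
    j≡j′ = remainder-unique q (Fin.toℕ<n j) (Fin.toℕ<n j′)
      (trans (l (+ toℕ j) (+ toℕ j′)) (cong (λ y → + toℕ j′ + y) eq′))
    q≡0 : q ≡ 0ℤ
    q≡0 = *-zero q height {{Folding.width≢0 b}}
      (trans (sym (trans (cong (λ k → + k - + toℕ j′) j≡j′) (l″ (+ toℕ j′)))) eq′)
    i≡i′ : toℕ i ≡ toℕ i′
    i≡i′ = remainder-unique p (Fin.toℕ<n i) (Fin.toℕ<n i′)
      (trans (l (+ toℕ i) (+ toℕ i′)) (cong (λ y → + toℕ i′ + y)
        (trans eq (trans (cong (λ q → p * + width + q * (x + x)) q≡0) (l′ (p * + width) (x + x))))))

  residue-cong : ∀ {m n m′ n′} → In (m - m′) (n - n′) → residue m n ≡ residue m′ n′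
  residue-cong {m} {n} {m′} {n′} per = In-residues (residue m n) (residue m′ n′)
    (subst₂ In (l m m′ _ _) (l n n′ _ _)
      (In-+ (In-neg (residue-In m n)) (In-+ per (residue-In m′ n′))))
    where
    l : ∀ m m′ i i′ → - (m - i) + ((m - m′) + (m′ - i′)) ≡ i - i′
    l = solve-∀

  residue-injective : ∀ {m n m′ n′} → residue m n ≡ residue m′ n′ → In (m - m′) (n - n′)
  residue-injective {m} {n} {m′} {n′} eq =
    subst₂ In (l m m′ _) (l n n′ _)
      (In-+ (residue-In m n) (subst (λ r → In (- (m′ - column r)) (- (n′ - row r))) (sym eq)
        (In-neg (residue-In m′ n′))))
    where
    l : ∀ m m′ i → (m - i) + - (m′ - i) ≡ m - m′
    l = solve-∀

  residue-residue : ∀ r → residue (column r) (row r) ≡ r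
  residue-residue r = sym (In-residues r (residue (column r) (row r)) (residue-In (column r) (row r)))

  Dart : Set
  Dart = Fin 3 × Residue

  -- The half turn about the point (a/2, c/2).
  turn : ℤ → ℤ → Residue → Residue
  turn a c r = residue (a - column r) (c - row r)

  turn-residue : ∀ a c m n → turn a c (residue m n) ≡ residue (a - m) (c - n)
  turn-residue a c m n = residue-cong (subst₂ In (l a m _) (l c n _) (residue-In m n))
    where
    l : ∀ a m i → m - i ≡ (a - i) - (a - m)
    l = solve-∀

  φ α : Dart → Dart
  φ (0F , r) = 1F , r
  φ (1F , r) = 2F , r
  φ (2F , r) = 0F , turn 0ℤ 0ℤ r
  α (0F , r) = 0F , turn -1ℤ 0ℤ r
  α (1F , r) = 1F , turn 0ℤ 1ℤ r
  α (2F , r) = 2F , turn 1ℤ 1ℤ r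

  framing : Framing φ α s b x
  framing = record
    { chart = record
      { at     = λ k m n → k , residue m n
      ; φ-at0  = λ m n → refl
      ; φ-at1  = λ m n → refl
      ; φ-at2  = λ m n → cong (0F ,_) (trans (turn-residue 0ℤ 0ℤ m n)
          (cong₂ residue (ℤ.+-identityˡ (- m)) (ℤ.+-identityˡ (- n))))
      ; α-at0  = λ m n → cong (0F ,_)
        (trans (turn-residue -1ℤ 0ℤ m n) (cong (residue _) (ℤ.+-identityˡ (- n))))
      ; α-at1  = λ m n → cong (1F ,_)
        (trans (turn-residue 0ℤ 1ℤ m n) (cong (λ m → residue m _) (ℤ.+-identityˡ (- m))))
      ; α-at2  = λ m n → cong (2F ,_) (turn-residue 1ℤ 1ℤ m n)
      ; onto   = λ { (k , r) → k , column r , row r , cong (k ,_) (residue-residue r) }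
      ; colour = cong proj₁
      }
    ; period⇒lattice = λ {m} {n} per → subst₂ In (ℤ.+-identityʳ m) (ℤ.+-identityʳ n)
        (residue-injective {m} {n} {0ℤ} {0ℤ} (cong proj₂ per))
    ; width-period   = cong (0F ,_)
      (residue-cong {+ width} {0ℤ} {0ℤ} {0ℤ} (1ℤ , 0ℤ , l (+ width) (x + x) , refl))
    ; height-period  = cong (0F ,_)
      (residue-cong {x + x} {+ height} {0ℤ} {0ℤ} (0ℤ , 1ℤ , l′ (+ width) (x + x) , l″ (+ height)))
    }
    where
    l : ∀ w y → w + 0ℤ ≡ 1ℤ * w + 0ℤ * y
    l = solve-∀
    l′ : ∀ w y → y + 0ℤ ≡ 0ℤ * w + 1ℤ * y
    l′ = solve-∀
    l″ : ∀ h → h + 0ℤ ≡ 1ℤ * h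
    l″ = solve-∀

  finite : Dart ↔ Fin (3 ℕ.* (width ℕ.* height))
  finite = ↔-sym ((↔-id _ ×-↔ Fin.*↔×) ↔-∘ Fin.*↔×)

  open TrihexOf framing finite public using (trihex) renaming (framing to trihex-framing)

abstract
  model : ∀ s b x → Σ[ T ∈ Trihex ] Framing (Trihex.φ T) (Trihex.α T) s b x
  model s b x = Model.trihex s b x , Model.trihex-framing s b x

-- From lattices to signatures

pos-twice : ∀ k → + twice k ≡ + k + + k
pos-twice k = cong +_ (trans (twice≡ k) (cong (k ℕ.+_) (ℕ.+-identityʳ k)))

pos-4s+4 : ∀ s → + (4 ℕ.* s ℕ.+ 4) ≡ + (2 ℕ.* s ℕ.+ 2) + + (2 ℕ.* s ℕ.+ 2)
pos-4s+4 s = cong +_ (l s)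
  where
  l : ∀ s → 4 ℕ.* s ℕ.+ 4 ≡ (2 ℕ.* s ℕ.+ 2) ℕ.+ (2 ℕ.* s ℕ.+ 2)
  l = ℕ-Solver.solve-∀

module AlignedFormation (T : Trihex) (C : Chart (Trihex.φ T) (Trihex.α T)) (s : ℕ) where
  open TrihexProperties T
  open ChartProperties C
  open Rows C s
  open Pieces T C s

  module _ (width-period : Period (+ width) 0ℤ) {b} (S : Spine s) (S-first : Spine.first S ≡ at 0F 0ℤ 0ℤ)
           (Bs : Vec (Belt width) b) (S′ : Spine s) (aligned : Aligned width-period 1ℤ Bs S′) where

    piece⇒row : ∀ p {e} → lookup (Spine.Contains S ∷ (map Belt.Contains Bs ∷ʳ Spine.Contains S′)) p e →
                Row (+ toℕ p) e
    piece⇒row Fin.zero    = spine-row⇒ S S-first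
    piece⇒row (Fin.suc p) = piece-row⇒ width-period Bs S′ aligned p

    row⇒piece : ∀ p {e} → Row (+ toℕ p) e →
                lookup (Spine.Contains S ∷ (map Belt.Contains Bs ∷ʳ Spine.Contains S′)) p e
    row⇒piece Fin.zero    = spine-row⇐ width-period S S-first refl
    row⇒piece (Fin.suc p) = piece-row⇐ width-period Bs S′ aligned p

  -- The position of the only dart of colour 2 starting at the same vertex.
  vertexColumn vertexRow : Fin 3 → ℤ → ℤ → ℤ
  vertexColumn 0F m n = 1ℤ + m
  vertexColumn 1F m n = - m
  vertexColumn 2F m n = m
  vertexRow 0F m n = 1ℤ + n
  vertexRow 1F m n = 1ℤ - n
  vertexRow 2F m n = n

  φα-vertex : ∀ k m n → ∃ λ k′ → ∃₂ λ m′ n′ → φ (α (at k m n)) ≡ at k′ m′ n′ ×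
              vertexColumn k′ m′ n′ ≡ vertexColumn k m n × vertexRow k′ m′ n′ ≡ vertexRow k m n
  φα-vertex 0F m n = 1F , _ , _ , trans (cong φ (α-at0 m n)) (φ-at0 _ _) , l m , l′ n
    where
    l : ∀ m → - (-1ℤ - m) ≡ 1ℤ + m
    l = solve-∀
    l′ : ∀ n → 1ℤ - - n ≡ 1ℤ + n
    l′ = solve-∀
  φα-vertex 1F m n = 2F , _ , _ , trans (cong φ (α-at1 m n)) (φ-at1 _ _) , refl , refl
  φα-vertex 2F m n = 0F , _ , _ , trans (cong φ (α-at2 m n)) (φ-at2 _ _) , l m , l n
    where
    l : ∀ m → 1ℤ + - (1ℤ - m) ≡ m
    l = solve-∀

  σ-vertex : ∀ i k m n → ∃ λ k′ → ∃₂ λ m′ n′ → (σ ^ i) (at k m n) ≡ at k′ m′ n′ ×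
             vertexColumn k′ m′ n′ ≡ vertexColumn k m n × vertexRow k′ m′ n′ ≡ vertexRow k m n
  σ-vertex zero k m n = k , m , n , refl , refl , refl
  σ-vertex (suc i) k m n
    with k₁ , m₁ , n₁ , eq₁ , c₁ , r₁ ← σ-vertex i k m n
    with k₂ , m₂ , n₂ , eq₂ , c₂ , r₂ ← φα-vertex k₁ m₁ n₁
    with k₃ , m₃ , n₃ , eq₃ , c₃ , r₃ ← φα-vertex k₂ m₂ n₂ =
    k₃ , m₃ , n₃ , trans (cong σ eq₁) (trans (σ≡φαφα _) (trans (cong (φ ∘ α) eq₂) eq₃)) ,
    trans c₃ (trans c₂ c₁) , trans r₃ (trans r₂ r₁)

  SameVertex⇒ : ∀ k {m n p q} → SameVertex (at k m n) (at 2F p q) →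
                Period (vertexColumn k m n - p) (vertexRow k m n - q)
  SameVertex⇒ k {m} {n} {p} {q} (i , eq)
    with k′ , m′ , n′ , eq′ , c , r ← σ-vertex i k m n
    with refl ← colour (trans (sym eq′) eq) =
    subst₂ (λ c r → Period (c - p) (r - q)) c r (≡⇒period 2F (trans (sym eq′) eq))

  SameVertex-1-2 : ∀ m n → SameVertex (at 1F m n) (at 2F (- m) (1ℤ - n))
  SameVertex-1-2 m n = 2 , trans (cong σ (σ≡φαφα _)) (trans (σ≡φαφα _)
    (trans (cong (φ ∘ α) (φα³ _)) (trans (cong φ (α-at1 m n)) (φ-at1 _ _))))

module Meetings (T : Trihex) {s x} (F : Framing (Trihex.φ T) (Trihex.α T) s 0 x)
                (D : Parts.Formation T s 0)
                (S-first : Parts.Spine.first (Parts.Formation.S D) ≡ Framing.at F 0F 0ℤ 0ℤ)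
                (S′-first : Parts.Spine.first (Parts.Formation.S′ D) ≡ Framing.at F 0F x 1ℤ) where
  open TrihexProperties T
  open FramingRows F
  open Pieces T chart s
  open AlignedFormation T chart s
  open Formation D using (S; S′)

  head-at : Spine.headDart S′ ≡ at 2F x 1ℤ
  head-at = trans (cong (φ ∘ φ) S′-first) (trans (cong φ (φ-at0 x 1ℤ)) (φ-at1 x 1ℤ))

  tail-at : Spine.tailDart S′ ≡ at 2F (-1ℤ - (x + + s)) -1ℤ
  tail-at = trans (cong (λ d → φ (φ (α ((ahead ^ s) d)))) S′-first)
    (trans (cong (φ ∘ φ ∘ α) (ahead^-at s x 1ℤ))
      (trans (cong (φ ∘ φ) (α-at0 _ 1ℤ)) (trans (cong φ (φ-at0 _ _)) (φ-at1 _ _))))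

  -- The even boundary vertices of `S` have row 0, the head and the tail of `S′` rows 1 and -1, and
  -- for `b = 0` every period changes the row by an even number.
  not-even : ∀ k → ¬ Meets D (twice k)
  not-even k (inj₁ c) with p , q , _ , eq ← period⇒lattice (Period-neg
      (SameVertex⇒ 2F (subst₂ SameVertex (boundary-even S S-first refl k) head-at c))) =
    contradiction (remainder-unique {1} {0} {2} q (s≤s (s≤s z≤n)) (s≤s z≤n)
      (trans eq (sym (ℤ.+-identityˡ _)))) λ ()
  not-even k (inj₂ c) with p , q , _ , eq ← period⇒lattice
      (SameVertex⇒ 2F (subst₂ SameVertex (boundary-even S S-first refl k) tail-at c)) =
    contradiction (remainder-unique {1} {0} {2} q (s≤s (s≤s z≤n)) (s≤s z≤n)
      (trans eq (sym (ℤ.+-identityˡ _)))) λ ()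

  -- Boundary vertex `2k + 1` has column `k + 1`. It is the head of `S′` only if this is `x` modulo
  -- `2s + 2`, and the tail only if it is `x + s + 1`; together they leave a condition modulo
  -- `s + 1`.
  at-odd : ∀ k → Meets D (suc (twice k)) → ∃ λ p → + suc k ≡ x + p * + suc s
  at-odd k (inj₁ c) with p , eq ← only-width
      (SameVertex⇒ 1F (subst₂ SameVertex (boundary-odd S S-first refl k) head-at c)) =
    p + p , trans (l (+ suc k) x) (trans
    (cong (λ y → x + y) (trans eq (cong (p *_) (double s)))) (l′ x p (+ suc s)))
    where
    l : ∀ k x → k ≡ x + (- (0ℤ - k) - x)
    l = solve-∀
    l′ : ∀ x p w → x + p * (w + w) ≡ x + (p + p) * w
    l′ = solve-∀
  at-odd k (inj₂ c) with p , eq ← only-width (Period-+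
      (SameVertex⇒ 1F (subst₂ SameVertex (boundary-odd S S-first refl k) tail-at c))
      (Period-neg height-period)) =
    p + p - 1ℤ , trans (l (+ suc k) x (+ s))
      (trans (cong (λ y → x + y - + suc s) (trans eq (cong (p *_) (double s)))) (l′ x p (+ suc s)))
    where
    l : ∀ k x s → k ≡ x + (- (0ℤ - k) - (-1ℤ - (x + s)) + - (x + x)) - (1ℤ + s)
    l = solve-∀
    l′ : ∀ x p w → x + p * (w + w) - w ≡ x + (p + p - 1ℤ) * w
    l′ = solve-∀

-- The shifts when all belts start in column 0: `a` is 0 after the first spine (`α-boundary`) and 1
-- after a belt (`α-outer`). The last entry carries in addition `suc c`, where `c + 2x` is a
-- multiple of `4s + 4`; this brings the second spine to column `x`.
shiftsFrom : (a c k : ℕ) → Vec ℕ (suc k)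
shiftsFrom a c zero    = (a ℕ.+ suc c) ∷ []
shiftsFrom a c (suc k) = a ∷ shiftsFrom 1 c k

-- Each deletion adds 2 to the accumulated shift, one from the rule of deletion and one from the
-- stagger of the belt. As `c + 2x` is kept, `x` falls by one for each belt, from `f + b + 1` to
-- `f + 1`.
deleteBelts-shiftsFrom : ∀ a c k → deleteBelts (shiftsFrom a c k) ≡ shiftsFrom a (c ℕ.+ 2 ℕ.* k) 0
deleteBelts-shiftsFrom a c zero    = cong (λ c → (a ℕ.+ suc c) ∷ []) (sym (ℕ.+-identityʳ c))
deleteBelts-shiftsFrom a c (suc k) = trans (cong deleteBelts (delete k))
  (trans (deleteBelts-shiftsFrom (a ℕ.+ 2) c k) (cong (_∷ []) (l a c k)))
  where
  l : ∀ a c k → a ℕ.+ 2 ℕ.+ suc (c ℕ.+ 2 ℕ.* k) ≡ a ℕ.+ suc (c ℕ.+ 2 ℕ.* suc k)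
  l = ℕ-Solver.solve-∀
  l′ : ∀ a c → a ℕ.+ 1 ℕ.+ (1 ℕ.+ suc c) ≡ a ℕ.+ 2 ℕ.+ suc c
  l′ = ℕ-Solver.solve-∀
  delete : ∀ k → deleteBelt (shiftsFrom a c (suc k)) ≡ shiftsFrom (a ℕ.+ 2) c k
  delete zero    = cong (_∷ []) (l′ a c)
  delete (suc k) = cong (_∷ shiftsFrom 1 c k) (ℕ.+-assoc a 1 1)

module FramingFormation (T : Trihex) {s b} (x : ℕ) (F : Framing (Trihex.φ T) (Trihex.α T) s b (+ x))
                        (c K : ℕ) (c+2x : c ℕ.+ 2 ℕ.* x ≡ K ℕ.* (4 ℕ.* s ℕ.+ 4)) where
  open TrihexProperties T
  open FramingRows F
  open Pieces T chart s
  open AlignedFormation T chart s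

  S S′ : Spine s
  S  = spineAt width-period only-width 0ℤ 0ℤ centre-S
  S′ = spineAt width-period only-width (+ x) (+ suc b) centre-S′

  beltsFrom : ∀ n k → 0 < n → n ℕ.+ k ≡ suc b → Vec (Belt width) k
  beltsFrom n zero    0<n eq = []
  beltsFrom n (suc k) 0<n eq =
    beltAt width-period only-width 0ℤ (+ n) (no-centre 0<n n≤b) ∷
    beltsFrom (suc n) k z<s (trans (sym (ℕ.+-suc n k)) eq)
    where
    n≤b : n ≤ b
    n≤b = subst (n ≤_) (ℕ.suc-injective (trans (sym (ℕ.+-suc n k)) eq)) (ℕ.m≤m+n n k)

  aligned : ∀ n k 0<n eq → Aligned width-period (+ n) (beltsFrom n k 0<n eq) S′
  aligned n zero    0<n eq = + x , cong (λ n → at 0F (+ x) (+ n)) (trans (sym eq) (ℕ.+-identityʳ n)) ,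
    subst (λ n → Period (+ x + + x) (+ n + + n)) (trans (sym eq) (ℕ.+-identityʳ n)) centre-S′
  aligned n (suc k) 0<n eq = (0ℤ , refl) , aligned (suc n) k z<s _

  -- Side `t` of the row and boundary edge `l` of `S′` coincide when `t + l + 2` is `2x` modulo
  -- `4s + 4`. Both numbers are even, so `t` and `l` have equal parity and the darts equal colour;
  -- halving then yields a multiple of the width.
  last-glue : ∀ a (y : ℕ → Dart) → (∀ j → α (y j) ≡ side 1ℤ (+ suc b) (a ℕ.+ j)) →
              ∀ j l → 4 ℕ.* s ℕ.+ 4 ∣ j ℕ.+ (a ℕ.+ suc c) ℕ.+ suc l → α (y j) ≡ Spine.boundary S′ l
  last-glue a y y-side j l (divides q eq) = trans (y-side j) (match (a ℕ.+ j) l total)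
    where
    total : (a ℕ.+ j) ℕ.+ l ℕ.+ 2 ℕ.+ K ℕ.* (4 ℕ.* s ℕ.+ 4) ≡ q ℕ.* (4 ℕ.* s ℕ.+ 4) ℕ.+ 2 ℕ.* x
    total = trans (cong ((a ℕ.+ j) ℕ.+ l ℕ.+ 2 ℕ.+_) (sym c+2x))
      (trans (rearrange a j l c x) (cong (ℕ._+ 2 ℕ.* x) eq))
      where
      rearrange : ∀ a j l c x → (a ℕ.+ j) ℕ.+ l ℕ.+ 2 ℕ.+ (c ℕ.+ 2 ℕ.* x) ≡
                  j ℕ.+ (a ℕ.+ suc c) ℕ.+ suc l ℕ.+ 2 ℕ.* x
      rearrange = ℕ-Solver.solve-∀
    Total : ℕ → ℕ → Set
    Total t l = t ℕ.+ l ℕ.+ 2 ℕ.+ K ℕ.* (4 ℕ.* s ℕ.+ 4) ≡ q ℕ.* (4 ℕ.* s ℕ.+ 4) ℕ.+ 2 ℕ.* x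
    signed : ∀ t l → Total t l →
             + t + + l + + 2 ≡ (+ q - + K) * (+ width + + width) + (+ x + + x)
    signed t l eq = trans (r₁ (+ t + + l + + 2) (+ K * + (4 ℕ.* s ℕ.+ 4)))
      (trans (cong (_- + K * + (4 ℕ.* s ℕ.+ 4)) lifted)
        (trans (cong (λ w → + q * w + (+ x + + x) - + K * w) (pos-4s+4 s))
          (r₂ (+ q) (+ K) (+ width + + width) (+ x + + x))))
      where
      r₁ : ∀ u v → u ≡ u + v - v
      r₁ = solve-∀
      r₂ : ∀ q K w y → q * w + y - K * w ≡ (q - K) * w + y
      r₂ = solve-∀
      lifted : + t + + l + + 2 + + K * + (4 ℕ.* s ℕ.+ 4) ≡ + q * + (4 ℕ.* s ℕ.+ 4) + (+ x + + x)
      lifted = trans (cong (λ y → + t + + l + + 2 + y) (sym (ℤ.pos-* K (4 ℕ.* s ℕ.+ 4))))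
        (trans (cong +_ eq) (trans (cong (λ y → + (q ℕ.* (4 ℕ.* s ℕ.+ 4)) + + (x ℕ.+ y)) (ℕ.+-identityʳ x))
          (cong (λ y → y + (+ x + + x)) (ℤ.pos-* q (4 ℕ.* s ℕ.+ 4)))))
    halve-equation : ∀ u → u + u ≡ (+ q - + K) * (+ width + + width) + (+ x + + x) →
                     u ≡ (+ q - + K) * + width + + x
    halve-equation u eq = ℤ.*-cancelˡ-≡ (+ 2) u _ (trans (r₁ u) (trans eq (r₂ (+ q - + K) (+ width) (+ x))))
      where
      r₁ : ∀ u → + 2 * u ≡ u + u
      r₁ = solve-∀
      r₂ : ∀ p w x → p * (w + w) + (x + x) ≡ + 2 * (p * w + x)
      r₂ = solve-∀
    mixed : ∀ h k → 1ℤ + (+ h + + h) + (+ k + + k) + + 2 ≢ (+ q - + K) * (+ width + + width) + (+ x + + x)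
    mixed h k eq = contradiction (remainder-unique {1} {0} {2}
      ((+ q - + K) * + width + + x - (+ h + + k + 1ℤ))
        (s≤s (s≤s z≤n)) (s≤s z≤n)
        (trans (r₁ (+ h) (+ k)) (trans (cong (_- (+ h + + h + (+ k + + k) + + 2)) eq)
          (r₂ (+ q - + K) (+ width) (+ x) (+ h) (+ k))))) λ ()
      where
      r₁ : ∀ h k → 1ℤ ≡ 1ℤ + (h + h) + (k + k) + + 2 - (h + h + (k + k) + + 2)
      r₁ = solve-∀
      r₂ : ∀ p w x h k → p * (w + w) + (x + x) - (h + h + (k + k) + + 2) ≡
           0ℤ + (p * w + x - (h + k + 1ℤ)) * + 2
      r₂ = solve-∀
    match : ∀ t l → Total t l → side 1ℤ (+ suc b) t ≡ Spine.boundary S′ l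
    match t l total with halve t | halve l
    ... | even h | even k = trans (side-even 1ℤ _ h) (trans (period⇒≡ 2F (subst₂ Period
        (trans (r₂ (+ q - + K) (+ width) (+ x)) (trans (cong (_- + x) (sym (halve-equation (1ℤ + + h + + k)
          (trans (r₁ (+ h) (+ k)) (trans
          (cong₂ (λ t l → t + l + + 2) (sym (pos-twice h)) (sym (pos-twice k)))
            (signed (twice h) (twice k) total)))))) (r₃ (+ h) (+ k) (+ x))))
        (sym (ℤ.+-inverseʳ (+ suc b))) (widths-period width-period (+ q - + K))))
        (sym (boundary-even S′ refl centre-S′ k)))
      where
      r₁ : ∀ h k → (1ℤ + h + k) + (1ℤ + h + k) ≡ h + h + (k + k) + + 2
      r₁ = solve-∀
      r₂ : ∀ p w x → p * w ≡ p * w + x - x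
      r₂ = solve-∀
      r₃ : ∀ h k x → 1ℤ + h + k - x ≡ (1ℤ + h) - (x - k)
      r₃ = solve-∀
    ... | odd h | odd k = trans (side-odd 1ℤ _ h) (trans (period⇒≡ 1F (subst₂ Period
        (trans (r₂ (+ q - + K) (+ width) (+ x)) (trans (cong (_- + x) (sym (halve-equation (+ 2 + + h + + k)
          (trans (r₁ (+ h) (+ k)) (trans
          (cong₂ (λ t l → 1ℤ + t + (1ℤ + l) + + 2) (sym (pos-twice h)) (sym (pos-twice k)))
            (signed (suc (twice h)) (suc (twice k)) total)))))) (r₃ (+ h) (+ k) (+ x))))
        (sym (ℤ.+-inverseʳ (+ suc b))) (widths-period width-period (+ q - + K))))
        (sym (boundary-odd S′ refl centre-S′ k)))
      where
      r₁ : ∀ h k → (+ 2 + h + k) + (+ 2 + h + k) ≡ 1ℤ + (h + h) + (1ℤ + (k + k)) + + 2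
      r₁ = solve-∀
      r₂ : ∀ p w x → p * w ≡ p * w + x - x
      r₂ = solve-∀
      r₃ : ∀ h k x → + 2 + h + k - x ≡ (1ℤ + h) - (x - (1ℤ + k))
      r₃ = solve-∀
    ... | odd h | even k = contradiction
      (trans (cong₂ (λ t l → 1ℤ + t + l + + 2) (sym (pos-twice h)) (sym (pos-twice k)))
        (signed (suc (twice h)) (twice k) total)) (mixed h k)
    ... | even h | odd k = contradiction
      (trans (r (+ h) (+ k)) (trans (cong₂
      (λ t l → t + (1ℤ + l) + + 2) (sym (pos-twice h)) (sym (pos-twice k)))
        (signed (twice h) (suc (twice k)) total))) (mixed h k)
      where
      r : ∀ h k → 1ℤ + (h + h) + (k + k) + + 2 ≡ h + h + (1ℤ + (k + k)) + + 2
      r = solve-∀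

  glued : ∀ n k 0<n eq a (y : ℕ → Dart) → (∀ j → α (y j) ≡ side 1ℤ (+ n) (a ℕ.+ j)) →
          Glued y (beltsFrom n k 0<n eq) (shiftsFrom a c k) S′
  glued n zero 0<n eq a y y-side with refl ← trans (sym eq) (ℕ.+-identityʳ n) = last-glue a y y-side
  glued n (suc k) 0<n eq a y y-side =
    (λ j → trans (y-side j) (trans (cong (side 1ℤ (+ n)) (ℕ.+-comm a j))
    (sym (inner-side B refl (j ℕ.+ a))))) ,
    glued (suc n) k z<s _ 1 (Belt.outer B) (α-outer B refl)
    where
    B : Belt width
    B = beltAt width-period only-width 0ℤ (+ n) _

  formation : Formation s b
  formation = record
    { S         = S
    ; S′        = S′
    ; belts     = beltsFrom 1 b z<s refl
    ; shifts    = shiftsFrom 0 c b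
    ; partition = λ d → let j , j≤ , row = row-fold (fold-row d) in
        fromℕ< (s≤s j≤) ,
        row⇒piece width-period S refl _ S′ (aligned 1 b z<s refl) (fromℕ< (s≤s j≤))
          (subst (λ j → Row (+ j) d) (sym (Fin.toℕ-fromℕ< (s≤s j≤))) row) ,
        λ {p} c → Fin.toℕ-injective (trans (Fin.toℕ-fromℕ< (s≤s j≤))
          (row-unique j≤ (Fin.toℕ≤pred[n] p) row
            (piece⇒row width-period S refl _ S′ (aligned 1 b z<s refl) p c)))
    ; glued     = glued 1 b z<s refl 0 (Spine.boundary S) (α-boundary S refl)
    }
    where
    fold-row : ∀ d → Row (proj₁ (proj₂ (proj₂ (onto d)))) d
    fold-row d with k , m , n , refl ← onto d = m , SameFace-at k m n

module _ {s f : ℕ} (f≤s : f ≤ s) where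

  private
    offset₀ : ∀ (T : Trihex) (F : Framing (Trihex.φ T) (Trihex.α T) s 0 (+ (f ℕ.+ 1))) c K c+2x →
              HasOffset (FramingFormation.formation T (f ℕ.+ 1) F c K c+2x) f
    offset₀ T F c K c+2x =
      subst (HasOffset formation) (m<n⇒m%n≡m (s≤s f≤s))
        (noBelts f (subst (FirstMeeting formation) suc-twice (met , first)))
      where
      open FramingFormation T (f ℕ.+ 1) F c K c+2x
      open Framing F
      open TrihexProperties T
      open Pieces T chart s
      open AlignedFormation T chart s
      open Meetings T F formation refl refl
      suc-twice : suc (twice f) ≡ 2 ℕ.* f ℕ.+ 1
      suc-twice = trans (cong suc (twice≡ f)) (ℕ.+-comm 1 (2 ℕ.* f))
      met : Meets formation (suc (twice f))
      met = inj₁ (subst₂ SameVertex (sym (boundary-odd S refl refl f))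
        (trans (cong (λ m → at 2F m 1ℤ) (trans (l (+ suc f)) (cong +_ (ℕ.+-comm 1 f)))) (sym head-at))
        (SameVertex-1-2 _ _))
        where
        l : ∀ m → - (0ℤ - m) ≡ m
        l = solve-∀
      first : ∀ j → j < suc (twice f) → ¬ Meets formation j
      first j j< meets with halve j
      ... | even k = not-even k meets
      -- An earlier odd meeting gives `k ≡ f` modulo `s + 1`; as both are at most `s`, they are
      -- equal.
      ... | odd k with p , eq ← at-odd k meets = ℕ.<⇒≢ j< (cong (suc ∘ twice) (remainder-unique p
              (s≤s (ℕ.≤-trans k≤f f≤s)) (s≤s f≤s)
              (trans (l (+ k)) (trans (cong (_- 1ℤ) eq)
                (trans (cong (λ y → y + p * + suc s - 1ℤ) (ℤ.pos-+ f 1)) (l′ (+ f) (p * + suc s)))))))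
        where
        l : ∀ k → k ≡ 1ℤ + k - 1ℤ
        l = solve-∀
        l′ : ∀ f y → f + 1ℤ + y - 1ℤ ≡ f + y
        l′ = solve-∀
        k≤f : k ≤ f
        k≤f = ℕ.*-cancelˡ-≤ 2 (subst₂ _≤_ (twice≡ k) (twice≡ f) (ℕ.<⇒≤ (ℕ.≤-pred j<)))

    signature-suc : ∀ b (T T₀ : Trihex)
      (F : Framing (Trihex.φ T) (Trihex.α T) s (suc b) (+ (f ℕ.+ suc (suc b))))
                    (F₀ : Framing (Trihex.φ T₀) (Trihex.α T₀) s 0 (+ (f ℕ.+ 1))) (c K : ℕ) →
                    c ℕ.+ 2 ℕ.* (f ℕ.+ suc (suc b)) ≡ K ℕ.* (4 ℕ.* s ℕ.+ 4) →
                    c ℕ.+ 2 ℕ.* suc b ℕ.+ 2 ℕ.* (f ℕ.+ 1) ≡ K ℕ.* (4 ℕ.* s ℕ.+ 4) →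
                    HasSignature T s (suc b) f
    signature-suc b T T₀ F F₀ c K c+2x c₀+2x =
      FramingFormation.formation T (f ℕ.+ suc (suc b)) F c K c+2x ,
      someBelts T₀ (FramingFormation.formation T₀ (f ℕ.+ 1) F₀ (c ℕ.+ 2 ℕ.* suc b) K c₀+2x)
        (sym (deleteBelts-shiftsFrom 0 c (suc b)))
        (offset₀ T₀ F₀ (c ℕ.+ 2 ℕ.* suc b) K c₀+2x)

    signature-zero : ∀ (T : Trihex) (F : Framing (Trihex.φ T) (Trihex.α T) s 0 (+ (f ℕ.+ 1))) (c K : ℕ) →
                     c ℕ.+ 2 ℕ.* (f ℕ.+ 1) ≡ K ℕ.* (4 ℕ.* s ℕ.+ 4) → HasSignature T s 0 f
    signature-zero T F c K c+2x = FramingFormation.formation T (f ℕ.+ 1) F c K c+2x , offset₀ T F c K c+2x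

    -- Shifts are natural numbers, so `- 2x` is represented by `x * (4s + 4) - 2x`.
    last-shift : ∀ x → ∃ λ c → c ℕ.+ 2 ℕ.* x ≡ x ℕ.* (4 ℕ.* s ℕ.+ 4)
    last-shift x = 2 ℕ.* x ℕ.* (2 ℕ.* s ℕ.+ 1) , l x s
      where
      l : ∀ x s → 2 ℕ.* x ℕ.* (2 ℕ.* s ℕ.+ 1) ℕ.+ 2 ℕ.* x ≡ x ℕ.* (4 ℕ.* s ℕ.+ 4)
      l = ℕ-Solver.solve-∀

    regroup : ∀ c b → c ℕ.+ 2 ℕ.* suc b ℕ.+ 2 ℕ.* (f ℕ.+ 1) ≡ c ℕ.+ 2 ℕ.* (f ℕ.+ suc (suc b))
    regroup c b = l c b f
      where
      l : ∀ c b f → c ℕ.+ 2 ℕ.* suc b ℕ.+ 2 ℕ.* (f ℕ.+ 1) ≡ c ℕ.+ 2 ℕ.* (f ℕ.+ suc (suc b))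
      l = ℕ-Solver.solve-∀

  framing⇒signature : ∀ b (T : Trihex) → Framing (Trihex.φ T) (Trihex.α T) s b (+ (f ℕ.+ suc b)) →
                      HasSignature T s b f
  framing⇒signature zero T F with c , c+2x ← last-shift (f ℕ.+ 1) = signature-zero T F c (f ℕ.+ 1) c+2x
  framing⇒signature (suc b) T F with c , c+2x ← last-shift (f ℕ.+ suc (suc b))
    -- The offset refers to an actual trihex with the belts deleted; the model with `x = f + 1`
    -- supplies it.
    with T₀ , F₀ ← model s 0 (+ (f ℕ.+ 1)) =
    signature-suc b T T₀ F F₀ c (f ℕ.+ suc (suc b)) c+2x (trans (regroup c b) c+2x)

-- From signatures to lattices

-- Twice the column at which the second spine starts, modulo 4s + 4, as read off
-- the shifts.
twist : ∀ {b} → ℤ → Vec ℕ (suc b) → ℤ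
twist v (c ∷ [])       = v - 1ℤ - + c
twist v (c ∷ cs@(_ ∷ _)) = twist (v - + c + 1ℤ) cs

twist-+ : ∀ {b} u v (cs : Vec ℕ (suc b)) → twist (u + v) cs ≡ u + twist v cs
twist-+ u v (c ∷ []) = l u v (+ c)
  where
  l : ∀ u v c → u + v - 1ℤ - c ≡ u + (v - 1ℤ - c)
  l = solve-∀
twist-+ u v (c ∷ cs@(_ ∷ _)) = trans (cong (λ v → twist v cs) (l u v (+ c))) (twist-+ u (v - + c + 1ℤ) cs)
  where
  l : ∀ u v c → u + v - c + 1ℤ ≡ u + (v - c + 1ℤ)
  l = solve-∀

-- The 2 is made up of the unit that the lost belt contributed and the unit by which the deletion
-- increases the shift.
twist-deleteBelt : ∀ {b} v (cs : Vec ℕ (suc (suc b))) → twist v cs ≡ + 2 + twist v (deleteBelt cs)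
twist-deleteBelt v (c ∷ c′ ∷ []) = trans (l v (+ c) (+ c′)) (cong (λ y → + 2 + (v - 1ℤ - y)) (sym lifted))
  where
  lifted : + (c ℕ.+ 1 ℕ.+ c′) ≡ + c + 1ℤ + + c′
  lifted = refl
  l : ∀ v c c′ → v - c + 1ℤ - 1ℤ - c′ ≡ + 2 + (v - 1ℤ - (c + 1ℤ + c′))
  l = solve-∀
twist-deleteBelt v (c ∷ c′ ∷ cs@(_ ∷ _)) =
  trans (cong (λ v → twist v cs) (l v (+ c) (+ c′))) (twist-+ (+ 2) (v - (+ c + 1ℤ + + c′) + 1ℤ) cs)
  where
  l : ∀ v c c′ → v - c + 1ℤ - c′ + 1ℤ ≡ + 2 + (v - (c + 1ℤ + c′) + 1ℤ)
  l = solve-∀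

twist-deleteBelts : ∀ {b} v (cs : Vec ℕ (suc b)) → twist v cs ≡ + b + + b + twist v (deleteBelts cs)
twist-deleteBelts {zero}  v cs = sym (ℤ.+-identityˡ _)
twist-deleteBelts {suc b} v cs = trans (twist-deleteBelt v cs)
  (trans (cong (λ y → + 2 + y) (twist-deleteBelts v (deleteBelt cs)))
  (l (+ b) (twist v (deleteBelts (deleteBelt cs)))))
  where
  l : ∀ b y → + 2 + (b + b + y) ≡ (1ℤ + b) + (1ℤ + b) + y
  l = solve-∀

module FormationFraming (T : Trihex) {s b} (D : Parts.Formation T s b) where
  open TrihexProperties T
  open Formation D

  private
    triangle⇒φ³ : ∀ {d} → Triangle d → (φ ^ 3) d ≡ d
    triangle⇒φ³ (_ , φ³ , _) = φ³

    first-triangle : (φ ^ 3) (Spine.first S) ≡ Spine.first S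
    first-triangle = triangle⇒φ³ (Spine.triangle₀ S)

  abstract
    chart : Chart φ α
    chart = chartAt (Spine.first S) first-triangle

    S-first : Spine.first S ≡ Chart.at chart 0F 0ℤ 0ℤ
    S-first = sym (chartAt-origin (Spine.first S) first-triangle)

  open ChartProperties chart
  open Rows chart s
  open Pieces T chart s
  open AlignedFormation T chart s

  -- The last triangle of `S` is centred at `(s + 1 , 0)`, and twice the centre of a triangle is a
  -- period.
  width-period : Period (+ width) 0ℤ
  width-period = subst (λ m → Period m 0ℤ) (trans (l (+ suc s)) (sym (double s)))
    (Period-neg (φ³-fixed⇒ 0F (subst (λ d → (φ ^ 3) d ≡ d) last-face (triangle⇒φ³ (Spine.triangle₁ S)))))
    where
    last-face : Spine.face S (suc s) ≡ at 0F (-1ℤ - (0ℤ + + s)) 0ℤ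
    last-face = trans (cong (λ d → α ((ahead ^ s) d)) S-first)
      (trans (cong α (ahead^-at s 0ℤ 0ℤ)) (α-at0 _ 0ℤ))
    l : ∀ w → - ((-1ℤ - (0ℤ + (w - 1ℤ))) + (-1ℤ - (0ℤ + (w - 1ℤ)))) ≡ w + w
    l = solve-∀

  ahead^-injective : ∀ k {d e} → (ahead ^ k) d ≡ (ahead ^ k) e → d ≡ e
  ahead^-injective zero    eq = eq
  ahead^-injective (suc k) eq = ahead^-injective k
    (trans (sym (α² _)) (trans (cong α (Periodic.^-injective φ 5 face⁶ 3 eq)) (α² _)))

  -- The gluing is read at `j = c`, because the index `c + c` is even whatever `c` is. If `a + c`
  -- were odd, this dart and the next one would force colours 0 and 1 on the same dart; so it is
  -- even, rung `c + 1` is located, and going back along the belt locates the first.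
  belt-aligned : ∀ r n a c (y : ℕ → Dart) (B : Belt width) → (∀ j → α (y j) ≡ side r n (a ℕ.+ j)) →
                 (∀ j → α (y j) ≡ Belt.inner B (j ℕ.+ c)) →
                 ∃ λ r′ → Belt.first B ≡ at 0F r′ n × (1ℤ + r′) + (1ℤ + r′) + 1ℤ ≡ r + r + + a - + c + 1ℤ
  belt-aligned r n a c y B y-side y-inner = go (a ℕ.+ c) refl (halve (a ℕ.+ c))
    where
    open Belt B using (rung; inner)
    c+c : c ℕ.+ c ≡ twice c
    c+c = trans (cong (c ℕ.+_) (sym (ℕ.+-identityʳ c))) (sym (twice≡ c))
    inner₀ : side r n (a ℕ.+ c) ≡ φ (φ (rung (suc c)))
    inner₀ = trans (sym (y-side c)) (trans (y-inner c) (trans (cong inner c+c) even-inner))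
      where
      even-inner : inner (twice c) ≡ φ (φ (rung (suc c)))
      even-inner rewrite parity-even c | half-even c = refl
    inner₁ : side r n (suc (a ℕ.+ c)) ≡ φ (rung (suc c))
    inner₁ = trans (cong (side r n) (sym (ℕ.+-suc a c)))
      (trans (sym (y-side (suc c))) (trans (y-inner (suc c)) (trans (cong (inner ∘ suc) c+c) odd-inner)))
      where
      odd-inner : inner (suc (twice c)) ≡ φ (rung (suc c))
      odd-inner rewrite parity-odd c | half-odd c = refl
    go : ∀ t → t ≡ a ℕ.+ c → Halved t →
         ∃ λ r′ → Belt.first B ≡ at 0F r′ n × (1ℤ + r′) + (1ℤ + r′) + 1ℤ ≡ r + r + + a - + c + 1ℤ
    go _ eq (even h) = r′ , ahead^-injective (suc c) (trans rung≡ (sym (trans (ahead^-at (suc c) r′ n)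
        (cong (λ r → at 0F r n) (l (r + + h) (+ suc c)))))) ,
      trans (l′ r (+ h) (+ c)) (trans
      (cong (λ y → r + r + y - (+ c + + c) + 1ℤ) (trans (sym (pos-twice h)) (cong +_ eq)))
        (l″ r (+ a) (+ c)))
      where
      r′ : ℤ
      r′ = r + + h - + suc c
      rung≡ : rung (suc c) ≡ at 0F (r + + h) n
      rung≡ = Periodic.^-injective φ 5 face⁶ 2 (trans (sym inner₀) (trans (cong (side r n) (sym eq))
        (trans (side-even r n h) (sym (trans (cong φ (φ-at0 _ n)) (φ-at1 _ n))))))
      l : ∀ r c → r - c + c ≡ r
      l = solve-∀
      l′ : ∀ r h c → (1ℤ + (r + h - (1ℤ + c))) + (1ℤ + (r + h - (1ℤ + c))) + 1ℤ ≡ r + r + (h + h) -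
        (c + c) + 1ℤ
      l′ = solve-∀
      l″ : ∀ r a c → r + r + (a + c) - (c + c) + 1ℤ ≡ r + r + a - c + 1ℤ
      l″ = solve-∀
    go _ eq (odd h) = contradiction (colour (trans (sym (φ-at2 _ n)) (trans
      (cong φ (trans (sym (side-even (1ℤ + r) n h)) (trans (cong (side r n ∘ suc) eq) inner₁)))
      (trans (sym inner₀) (trans (cong (side r n) (sym eq)) (side-odd r n h)))))) λ ()

  -- Boundary edge 0 of `S′` is `φ (φ first)` and so locates the spine. Edge 1, which is
  -- `φ (α first)` as `first` lies in a triangle, excludes the odd case by its colour.
  last-aligned : ∀ r n a c (y : ℕ → Dart) (S′ : Spine s) → (∀ j → α (y j) ≡ side r n (a ℕ.+ j)) →
                 (∀ j l → 4 ℕ.* s ℕ.+ 4 ∣ j ℕ.+ c ℕ.+ suc l → α (y j) ≡ Spine.boundary S′ l) →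
                 ∃ λ x → Spine.first S′ ≡ at 0F x n × Period (x + x) (n + n) ×
                 ∃ λ p → x + x ≡ (r + r + + a) - 1ℤ - + c + p * + (4 ℕ.* s ℕ.+ 4)
  last-aligned r n a c y S′ y-side y-boundary = go (a ℕ.+ suc j₀) refl (halve (a ℕ.+ suc j₀))
    where
    open Spine S′ using (first; boundary)
    j₀ : ℕ
    -- This is `(c + 1) * (4s + 4) - c - 2`, so vertex `j₀` is glued to edge 1 of `S′` and `suc j₀`
    -- to edge 0.
    j₀ = 4 ℕ.* s ℕ.+ 2 ℕ.+ c ℕ.* (4 ℕ.* s ℕ.+ 3)
    j₀-total : ∀ c s → (4 ℕ.* s ℕ.+ 2 ℕ.+ c ℕ.* (4 ℕ.* s ℕ.+ 3)) ℕ.+ c ℕ.+ 2 ≡ suc c ℕ.* (4 ℕ.* s ℕ.+ 4)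
    j₀-total = ℕ-Solver.solve-∀
    φ³-first : (φ ^ 3) first ≡ first
    φ³-first = triangle⇒φ³ (Spine.triangle₀ S′)
    boundary₁ : side r n (a ℕ.+ j₀) ≡ φ (α first)
    boundary₁ = trans (sym (y-side j₀)) (trans (y-boundary j₀ 1 (divides (suc c) (j₀-total c s)))
      (cong (φ ∘ α) φ³-first))
    boundary₀ : side r n (a ℕ.+ suc j₀) ≡ φ (φ first)
    boundary₀ = trans (sym (y-side (suc j₀))) (y-boundary (suc j₀) 0
      (divides (suc c) (trans (sym (ℕ.+-suc (j₀ ℕ.+ c) 1)) (j₀-total c s))))
    go : ∀ t → t ≡ a ℕ.+ suc j₀ → Halved t →
         ∃ λ x → first ≡ at 0F x n × Period (x + x) (n + n) ×
         ∃ λ p → x + x ≡ (r + r + + a) - 1ℤ - + c + p * + (4 ℕ.* s ℕ.+ 4)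
    go _ eq (even h) = x , first≡ , φ³-fixed⇒ 0F (subst (λ d → (φ ^ 3) d ≡ d) first≡ φ³-first) , + suc c ,
      trans (l r (+ h)) (trans (cong (λ y → r + r + y) (trans (sym (pos-twice h)) (cong +_ eq)))
        (trans (l′ r (+ a) (+ j₀) (+ c)) (cong (λ y → (r + r + + a) - 1ℤ - + c + y)
          (trans (cong +_ (j₀-total c s)) (ℤ.pos-* (suc c) _)))))
      where
      x : ℤ
      x = r + + h
      first≡ : first ≡ at 0F x n
      first≡ = Periodic.^-injective φ 5 face⁶ 2 (trans (sym boundary₀) (trans (cong (side r n) (sym eq))
        (trans (side-even r n h) (sym (trans (cong φ (φ-at0 _ n)) (φ-at1 _ n))))))
      l : ∀ r h → (r + h) + (r + h) ≡ r + r + (h + h)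
      l = solve-∀
      l′ : ∀ r a j c → r + r + (a + (1ℤ + j)) ≡ (r + r + a) - 1ℤ - c + (j + c + + 2)
      l′ = solve-∀
    go _ eq (odd h) = contradiction (colour (trans (sym (side-even r n h)) (trans
      (cong (side r n) (ℕ.suc-injective (trans eq (ℕ.+-suc a j₀)))) (trans boundary₁
      (trans (cong (φ ∘ α) first≡) (trans (cong φ (α-at2 _ n)) (φ-at2 _ _))))))) λ ()
      where
      first≡ : first ≡ at 2F (r + + h) n
      first≡ = trans (sym φ³-first) (trans
        (cong φ (trans (sym boundary₀) (trans (cong (side r n) (sym eq)) (side-odd r n h))))
        (φ-at1 _ n))

  -- The invariant is `r + r + a`, the start of the current boundary in half columns. A belt glued
  -- with shift `c` changes it to `r + r + a - c + 1`, which is the recursion of `twist`.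
  align : ∀ {k} r n a (y : ℕ → Dart) (Bs : Vec (Belt width) k) (cs : Vec ℕ (suc k)) (S′ : Spine s) →
          (∀ j → α (y j) ≡ side r n (a ℕ.+ j)) → Glued y Bs cs S′ →
          Aligned width-period n Bs S′ ×
          ∃ λ x → Spine.first S′ ≡ at 0F x (n + + k) × Period (x + x) ((n + + k) + (n + + k)) ×
          ∃ λ p → x + x ≡ twist (r + r + + a) cs + p * + (4 ℕ.* s ℕ.+ 4)
  align r n a y [] (c ∷ []) S′ y-side glue with x , first , centre , p , eq ← last-aligned r n a c y S′ y-side glue =
    (x , first , centre) , x , trans first (cong (at 0F x) (sym (ℤ.+-identityʳ n))) ,
    subst (λ n → Period (x + x) (n + n)) (sym (ℤ.+-identityʳ n)) centre , p , eq
  align {suc k} r n a y (B ∷ Bs) (c ∷ cs@(_ ∷ _)) S′ y-side (glue , glues)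
    with r′ , first , v ← belt-aligned r n a c y B y-side glue
    with aligned , x , x-first , centre , p , eq ← align (1ℤ + r′) (1ℤ + n) 1
    (Belt.outer B) Bs cs S′ (α-outer B first) glues =
    ((r′ , first) , aligned) , x , trans x-first (cong (at 0F x) (l n (+ k))) ,
    subst (λ n → Period (x + x) (n + n)) (l n (+ k)) centre , p ,
    trans eq (cong (λ v → twist v cs + p * + (4 ℕ.* s ℕ.+ 4)) v)
    where
    l : ∀ n k → 1ℤ + n + k ≡ n + (1ℤ + k)
    l = solve-∀

  private
    height : ℕ
    height = 2 ℕ.* b ℕ.+ 2

  abstract
    alignment : Aligned width-period 1ℤ belts S′ ×
                ∃ λ x → Spine.first S′ ≡ at 0F x (+ suc b) × Period (x + x) (+ suc b + + suc b) ×
                ∃ λ p → x + x ≡ twist (+ 2) shifts + p * + (4 ℕ.* s ℕ.+ 4)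
    alignment = align 1ℤ 1ℤ 0 (Spine.boundary S) belts shifts S′ (α-boundary S S-first) glued

    aligned : Aligned width-period 1ℤ belts S′
    aligned = proj₁ alignment

    x : ℤ
    x = proj₁ (proj₂ alignment)

    S′-first : Spine.first S′ ≡ at 0F x (+ suc b)
    S′-first = proj₁ (proj₂ (proj₂ alignment))

    height-period : Period (x + x) (+ height)
    height-period = subst (Period (x + x)) (sym (double b)) (proj₁ (proj₂ (proj₂ (proj₂ alignment))))

    x-twist : ∃ λ p → x + x ≡ twist (+ 2) shifts + p * + (4 ℕ.* s ℕ.+ 4)
    x-twist = proj₂ (proj₂ (proj₂ (proj₂ alignment)))

  private
    heights-period : ∀ q → Period (q * (x + x)) (q * + height)
    heights-period q = Period-* q height-period

    -- Such a period puts the dart at the origin both in row 0 and in row `j`, that is, in two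
    -- pieces of the partition unless they agree.
    row-trivial : ∀ {m j} → j ≤ suc b → Period m (+ j) → j ≡ 0
    row-trivial {m} {j} j≤ per = trans (sym (Fin.toℕ-fromℕ< (s≤s j≤))) (cong toℕ (trans
      (sym (proj₂ (proj₂ unique) (row⇒piece width-period S S-first belts S′ aligned (fromℕ< (s≤s j≤))
        (subst (λ j → Row (+ j) origin) (sym (Fin.toℕ-fromℕ< (s≤s j≤))) (m , 0 , per)))))
      (proj₂ (proj₂ unique) (row⇒piece width-period S S-first belts S′ aligned Fin.zero (0ℤ , 0 , refl)))))
      where
      origin : Dart
      origin = at 0F 0ℤ 0ℤ
      unique = partition origin

    -- Such a period identifies face `i` of `S` with its first face.
    column-trivial : ∀ {i} → i ≤ suc s → Period (+ i) 0ℤ → i ≡ 0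
    column-trivial {i} i≤ per = Spine.distinct S i 0 i≤ z≤n
      (SameCycle-trans (SameFace-sym (spineFace-at′ i))
        (SameCycle-trans (0 , trans (cong (λ m → at 0F m 0ℤ) (ℤ.+-identityˡ (+ i))) per) (spineFace-at′ 0)))
      where
      spineFace-at′ : ∀ i → SameFace (at 0F (0ℤ + + i) 0ℤ) (Spine.face S i)
      spineFace-at′ i = subst (λ d → SameFace (at 0F (0ℤ + + i) 0ℤ) (spineFace d i)) (sym S-first)
        (spineFace-at 0ℤ 0ℤ i)

    +-cancel : ∀ i y → i + y - y ≡ i
    +-cancel = solve-∀

    neg-cancel : ∀ i y → - (- i + y) + y ≡ i
    neg-cancel = solve-∀

    columns : ∀ {m} → Period m 0ℤ → ∃ λ p → m ≡ p * + width
    columns {m} per = let i , i≤ , folds = Folding.fold s m in go i i≤ folds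
      where
      go : ∀ i → i ≤ suc s → Folds s m i → ∃ λ p → m ≡ p * + width
      go i i≤ (p , inj₁ eq) = p , trans eq
        (trans (cong (λ i → + i + p * + width) i≡0) (ℤ.+-identityˡ (p * + width)))
        where
        i≡0 : i ≡ 0
        i≡0 = column-trivial i≤ (subst (λ m → Period m 0ℤ)
             (trans (cong (_- p * + width) eq) (+-cancel (+ i) (p * + width)))
             (Period-+ per (Period-neg (widths-period width-period p))))
      go i i≤ (p , inj₂ eq) = p , trans eq
        (trans (cong (λ i → - + i + p * + width) i≡0) (ℤ.+-identityˡ (p * + width)))
        where
        i≡0 : i ≡ 0
        i≡0 = column-trivial i≤ (subst (λ m → Period m 0ℤ)
             (trans (cong (λ m → - m + p * + width) eq) (neg-cancel (+ i) (p * + width)))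
             (Period-+ (Period-neg per) (widths-period width-period p)))

    -- Folding brings the row of a period into the range `0`, ..., `b + 1`, where the partition
    -- makes it 0. The horizontal period that remains is folded in the same way against the faces of
    -- `S`.
    in-lattice : ∀ {m n} → Period m n → InLattice s b x m n
    in-lattice {m} {n} per = let j , j≤ , folds = Folding.fold b n in go j j≤ folds
      where
      go : ∀ j → j ≤ suc b → Folds b n j → InLattice s b x m n
      go j j≤ (q , inj₁ eq) = proj₁ column , q ,
        trans (l m (q * (x + x))) (cong (λ y → y + q * (x + x)) (proj₂ column)) ,
        trans eq (trans (cong (λ j → + j + q * + height) j≡0) (ℤ.+-identityˡ (q * + height)))
        where
        l : ∀ m y → m ≡ m - y + y
        l = solve-∀
        reduced : Period (m - q * (x + x)) (+ j)
        reduced = subst (Period (m - q * (x + x)))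
             (trans (cong (_- q * + height) eq) (+-cancel (+ j) (q * + height)))
             (Period-+ per (Period-neg (heights-period q)))
        j≡0 : j ≡ 0
        j≡0 = row-trivial j≤ reduced
        column : ∃ λ p → m - q * (x + x) ≡ p * + width
        column = columns (subst (λ j → Period (m - q * (x + x)) (+ j)) j≡0 reduced)
      go j j≤ (q , inj₂ eq) = - proj₁ column , q ,
        trans (l m (q * (x + x))) (trans (cong (λ y → - y + q * (x + x)) (proj₂ column))
          (cong (λ y → y + q * (x + x)) (ℤ.neg-distribˡ-* (proj₁ column) (+ width)))) ,
        trans eq (trans (cong (λ j → - + j + q * + height) j≡0) (ℤ.+-identityˡ (q * + height)))
        where
        l : ∀ m y → m ≡ - (- m + y) + y
        l = solve-∀
        reduced : Period (- m + q * (x + x)) (+ j)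
        reduced = subst (Period (- m + q * (x + x)))
             (trans (cong (λ n → - n + q * + height) eq) (neg-cancel (+ j) (q * + height)))
             (Period-+ (Period-neg per) (heights-period q))
        j≡0 : j ≡ 0
        j≡0 = row-trivial j≤ reduced
        column : ∃ λ p → - m + q * (x + x) ≡ p * + width
        column = columns (subst (λ j → Period (- m + q * (x + x)) (+ j)) j≡0 reduced)

  framing : Framing φ α s b x
  framing = record
    { chart          = chart
    ; period⇒lattice = in-lattice
    ; width-period   = width-period
    ; height-period  = height-period
    }

-- A meeting at vertex `2i + 1` fixes `x` as `i + 1` modulo `s + 1`, and the offset is `i` modulo
-- the same number.
offset-column : ∀ (T : Trihex) {s f} (D : Parts.Formation T s 0) → HasOffset D f →
                ∃ λ k → FormationFraming.x T D ≡ + suc f + k * + suc s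
offset-column T {s} D (noBelts i (meets , _)) = + (i ℕ./ suc s) - p ,
  trans (l₁ x (p * + suc s)) (trans (cong (_- p * + suc s) (sym eq))
    (trans (cong (λ i → 1ℤ + i - p * + suc s) i≡) (l₂ (+ (i ℕ.% suc s)) (+ (i ℕ./ suc s)) p (+ suc s))))
  where
  open FormationFraming T D using (x; framing; S-first; S′-first)
  open Meetings T framing D S-first S′-first using (at-odd)
  odd-meeting : ∃ λ p → + suc i ≡ x + p * + suc s
  odd-meeting = at-odd i (subst (Parts.Meets T D)
    (trans (ℕ.+-comm (2 ℕ.* i) 1) (cong suc (sym (twice≡ i)))) meets)
  p : ℤ
  p = proj₁ odd-meeting
  eq : + suc i ≡ x + p * + suc s
  eq = proj₂ odd-meeting
  i≡ : + i ≡ + (i ℕ.% suc s) + + (i ℕ./ suc s) * + suc s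
  i≡ = trans (cong +_ (m≡m%n+[m/n]*n i (suc s)))
    (cong (λ y → + (i ℕ.% suc s) + y) (ℤ.pos-* (i ℕ./ suc s) (suc s)))
  l₁ : ∀ x y → x ≡ x + y - y
  l₁ = solve-∀
  l₂ : ∀ f q p w → 1ℤ + (f + q * w) - p * w ≡ 1ℤ + f + (q - p) * w
  l₂ = solve-∀

-- The two trihexes are compared only through their shifts: by `twist`, `2x` exceeds `2x₀` by twice
-- the number of belts modulo `4s + 4`. Halving keeps this valid modulo `2s + 2`, whence the term
-- `q + q` in units of `s + 1`.
signature-column : ∀ (T : Trihex) {s b f} (D : Parts.Formation T s b) → HasOffset D f →
                   ∃ λ k → FormationFraming.x T D ≡ + (f ℕ.+ suc b) + k * + suc s
signature-column T {s} {zero} {f} D offset with k , eq ← offset-column T D offset =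
  k , trans eq (cong (λ n → + n + k * + suc s) (ℕ.+-comm 1 f))
signature-column T {s} {suc b} {f} D (someBelts T₀ D₀ shifts≡ offset₀) = k + (q + q) , ℤ.*-cancelˡ-≡
  (+ 2) x _
  (trans (l₁ x) (trans (proj₂ x-twist)
    (trans (cong (λ y → y + p * + (4 ℕ.* s ℕ.+ 4)) (twist-deleteBelts (+ 2) (Parts.Formation.shifts D)))
      (trans (cong (λ y → + suc b + + suc b + y + p * + (4 ℕ.* s ℕ.+ 4)) total₀)
        (trans (cong₂ (λ x₀ w → + suc b + + suc b + (x₀ + x₀ - p₀ * w) + p * w) x₀≡
        (trans (pos-4s+4 s) (cong₂ _+_ (double s) (double s))))
          (trans (l₂ (+ suc b) (+ f) k p p₀ (+ suc s))
            (cong (λ n → + 2 * (n + (k + (q + q)) * + suc s)) (sym (ℤ.pos-+ f (suc (suc b)))))))))))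
  where
  open FormationFraming T D using (x; x-twist)
  x₀ p p₀ k q : ℤ
  x₀ = FormationFraming.x T₀ D₀
  p  = proj₁ x-twist
  p₀ = proj₁ (FormationFraming.x-twist T₀ D₀)
  k  = proj₁ (offset-column T₀ D₀ offset₀)
  q  = p - p₀
  x₀≡ : x₀ ≡ + suc f + k * + suc s
  x₀≡ = proj₂ (offset-column T₀ D₀ offset₀)
  total₀ : twist (+ 2) (deleteBelts (Parts.Formation.shifts D)) ≡ x₀ + x₀ - p₀ * + (4 ℕ.* s ℕ.+ 4)
  total₀ = trans (cong (twist (+ 2)) (sym shifts≡)) (trans (l _ (p₀ * + (4 ℕ.* s ℕ.+ 4)))
    (cong (_- p₀ * + (4 ℕ.* s ℕ.+ 4)) (sym (proj₂ (FormationFraming.x-twist T₀ D₀)))))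
    where
    l : ∀ t y → t ≡ t + y - y
    l = solve-∀
  l₁ : ∀ x → + 2 * x ≡ x + x
  l₁ = solve-∀
  l₂ : ∀ b f k p p₀ w →
       b + b + ((1ℤ + f + k * w) + (1ℤ + f + k * w) - p₀ * (w + w + (w + w))) + p * (w + w + (w + w)) ≡
       + 2 * (f + (1ℤ + b) + (k + ((p - p₀) + (p - p₀))) * w)
  l₂ = solve-∀

signature⇒framing : ∀ (T : Trihex) {s b f} → HasSignature T s b f →
                    Framing (Trihex.φ T) (Trihex.α T) s b (+ (f ℕ.+ suc b))
signature⇒framing T {s} {b} {f} (D , offset) with k , eq ← signature-column T D offset =
  subst (Framing _ _ s b) (trans (cong (λ x → x + - k * + suc s) eq) (l (+ (f ℕ.+ suc b)) k (+ suc s)))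
    (reframe (- k) (FormationFraming.framing T D))
  where
  l : ∀ y k w → y + k * w + - k * w ≡ y
  l = solve-∀

framing⇒some-signature : ∀ (T : Trihex) {s b x} → Framing (Trihex.φ T) (Trihex.α T) s b x →
                         ∃[ f ] f ≤ s × HasSignature T s b f
framing⇒some-signature T {s} {b} {x} F = f , f≤s ,
  framing⇒signature f≤s b T (subst (Framing _ _ s b) x≡ (reframe (- q) F))
  where
  f : ℕ
  -- This solves `x = f + b + 1` modulo `s + 1`; the quotient is absorbed by `reframe`.
  f = (x - + suc b) ℤ.%ℕ suc s
  q : ℤ
  q = (x - + suc b) ℤ./ℕ suc s
  f≤s : f ≤ s
  f≤s = ℕ.≤-pred (ℤ.n%ℕd<d (x - + suc b) (suc s))
  l₁ : ∀ x b y → x + - y ≡ x - b - y + b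
  l₁ = solve-∀
  l₂ : ∀ f y b → f + y - y + b ≡ f + b
  l₂ = solve-∀
  x≡ : x + - q * + suc s ≡ + (f ℕ.+ suc b)
  x≡ = trans (cong (λ y → x + y) (sym (ℤ.neg-distribˡ-* q (+ suc s))))
    (trans (l₁ x (+ suc b) (q * + suc s)) (trans
      (cong (λ y → y - q * + suc s + + suc b) (ℤ.a≡a%ℕn+[a/ℕn]*n (x - + suc b) (suc s)))
      (trans (l₂ (+ f) (q * + suc s) (+ suc b)) (sym (ℤ.pos-+ f (suc b))))))

theorem3p6 : (∀ (s b f : ℕ) → f ≤ s → Σ[ T ∈ Trihex ] HasSignature T s b f)
    × (∀ (s b f : ℕ) → f ≤ s → ∀ (T T′ : Trihex) →
    HasSignature T s b f → HasSignature T′ s b f → Equivalent T T′)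
    × (∀ (T : Trihex) → ∃[ s ] ∃[ b ] ∃[ f ] f ≤ s × HasSignature T s b f)
theorem3p6 =
  (λ s b f f≤s → let T , F = model s b (+ (f ℕ.+ suc b)) in T , framing⇒signature f≤s b T F) ,
  (λ s b f f≤s T T′ sig sig′ → framing-equivalent T T′ (signature⇒framing T sig)
  (signature⇒framing T′ sig′)) ,
  (λ T → let s , b , x , F = framed T
             f , f≤s , sig = framing⇒some-signature T F
         in s , b , f , f≤s , sig)
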